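{- For every constant $c>0$, every $\delta\in(0,1)$ and every $\epsilon>0$ there is a randomized algorithm which takes as input a graph $G=(V,E)$ with $n=|V|\ge 2$ vertices, is $(\epsilon,\delta)$-edge differentially private, and with probability at least $1-6n^{ -c}$ outputs a set $S\subseteq V$ with $$\rho(S)\;\ge\;\rho(G)-C\cdot\frac{\sqrt{\log(n)\,\log(n/\delta)}}{\epsilon},$$ where $C$ is a constant depending only on $c$.
   Context: All graphs are simple and undirected; $V$ is public and only $E$ is private. For nonempty $S\subseteq V$, $E(S)$ is the set of edges with both endpoints in $S$, the density is $\rho(S)=|E(S)|/|S|$, and $\rho(G)=\max_{\emptyset\ne S\subseteq V}\rho(S)$. $\log$ is the natural logarithm. Two graphs are edge-neighboring if they have the same vertex set and their edge sets differ in exactly one edge. A randomized algorithm $\mathcal A$ is $(\epsilon,\delta)$-edge differentially private if for all edge-neighboring $G,G'$ and all measurable sets $O$ of outputs, $\Pr[\mathcal A(G)\in O]\le e^{\epsilon}\Pr[\mathcal A(G')\in O]+\delta$. -}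

module Defs where

open import Algebra.Bundles using (CommutativeRing)
import Algebra.Solver.Ring.NaturalCoefficients.Default as NatCoeff
open import Data.Bool.Base using (Bool; false; T; _∧_; _xor_)
open import Data.Fin.Base as Fin using (Fin)
open import Data.Fin.Properties using () renaming (_<?_ to _<ᶠ?_)
open import Data.Fin.Subset as Sub using (Subset; inside; outside)
open import Data.Fin.Subset.Properties using (nonempty?)
import Data.Integer.Base as ℤ
import Data.Integer.Properties as ℤP
open import Data.List.Base as List
  using (List; []; _∷_; _++_; map; filter; filterᵇ; length; foldr; allFin; cartesianProduct)
open import Data.Nat.Base as ℕ using (ℕ; zero; suc)
import Data.Nat.Coprimality as Cop
import Data.Nat.Properties as ℕP
open import Data.Product using (∃-syntax; _×_; _,_; proj₁; proj₂)
open import Data.Rational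
open import Data.Rational.Properties
import Data.Rational.Unnormalised.Base as ℚᵘ
import Data.Rational.Unnormalised.Properties as ℚᵘP
open import Data.Rational.Solver using (module +-*-Solver)
open import Data.Sum.Base using (_⊎_; inj₁; inj₂) renaming (map to ⊎-map; [_,_]′ to ⊎-rec)
open import Data.Vec.Base as Vec using (Vec; lookup)
open import Relation.Binary.PropositionalEquality
  using (_≡_; refl; sym; trans; cong; cong₂; subst; subst₂)
open import Relation.Nullary using (¬_)
open import Relation.Nullary.Negation using (contradiction)

open +-*-Solver using (solve; _:=_; _:+_; _:*_; _:-_; :-_; con)
-- normalises subtraction-free identities far faster than +-*-Solver
module S = NatCoeff (CommutativeRing.commutativeSemiring +-*-commutativeRing)

≤-by : ∀ {p q a b} → p ≤ q → q - p ≡ b - a → a ≤ b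
≤-by {p} {q} {a} {b} p≤q eq =
  subst₂ _≤_ (solve 2 (λ a p → p :+ (a :- p) := a) refl a p)
    (trans (solve 3 (λ a p q → q :+ (a :- p) := a :+ (q :- p)) refl a p q)
      (trans (cong (a +_) eq) (solve 2 (λ a b → a :+ (b :- a) := b) refl a b)))
    (+-monoˡ-≤ (a - p) p≤q)

<-by : ∀ {p q a b} → p < q → q - p ≡ b - a → a < b
<-by {p} {q} {a} {b} p<q eq =
  subst₂ _<_ (solve 2 (λ a p → p :+ (a :- p) := a) refl a p)
    (trans (solve 3 (λ a p q → q :+ (a :- p) := a :+ (q :- p)) refl a p q)
      (trans (cong (a +_) eq) (solve 2 (λ a b → a :+ (b :- a) := b) refl a b)))
    (+-monoˡ-< (a - p) p<q)

0<1 : 0ℚ < 1ℚ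
0<1 = positive⁻¹ 1ℚ

*-monoˡ : ∀ {r p q} → 0ℚ ≤ r → p ≤ q → r * p ≤ r * q
*-monoˡ {r} 0≤r = *-monoˡ-≤-nonNeg r {{nonNegative 0≤r}}

*-monoʳ : ∀ {r p q} → 0ℚ ≤ r → p ≤ q → p * r ≤ q * r
*-monoʳ {r} 0≤r = *-monoʳ-≤-nonNeg r {{nonNegative 0≤r}}

*-mono : ∀ {p q r s} → 0ℚ ≤ p → 0ℚ ≤ s → p ≤ q → r ≤ s → p * r ≤ q * s
*-mono {p} {q} {r} {s} 0≤p 0≤s p≤q r≤s =
  ≤-trans (*-monoˡ {p} {r} {s} 0≤p r≤s) (*-monoʳ {s} {p} {q} 0≤s p≤q)

*-nonNeg : ∀ {p q} → 0ℚ ≤ p → 0ℚ ≤ q → 0ℚ ≤ p * q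
*-nonNeg {p} {q} 0≤p 0≤q = subst (_≤ p * q) (*-zeroʳ p) (*-monoˡ {p} {0ℚ} {q} 0≤p 0≤q)

*-pos : ∀ {p q} → 0ℚ < p → 0ℚ < q → 0ℚ < p * q
*-pos {p} {q} 0<p 0<q = subst (_< p * q) (*-zeroʳ p) (*-monoʳ-<-pos p {{positive 0<p}} 0<q)

+-nonNeg : ∀ {p q} → 0ℚ ≤ p → 0ℚ ≤ q → 0ℚ ≤ p + q
+-nonNeg {p} {q} 0≤p 0≤q = subst (_≤ p + q) (+-identityˡ 0ℚ) (+-mono-≤ {0ℚ} {p} {0ℚ} {q} 0≤p 0≤q)

p≤∣p∣ : ∀ p → p ≤ ∣ p ∣
p≤∣p∣ p with ≤-total 0ℚ p
... | inj₁ 0≤p = ≤-reflexive (sym (0≤p⇒∣p∣≡p 0≤p))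
... | inj₂ p≤0 = ≤-trans p≤0 (0≤∣p∣ p)

∣-∣-flip : ∀ p q → ∣ p - q ∣ ≡ ∣ q - p ∣
∣-∣-flip p q = trans (cong ∣_∣ (solve 2 (λ p q → p :- q := :- (q :- p)) refl p q)) (∣-p∣≡∣p∣ (q - p))

∣-∣-bound : ∀ {p b} → p ≤ b → - p ≤ b → ∣ p ∣ ≤ b
∣-∣-bound {p} {b} p≤b -p≤b with ∣p∣≡p∨∣p∣≡-p p
... | inj₁ eq = subst (_≤ b) (sym eq) p≤b
... | inj₂ eq = subst (_≤ b) (sym eq) -p≤b

-- The proofs below are opaque because type checking would otherwise unfold them into huge terms.
opaque
  halve : ∀ {e} → 0ℚ < e → ∃[ h ] (0ℚ < h × e ≡ h + h)
  halve {e} 0<e = ½ * e , *-pos (positive⁻¹ ½) 0<e ,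
    solve 1 (λ e → e := con ½ :* e :+ con ½ :* e) refl e

ι : ℕ → ℚ
ι n = ℤ.+ n / 1

ι≡ : ∀ n → ι n ≡ mkℚ (ℤ.+ n) 0 (Cop.sym (Cop.1-coprimeTo n))
ι≡ n = normalize-coprime (Cop.sym (Cop.1-coprimeTo n))

ι-suc : ∀ n → ι (suc n) ≡ 1ℚ + ι n
ι-suc n = sym (trans (cong (1ℚ +_) (ι≡ n))
  (cong (λ k → (ℤ.+ 1 ℤ.+ k) / 1) (ℤP.*-identityʳ (ℤ.+ n))))

0≤ι : ∀ n → 0ℚ ≤ ι n
0≤ι n = nonNegative⁻¹ (ι n) {{normalize-nonNeg n 1}}

-- 1/(j+1)
unit : ℕ → ℚ
unit j = ℤ.+ 1 / suc j

unit-inverse : ∀ j → unit j * ι (suc j) ≡ 1ℚ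
unit-inverse j = trans (cong₂ _*_ (normalize-coprime (Cop.1-coprimeTo (suc j))) (ι≡ (suc j)))
  (*-inverseˡ (mkℚ (ℤ.+ suc j) 0 (Cop.sym (Cop.1-coprimeTo (suc j)))))

0≤unit : ∀ j → 0ℚ ≤ unit j
0≤unit j = nonNegative⁻¹ (unit j) {{normalize-nonNeg 1 (suc j)}}

opaque
  reciprocal : ∀ {e} → 0ℚ < e → ∃[ r ] (0ℚ < r × r * e ≡ 1ℚ)
  reciprocal {e} 0<e = (1/ e) , positive⁻¹ (1/ e) {{1/pos⇒pos e}} , *-inverseˡ e
    where instance
      e-pos : Positive e
      e-pos = positive 0<e
      e-nz : NonZero e
      e-nz = pos⇒nonZero e

opaque
  ceil : ∀ p → ∃[ n ] p ≤ ι n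
  ceil p@(mkℚ a d c) = n , subst (p ≤_) (sym (ι≡ n)) (*≤* (begin
      a ℤ.* ℤ.+ 1          ≡⟨ ℤP.*-identityʳ a ⟩
      a                    ≤⟨ a≤∣a∣ a ⟩
      ℤ.+ n                ≤⟨ ℤ.+≤+ (ℕP.m≤m*n n (suc d)) ⟩
      ℤ.+ (n ℕ.* suc d)    ≡⟨ ℤP.pos-* n (suc d) ⟩
      ℤ.+ n ℤ.* ℤ.+ suc d  ∎))
    where
    open ℤP.≤-Reasoning
    n : ℕ
    n = ℤ.∣ a ∣
    a≤∣a∣ : ∀ a → a ℤ.≤ ℤ.+ ℤ.∣ a ∣
    a≤∣a∣ (ℤ.+ n) = ℤP.≤-refl
    a≤∣a∣ ℤ.-[1+ n ] = ℤ.-≤+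

ι-suc-* : ∀ n e → ι (suc n) * e ≡ e + ι n * e
ι-suc-* n e = trans (cong (_* e) (ι-suc n))
  (trans (*-distribʳ-+ e 1ℚ (ι n)) (cong (_+ ι n * e) (*-identityˡ e)))

p<q+p : ∀ {q} p → 0ℚ < q → p < q + p
p<q+p {q} p 0<q = subst (_< q + p) (+-identityˡ p) (+-monoˡ-< p 0<q)

opaque
  archimedes : ∀ p {e} → 0ℚ < e → ∃[ n ] p < ι n * e
  archimedes p {e} 0<e with reciprocal 0<e
  ... | r , 0<r , re≡1 with ceil (p * r)
  ... | n , pr≤n = suc n , subst₂ _<_ p*r*e≡p (sym (ι-suc-* n e))
        (≤-<-trans (*-monoʳ {e} {p * r} {ι n} (<⇒≤ 0<e) pr≤n) (p<q+p (ι n * e) 0<e))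
    where
    p*r*e≡p : p * r * e ≡ p
    p*r*e≡p = trans (*-assoc p r e) (trans (cong (p *_) re≡1) (*-identityʳ p))

opaque
  shrink : ∀ {K e} → 0ℚ ≤ K → 0ℚ < e → ∃[ d ] (0ℚ < d × K * d < e)
  shrink {K} {e} 0≤K 0<e with reciprocal {1ℚ + K} (<-≤-trans 0<1
      (subst (_≤ 1ℚ + K) (+-identityʳ 1ℚ) (+-monoʳ-≤ 1ℚ 0≤K)))
  ... | r , 0<r , r*[1+K]≡1 = d , 0<d , subst (K * d <_) d+Kd≡e (p<q+p (K * d) 0<d)
    where
    d : ℚ
    d = r * e
    0<d : 0ℚ < d
    0<d = *-pos 0<r 0<e
    d+Kd≡e : d + K * d ≡ e
    d+Kd≡e = trans (cong (_+ K * d) (sym (*-identityˡ d))) (trans (sym (*-distribʳ-+ d 1ℚ K))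
      (trans (solve 3 (λ k r e → k :* (r :* e) := (r :* k) :* e) refl (1ℚ + K) r e)
        (trans (cong (_* e) r*[1+K]≡1) (*-identityˡ e))))

≤-cancel : ∀ {p q a b} → p ≤ q → q + a ≡ p + b → a ≤ b
≤-cancel {p} {q} {a} {b} p≤q eq = ≤-by {p} {q} p≤q
  (trans (solve 3 (λ p q a → q :- p := (q :+ a) :- (p :+ a)) refl p q a)
    (trans (cong (_- (p + a)) eq) (solve 3 (λ p a b → (p :+ b) :- (p :+ a) := b :- a) refl p a b)))

[a+b]-[c+d] : ∀ a b c d → (a + b) - (c + d) ≡ (a - c) + (b - d)
[a+b]-[c+d] = solve 4 (λ a b c d → (a :+ b) :- (c :+ d) := (a :- c) :+ (b :- d)) refl

-a--b : ∀ a b → - a - - b ≡ b - a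
-a--b = solve 2 (λ a b → (:- a) :- (:- b) := b :- a) refl

ab-cd : ∀ a b c d → a * b - c * d ≡ a * (b - d) + d * (a - c)
ab-cd = solve 4 (λ a b c d → a :* b :- c :* d := a :* (b :- d) :+ d :* (a :- c)) refl

a-b+b : ∀ a b → (a - b) + b ≡ a
a-b+b = solve 2 (λ a b → (a :- b) :+ b := a) refl

near-eq : ∀ a b e → e - (a - b) ≡ (b + e) - a
near-eq = solve 3 (λ a b e → e :- (a :- b) := (b :+ e) :- a) refl

cotrans-eq₁ : ∀ xn X Z zn d → ((X + d) + (Z + ((zn + d) + d))) + (xn + d)
  ≡ (xn + ((X + ((d + d) + (d + d))) + (Z + 0ℚ))) + zn
cotrans-eq₁ = S.solve 5 (λ xn X Z zn d →
  ((X S.:+ d) S.:+ (Z S.:+ ((zn S.:+ d) S.:+ d))) S.:+ (xn S.:+ d)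
    S.:= (xn S.:+ ((X S.:+ ((d S.:+ d) S.:+ (d S.:+ d))) S.:+ (Z S.:+ S.con 0))) S.:+ zn) refl

cotrans-eq₂ : ∀ zn Z X Y yn d → ((Z + d) + ((X + ((d + d) + (d + d))) + (Y + ((yn + d) + d)))) + (zn + d)
  ≡ (zn + (Z + ((X + (((d + d) + (d + d)) + ((d + d) + (d + d)))) + (Y + 0ℚ)))) + yn
cotrans-eq₂ = S.solve 6 (λ zn Z X Y yn d →
  ((Z S.:+ d) S.:+ ((X S.:+ ((d S.:+ d) S.:+ (d S.:+ d))) S.:+ (Y S.:+ ((yn S.:+ d) S.:+ d))))
    S.:+ (zn S.:+ d)
    S.:= (zn S.:+ (Z S.:+ ((X S.:+ (((d S.:+ d) S.:+ (d S.:+ d)) S.:+ ((d S.:+ d) S.:+ (d S.:+ d))))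
      S.:+ (Y S.:+ S.con 0)))) S.:+ yn) refl

+-near : ∀ a b c d e f → ∣ a - c ∣ < e → ∣ b - d ∣ < f → ∣ (a + b) - (c + d) ∣ < e + f
+-near a b c d e f p q = ≤-<-trans {∣ (a + b) - (c + d) ∣} {∣ a - c ∣ + ∣ b - d ∣} {e + f}
  (subst (λ t → ∣ t ∣ ≤ ∣ a - c ∣ + ∣ b - d ∣) (sym ([a+b]-[c+d] a b c d)) (∣p+q∣≤∣p∣+∣q∣ (a - c) (b - d)))
  (+-mono-< {∣ a - c ∣} {e} {∣ b - d ∣} {f} p q)

neg-near : ∀ a b e → ∣ b - a ∣ < e → ∣ - a - - b ∣ < e
neg-near a b e = subst (λ t → ∣ t ∣ < e) (sym (-a--b a b))

∣-∣-near : ∀ a b e → ∣ a - b ∣ ≤ e → ∣ a ∣ ≤ e + ∣ b ∣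
∣-∣-near a b e p = ≤-trans {∣ a ∣} {∣ a - b ∣ + ∣ b ∣} {e + ∣ b ∣}
  (subst (λ t → ∣ t ∣ ≤ ∣ a - b ∣ + ∣ b ∣) (a-b+b a b) (∣p+q∣≤∣p∣+∣q∣ (a - b) b))
  (+-monoˡ-≤ ∣ b ∣ {∣ a - b ∣} {e} p)

*-near : ∀ a b c d A D δ → 0ℚ ≤ δ → ∣ a ∣ ≤ A → ∣ d ∣ ≤ D → ∣ a - c ∣ ≤ δ → ∣ b - d ∣ ≤ δ →
  ∣ a * b - c * d ∣ ≤ (A + D) * δ
*-near a b c d A D δ 0≤δ aA dD ac bd = begin
    ∣ a * b - c * d ∣
      ≡⟨ cong ∣_∣ (ab-cd a b c d) ⟩
    ∣ a * (b - d) + d * (a - c) ∣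
      ≤⟨ ∣p+q∣≤∣p∣+∣q∣ (a * (b - d)) (d * (a - c)) ⟩
    ∣ a * (b - d) ∣ + ∣ d * (a - c) ∣
      ≡⟨ cong₂ _+_ (∣p*q∣≡∣p∣*∣q∣ a (b - d)) (∣p*q∣≡∣p∣*∣q∣ d (a - c)) ⟩
    ∣ a ∣ * ∣ b - d ∣ + ∣ d ∣ * ∣ a - c ∣
      ≤⟨ +-mono-≤ {∣ a ∣ * ∣ b - d ∣} {A * δ} {∣ d ∣ * ∣ a - c ∣} {D * δ}
           (*-mono {∣ a ∣} {A} {∣ b - d ∣} {δ} (0≤∣p∣ a) 0≤δ aA bd)
           (*-mono {∣ d ∣} {D} {∣ a - c ∣} {δ} (0≤∣p∣ d) 0≤δ dD ac) ⟩
    A * δ + D * δ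
      ≡⟨ sym (*-distribʳ-+ δ A D) ⟩
    (A + D) * δ ∎
  where open ≤-Reasoning

near : ∀ a b e → ∣ a - b ∣ < e → a ≤ b + e
near a b e lt = ≤-by {a - b} {e} {a} {b + e}
  (≤-trans {a - b} {∣ a - b ∣} {e} (p≤∣p∣ (a - b)) (<⇒≤ {∣ a - b ∣} {e} lt)) (near-eq a b e)

cotrans₁ : ∀ xn X Z zn d → 0ℚ < d → ∣ xn - X ∣ < d → X + ((d + d) + (d + d)) ≤ Z → ∣ Z - zn ∣ < d → xn + d ≤ zn
cotrans₁ xn X Z zn d 0<d xX XZ Zz =
  ≤-cancel {xn + ((X + ((d + d) + (d + d))) + (Z + 0ℚ))} {(X + d) + (Z + ((zn + d) + d))} {xn + d} {zn}
    (+-mono-≤ {xn} {X + d} (near xn X d xX)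
      (+-mono-≤ {X + ((d + d) + (d + d))} {Z} XZ
        (+-mono-≤ {Z} {zn + d} {0ℚ} {d} (near Z zn d Zz) (<⇒≤ 0<d))))
    (cotrans-eq₁ xn X Z zn d)

cotrans₂ : ∀ zn Z X Y yn d → 0ℚ < d → ∣ zn - Z ∣ < d → Z ≤ X + ((d + d) + (d + d)) →
  X + (((d + d) + (d + d)) + ((d + d) + (d + d))) ≤ Y → ∣ Y - yn ∣ < d → zn + d ≤ yn
cotrans₂ zn Z X Y yn d 0<d zZ ZX XY Yy =
  ≤-cancel {zn + (Z + ((X + (((d + d) + (d + d)) + ((d + d) + (d + d)))) + (Y + 0ℚ)))}
    {(Z + d) + ((X + ((d + d) + (d + d))) + (Y + ((yn + d) + d)))} {zn + d} {yn}
    (+-mono-≤ {zn} {Z + d} (near zn Z d zZ)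
      (+-mono-≤ {Z} {X + ((d + d) + (d + d))} ZX
        (+-mono-≤ {X + (((d + d) + (d + d)) + ((d + d) + (d + d)))} {Y} XY
          (+-mono-≤ {Y} {yn + d} {0ℚ} {d} (near Y yn d Yy) (<⇒≤ 0<d)))))
    (cotrans-eq₂ zn Z X Y yn d)

opaque
  eighths : ∀ {e} → 0ℚ < e → ∃[ d ] (0ℚ < d × e ≡ ((d + d) + (d + d)) + ((d + d) + (d + d)))
  eighths 0<e with halve 0<e
  ... | h , 0<h , refl with halve 0<h
  ... | k , 0<k , refl with halve 0<k
  ... | d , 0<d , refl = d , 0<d , refl

-- Real numbers as Cauchy sequences of rationals; equality is _≃ᴿ_

record ℝ : Set where
  constructor mkℝ
  field
    seq    : ℕ → ℚ
    cauchy : ∀ e → 0ℚ < e → ∃[ N ] (∀ m n → N ℕ.≤ m → N ℕ.≤ n → ∣ seq m - seq n ∣ < e)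

open ℝ public

infix 4 _<ᴿ_ _≤ᴿ_ _≃ᴿ_
infixl 6 _+ᴿ_ _-ᴿ_
infixl 7 _*ᴿ_ _÷ᴿ_⟨_⟩
infix 8 -ᴿ_ _^ᴿ_

_<ᴿ_ : ℝ → ℝ → Set
x <ᴿ y = ∃[ e ] (0ℚ < e × ∃[ N ] (∀ n → N ℕ.≤ n → seq x n + e ≤ seq y n))

_≤ᴿ_ : ℝ → ℝ → Set
x ≤ᴿ y = ¬ (y <ᴿ x)

_≃ᴿ_ : ℝ → ℝ → Set
x ≃ᴿ y = x ≤ᴿ y × y ≤ᴿ x

opaque
  const-cauchy : ∀ q → ∀ e → 0ℚ < e → ∃[ N ] (∀ m n → N ℕ.≤ m → N ℕ.≤ n → ∣ q - q ∣ < e)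
  const-cauchy q e 0<e = 0 , λ _ _ _ _ → subst (_< e) (sym (cong ∣_∣ (+-inverseʳ q))) 0<e

ofℚ : ℚ → ℝ
ofℚ q = mkℝ (λ _ → q) (const-cauchy q)

0ᴿ 1ᴿ : ℝ
0ᴿ = ofℚ 0ℚ
1ᴿ = ofℚ 1ℚ

ofℕ : ℕ → ℝ
ofℕ n = ofℚ (ι n)

opaque
  +-cauchy : ∀ x y e → 0ℚ < e → ∃[ N ] (∀ m n → N ℕ.≤ m → N ℕ.≤ n →
    ∣ (seq x m + seq y m) - (seq x n + seq y n) ∣ < e)
  +-cauchy x y e 0<e =
    let (h , 0<h , e≡h+h) = halve 0<e
        (M , xM) = cauchy x h 0<h
        (N , yN) = cauchy y h 0<h
    in M ℕ.⊔ N , λ m n m≥ n≥ → subst (∣ (seq x m + seq y m) - (seq x n + seq y n) ∣ <_) (sym e≡h+h)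
      (+-near (seq x m) (seq y m) (seq x n) (seq y n) h h
        (xM m n (ℕP.m⊔n≤o⇒m≤o M N m≥) (ℕP.m⊔n≤o⇒m≤o M N n≥))
        (yN m n (ℕP.m⊔n≤o⇒n≤o M N m≥) (ℕP.m⊔n≤o⇒n≤o M N n≥)))

_+ᴿ_ : ℝ → ℝ → ℝ
x +ᴿ y = mkℝ (λ n → seq x n + seq y n) (+-cauchy x y)

opaque
  neg-cauchy : ∀ x e → 0ℚ < e → ∃[ N ] (∀ m n → N ℕ.≤ m → N ℕ.≤ n →
    ∣ - seq x m - - seq x n ∣ < e)
  neg-cauchy x e 0<e =
    let (N , xN) = cauchy x e 0<e
    in N , λ m n m≥ n≥ → neg-near (seq x m) (seq x n) e (xN n m n≥ m≥)

-ᴿ_ : ℝ → ℝ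
-ᴿ x = mkℝ (λ n → - seq x n) (neg-cauchy x)

_-ᴿ_ : ℝ → ℝ → ℝ
x -ᴿ y = x +ᴿ (-ᴿ y)

opaque
  bounded : ∀ x → ∃[ B ] (0ℚ ≤ B × ∃[ N ] (∀ n → N ℕ.≤ n → ∣ seq x n ∣ ≤ B))
  bounded x =
    let (N , xN) = cauchy x 1ℚ 0<1
    in 1ℚ + ∣ seq x N ∣ , +-nonNeg {1ℚ} {∣ seq x N ∣} (<⇒≤ 0<1) (0≤∣p∣ (seq x N)) , N , λ n n≥ →
      ∣-∣-near (seq x n) (seq x N) 1ℚ (<⇒≤ (xN n N n≥ ℕP.≤-refl))

opaque
  *-cauchy : ∀ x y e → 0ℚ < e → ∃[ N ] (∀ m n → N ℕ.≤ m → N ℕ.≤ n →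
    ∣ seq x m * seq y m - seq x n * seq y n ∣ < e)
  *-cauchy x y e 0<e =
    let (A , 0≤A , L , xL) = bounded x
        (B , 0≤B , L′ , yL) = bounded y
        (d , 0<d , Kd<e) = shrink {A + B} {e} (+-nonNeg 0≤A 0≤B) 0<e
        (M , xM) = cauchy x d 0<d
        (N , yN) = cauchy y d 0<d
        K₁ = L ℕ.⊔ L′
        K₂ = M ℕ.⊔ N
    in K₁ ℕ.⊔ K₂ , λ m n m≥ n≥ →
      ≤-<-trans {∣ seq x m * seq y m - seq x n * seq y n ∣} {(A + B) * d} {e}
        (*-near (seq x m) (seq y m) (seq x n) (seq y n) A B d (<⇒≤ 0<d)
          (xL m (ℕP.m⊔n≤o⇒m≤o L L′ (ℕP.m⊔n≤o⇒m≤o K₁ K₂ m≥)))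
          (yL n (ℕP.m⊔n≤o⇒n≤o L L′ (ℕP.m⊔n≤o⇒m≤o K₁ K₂ n≥)))
          (<⇒≤ (xM m n (ℕP.m⊔n≤o⇒m≤o M N (ℕP.m⊔n≤o⇒n≤o K₁ K₂ m≥)) (ℕP.m⊔n≤o⇒m≤o M N (ℕP.m⊔n≤o⇒n≤o K₁ K₂ n≥))))
          (<⇒≤ (yN m n (ℕP.m⊔n≤o⇒n≤o M N (ℕP.m⊔n≤o⇒n≤o K₁ K₂ m≥)) (ℕP.m⊔n≤o⇒n≤o M N (ℕP.m⊔n≤o⇒n≤o K₁ K₂ n≥)))))
        Kd<e

_*ᴿ_ : ℝ → ℝ → ℝ
x *ᴿ y = mkℝ (λ n → seq x n * seq y n) (*-cauchy x y)

opaque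
  <ᴿ-trans : ∀ {x y z} → x <ᴿ y → y <ᴿ z → x <ᴿ z
  <ᴿ-trans {x} {y} {z} (e , 0<e , M , xy) (e′ , 0<e′ , N , yz) = e , 0<e , M ℕ.⊔ N , λ n n≥ →
    ≤-trans {seq x n + e} {seq y n} {seq z n} (xy n (ℕP.m⊔n≤o⇒m≤o M N n≥))
      (≤-trans {seq y n} {seq y n + e′} {seq z n}
        (<⇒≤ (subst (seq y n <_) (+-comm e′ (seq y n)) (p<q+p (seq y n) 0<e′)))
        (yz n (ℕP.m⊔n≤o⇒n≤o M N n≥)))

opaque
  cotrans : ∀ {x y} → x <ᴿ y → ∀ z → x <ᴿ z ⊎ z <ᴿ y
  cotrans {x} {y} (e , 0<e , N , xy) z =
    let (d , 0<d , e≡8d) = eighths 0<e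
        (Nx , xN) = cauchy x d 0<d
        (Ny , yN) = cauchy y d 0<d
        (Nz , zN) = cauchy z d 0<d
        M₁ = Nx ℕ.⊔ Ny
        M₂ = Nz ℕ.⊔ N
        M = M₁ ℕ.⊔ M₂
        x≥ = λ {n} (n≥ : M ℕ.≤ n) → ℕP.m⊔n≤o⇒m≤o Nx Ny (ℕP.m⊔n≤o⇒m≤o M₁ M₂ n≥)
        y≥ = λ {n} (n≥ : M ℕ.≤ n) → ℕP.m⊔n≤o⇒n≤o Nx Ny (ℕP.m⊔n≤o⇒m≤o M₁ M₂ n≥)
        z≥ = λ {n} (n≥ : M ℕ.≤ n) → ℕP.m⊔n≤o⇒m≤o Nz N (ℕP.m⊔n≤o⇒n≤o M₁ M₂ n≥)
        M≥ = ℕP.≤-refl {M}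
        gap = subst (λ t → seq x M + t ≤ seq y M) e≡8d
                (xy M (ℕP.m⊔n≤o⇒n≤o Nz N (ℕP.m⊔n≤o⇒n≤o M₁ M₂ M≥)))
    in ⊎-map
      (λ le → d , 0<d , M , λ n n≥ →
        cotrans₁ (seq x n) (seq x M) (seq z M) (seq z n) d 0<d (xN n M (x≥ n≥) (x≥ M≥)) le (zN M n (z≥ M≥) (z≥ n≥)))
      (λ le → d , 0<d , M , λ n n≥ →
        cotrans₂ (seq z n) (seq z M) (seq x M) (seq y M) (seq y n) d 0<d
          (zN n M (z≥ n≥) (z≥ M≥)) le gap (yN M n (y≥ M≥) (y≥ n≥)))
      (≤-total (seq x M + ((d + d) + (d + d))) (seq z M))

-- term q j = qʲ / j!
term : ℚ → ℕ → ℚ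
term q zero    = 1ℚ
term q (suc j) = term q j * q * unit j

-- psum q k = Σ_{j ≤ k} qʲ / j!
psum : ℚ → ℕ → ℚ
psum q zero    = 1ℚ
psum q (suc k) = psum q k + term q (suc k)

term-nonNeg : ∀ {q} → 0ℚ ≤ q → ∀ j → 0ℚ ≤ term q j
term-nonNeg 0≤q zero = <⇒≤ 0<1
term-nonNeg {q} 0≤q (suc j) = *-nonNeg {term q j * q} (*-nonNeg {term q j} (term-nonNeg 0≤q j) 0≤q) (0≤unit j)

∣term∣≤ : ∀ {q B} → ∣ q ∣ ≤ B → ∀ j → ∣ term q j ∣ ≤ term B j
∣term∣≤ qB zero = ≤-refl
∣term∣≤ {q} {B} qB (suc j) = subst (_≤ term B (suc j)) (sym eq)
  (*-monoʳ {unit j} {∣ term q j ∣ * ∣ q ∣} {term B j * B} (0≤unit j)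
    (*-mono {∣ term q j ∣} {term B j} {∣ q ∣} {B} (0≤∣p∣ (term q j)) (≤-trans (0≤∣p∣ q) qB) (∣term∣≤ qB j) qB))
  where
  eq : ∣ term q j * q * unit j ∣ ≡ ∣ term q j ∣ * ∣ q ∣ * unit j
  eq = trans (∣p*q∣≡∣p∣*∣q∣ (term q j * q) (unit j))
    (cong₂ _*_ (∣p*q∣≡∣p∣*∣q∣ (term q j) q) (0≤p⇒∣p∣≡p (0≤unit j)))

term-rec : ∀ B j → term B (suc j) * ι (suc j) ≡ term B j * B
term-rec B j = trans (*-assoc (term B j * B) (unit j) (ι (suc j)))
  (trans (cong (term B j * B *_) (unit-inverse j)) (*-identityʳ (term B j * B)))

lip-eq : ∀ B D t t′ n → t′ * n ≡ t * B → B * (D * t) + t′ * D ≡ D * t′ * (1ℚ + n)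
lip-eq B D t t′ n eq = trans
  (S.solve 4 (λ B D t t′ → B S.:* (D S.:* t) S.:+ t′ S.:* D S.:= D S.:* (t S.:* B) S.:+ D S.:* t′) refl B D t t′)
  (trans (cong (λ s → D * s + D * t′) (sym eq))
    (S.solve 3 (λ D t′ n → D S.:* (t′ S.:* n) S.:+ D S.:* t′ S.:= D S.:* t′ S.:* (S.con 1 S.:+ n)) refl D t′ n))

*-unit : ∀ a j → a * ι (suc j) * unit j ≡ a
*-unit a j = trans (*-assoc a (ι (suc j)) (unit j))
  (trans (cong (a *_) (trans (*-comm (ι (suc j)) (unit j)) (unit-inverse j))) (*-identityʳ a))

lip-step : ∀ ta tb a b u → ∣ ta * a * u - tb * b * u ∣ ≡ ∣ a * (ta - tb) + tb * (a - b) ∣ * ∣ u ∣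
lip-step ta tb a b u = trans (cong ∣_∣ (trans
    (solve 3 (λ x y u → x :* u :- y :* u := (x :- y) :* u) refl (ta * a) (tb * b) u)
    (cong (_* u) (trans (cong (_- tb * b) (*-comm ta a)) (trans (cong (λ z → a * ta - z) (*-comm tb b)) (ab-cd a ta b tb))))))
  (∣p*q∣≡∣p∣*∣q∣ (a * (ta - tb) + tb * (a - b)) u)

term-1 : ∀ q → term q 1 ≡ q
term-1 q = trans (*-identityʳ (1ℚ * q)) (*-identityˡ q)

term-lip : ∀ {a b B} → ∣ a ∣ ≤ B → ∣ b ∣ ≤ B → ∀ j →
  ∣ term a (suc j) - term b (suc j) ∣ ≤ ∣ a - b ∣ * term B j
term-lip {a} {b} {B} aB bB zero = ≤-reflexive
  (trans (cong₂ (λ s t → ∣ s - t ∣) (term-1 a) (term-1 b)) (sym (*-identityʳ ∣ a - b ∣)))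
term-lip {a} {b} {B} aB bB (suc j) = begin
    ∣ ta * a * u - tb * b * u ∣
      ≡⟨ lip-step ta tb a b u ⟩
    ∣ a * (ta - tb) + tb * (a - b) ∣ * ∣ u ∣
      ≡⟨ cong (∣ a * (ta - tb) + tb * (a - b) ∣ *_) (0≤p⇒∣p∣≡p (0≤unit (suc j))) ⟩
    ∣ a * (ta - tb) + tb * (a - b) ∣ * u
      ≤⟨ *-monoʳ {u} (0≤unit (suc j)) (∣p+q∣≤∣p∣+∣q∣ (a * (ta - tb)) (tb * (a - b))) ⟩
    (∣ a * (ta - tb) ∣ + ∣ tb * (a - b) ∣) * u
      ≡⟨ cong (_* u) (cong₂ _+_ (∣p*q∣≡∣p∣*∣q∣ a (ta - tb)) (∣p*q∣≡∣p∣*∣q∣ tb (a - b))) ⟩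
    (∣ a ∣ * ∣ ta - tb ∣ + ∣ tb ∣ * D) * u
      ≤⟨ *-monoʳ {u} (0≤unit (suc j)) (+-mono-≤ {∣ a ∣ * ∣ ta - tb ∣} {B * (D * term B j)} {∣ tb ∣ * D} {tB * D}
           (*-mono {∣ a ∣} {B} {∣ ta - tb ∣} {D * term B j} (0≤∣p∣ a)
             (*-nonNeg {D} (0≤∣p∣ (a - b)) (term-nonNeg 0≤B j)) aB (term-lip aB bB j))
           (*-monoʳ {D} {∣ tb ∣} {tB} (0≤∣p∣ (a - b)) (∣term∣≤ bB (suc j)))) ⟩
    (B * (D * term B j) + tB * D) * u
      ≡⟨ cong (_* u) (lip-eq B D (term B j) tB (ι (suc j)) (term-rec B j)) ⟩
    D * tB * (1ℚ + ι (suc j)) * u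
      ≡⟨ cong (λ n → D * tB * n * u) (sym (ι-suc (suc j))) ⟩
    D * tB * ι (suc (suc j)) * u
      ≡⟨ *-unit (D * tB) (suc j) ⟩
    D * tB ∎
  where
  open ≤-Reasoning
  ta = term a (suc j)
  tb = term b (suc j)
  tB = term B (suc j)
  u = unit (suc j)
  D = ∣ a - b ∣
  0≤B : 0ℚ ≤ B
  0≤B = ≤-trans (0≤∣p∣ a) aB

∣sum-diff∣ : ∀ p q s t A C → ∣ p - q ∣ ≤ A → ∣ s - t ∣ ≤ C → ∣ (p + s) - (q + t) ∣ ≤ A + C
∣sum-diff∣ p q s t A C pq st = subst (λ z → ∣ z ∣ ≤ A + C) (sym ([a+b]-[c+d] p s q t))
  (≤-trans (∣p+q∣≤∣p∣+∣q∣ (p - q) (s - t)) (+-mono-≤ {∣ p - q ∣} {A} {∣ s - t ∣} {C} pq st))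

psum-lip⁺ : ∀ {a b B} → ∣ a ∣ ≤ B → ∣ b ∣ ≤ B → ∀ k →
  ∣ psum a (suc k) - psum b (suc k) ∣ ≤ ∣ a - b ∣ * psum B k
psum-lip⁺ {a} {b} {B} aB bB zero = subst (∣ psum a 1 - psum b 1 ∣ ≤_) (+-identityˡ (∣ a - b ∣ * 1ℚ))
  (∣sum-diff∣ 1ℚ 1ℚ (term a 1) (term b 1) 0ℚ (∣ a - b ∣ * 1ℚ) ≤-refl (term-lip aB bB 0))
psum-lip⁺ {a} {b} {B} aB bB (suc k) =
  subst (∣ psum a (suc (suc k)) - psum b (suc (suc k)) ∣ ≤_) (sym (*-distribˡ-+ ∣ a - b ∣ (psum B k) (term B (suc k))))
  (∣sum-diff∣ (psum a (suc k)) (psum b (suc k)) (term a (suc (suc k))) (term b (suc (suc k)))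
    (∣ a - b ∣ * psum B k) (∣ a - b ∣ * term B (suc k)) (psum-lip⁺ aB bB k) (term-lip aB bB (suc k)))

psum-lip : ∀ {a b B K} → ∣ a ∣ ≤ B → ∣ b ∣ ≤ B → 0ℚ ≤ K → (∀ k → psum B k ≤ K) → ∀ k →
  ∣ psum a k - psum b k ∣ ≤ ∣ a - b ∣ * K
psum-lip {a} {b} aB bB 0≤K K≥ zero = *-nonNeg {∣ a - b ∣} (0≤∣p∣ (a - b)) 0≤K
psum-lip {a} {b} {B} {K} aB bB 0≤K K≥ (suc k) = ≤-trans (psum-lip⁺ aB bB k)
  (*-monoˡ {∣ a - b ∣} {psum B k} {K} (0≤∣p∣ (a - b)) (K≥ k))

ι-mono : ∀ i j → ι j ≤ ι (i ℕ.+ j)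
ι-mono zero j = ≤-refl
ι-mono (suc i) j = ≤-trans (ι-mono i j) (subst (ι (i ℕ.+ j) ≤_) (sym (ι-suc (i ℕ.+ j))) (<⇒≤ (p<q+p (ι (i ℕ.+ j)) 0<1)))

ι-mono′ : ∀ {i j} → i ℕ.≤ j → ι i ≤ ι j
ι-mono′ {i} {j} i≤j = subst (λ k → ι i ≤ ι k) (ℕP.m∸n+n≡m i≤j) (ι-mono (j ℕ.∸ i) i)

p≤p+q : ∀ p {q} → 0ℚ ≤ q → p ≤ p + q
p≤p+q p {q} 0≤q = subst (_≤ p + q) (+-identityʳ p) (+-monoʳ-≤ p 0≤q)

module Tail {B : ℚ} (0≤B : 0ℚ ≤ B) (J : ℕ) (2B≤J : B + B ≤ ι J) where

  halving : ∀ i → term B (suc i ℕ.+ J) + term B (suc i ℕ.+ J) ≤ term B (i ℕ.+ J)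
  halving i = subst₂ _≤_ eq (*-identityʳ t)
    (*-monoˡ {t} {(B + B) * unit (i ℕ.+ J)} {1ℚ} (term-nonNeg 0≤B (i ℕ.+ J))
      (subst ((B + B) * unit (i ℕ.+ J) ≤_)
        (trans (*-comm (ι (suc (i ℕ.+ J))) (unit (i ℕ.+ J))) (unit-inverse (i ℕ.+ J)))
        (*-monoʳ {unit (i ℕ.+ J)} {B + B} {ι (suc (i ℕ.+ J))} (0≤unit (i ℕ.+ J))
          (≤-trans 2B≤J (ι-mono (suc i) J)))))
    where
    t = term B (i ℕ.+ J)
    aux : ∀ t B u → t * ((B + B) * u) ≡ t * B * u + t * B * u
    aux = S.solve 3 (λ t B u → t S.:* ((B S.:+ B) S.:* u) S.:= t S.:* B S.:* u S.:+ t S.:* B S.:* u) refl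
    eq : t * ((B + B) * unit (i ℕ.+ J)) ≡ term B (suc i ℕ.+ J) + term B (suc i ℕ.+ J)
    eq = aux t B (unit (i ℕ.+ J))

  psum-bound : ∀ i → psum B (i ℕ.+ J) + term B (i ℕ.+ J) ≤ psum B J + term B J
  psum-bound zero = ≤-refl
  psum-bound (suc i) = ≤-trans
    (subst (_≤ psum B (i ℕ.+ J) + term B (i ℕ.+ J))
      (sym (+-assoc (psum B (i ℕ.+ J)) (term B (suc i ℕ.+ J)) (term B (suc i ℕ.+ J))))
      (+-monoʳ-≤ (psum B (i ℕ.+ J)) (halving i)))
    (psum-bound i)

  psum-mono : ∀ k l → psum B k ≤ psum B (l ℕ.+ k)
  psum-mono k zero = ≤-refl
  psum-mono k (suc l) = ≤-trans (psum-mono k l) (p≤p+q (psum B (l ℕ.+ k)) (term-nonNeg 0≤B (suc l ℕ.+ k)))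

  K : ℚ
  K = psum B J + term B J

  psum≤K : ∀ k → psum B k ≤ K
  psum≤K k = ≤-trans (subst (λ j → psum B k ≤ psum B j) (ℕP.+-comm J k) (psum-mono k J))
    (≤-trans (p≤p+q (psum B (k ℕ.+ J)) (term-nonNeg 0≤B (k ℕ.+ J))) (psum-bound k))

  decay : ∀ i → ι (suc i) * term B (i ℕ.+ J) ≤ term B J
  decay zero = ≤-reflexive (*-identityˡ (term B J))
  decay (suc i) = ≤-trans {ι (suc (suc i)) * t′} {ι (suc i) * (t′ + t′)} step
    (≤-trans (*-monoˡ {ι (suc i)} {t′ + t′} {term B (i ℕ.+ J)} (0≤ι (suc i)) (halving i)) (decay i))
    where
    t′ = term B (suc i ℕ.+ J)
    step : ι (suc (suc i)) * t′ ≤ ι (suc i) * (t′ + t′)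
    step = subst₂ _≤_ (sym (ι-suc-* (suc i) t′)) (sym (*-distribˡ-+ (ι (suc i)) t′ t′))
      (+-monoˡ-≤ (ι (suc i) * t′)
        (subst (_≤ ι (suc i) * t′) (*-identityˡ t′)
          (*-monoʳ {t′} {1ℚ} {ι (suc i)} (term-nonNeg 0≤B (suc i ℕ.+ J))
            (subst (λ k → 1ℚ ≤ ι k) (ℕP.+-comm i 1) (ι-mono i 1)))))

  term-small : ∀ {h} → 0ℚ < h → ∃[ I ] (∀ i → I ℕ.≤ i → term B (i ℕ.+ J) < h)
  term-small {h} 0<h =
    let (I , lt) = archimedes (term B J) 0<h
    in I , λ i I≤i → *-cancelˡ-<-nonNeg (ι (suc i)) {{normalize-nonNeg (suc i) 1}}
      (≤-<-trans (decay i) (<-≤-trans lt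
        (*-monoʳ {h} {ι I} {ι (suc i)} (<⇒≤ 0<h) (ι-mono′ (ℕP.≤-trans I≤i (ℕP.n≤1+n i))))))

  tail : ∀ {b} → ∣ b ∣ ≤ B → ∀ l i →
    ∣ psum b (l ℕ.+ (i ℕ.+ J)) - psum b (i ℕ.+ J) ∣ + term B (l ℕ.+ (i ℕ.+ J)) ≤ term B (i ℕ.+ J)
  tail {b} bB zero i = ≤-reflexive (trans
    (cong (λ t → ∣ t ∣ + term B (i ℕ.+ J)) (+-inverseʳ (psum b (i ℕ.+ J)))) (+-identityˡ (term B (i ℕ.+ J))))
  tail {b} bB (suc l) i = ≤-trans
    (step (psum b (l ℕ.+ n)) (psum b n) (term b (suc l ℕ.+ n)) (term B (suc l ℕ.+ n)) (term B (l ℕ.+ n))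
      (∣term∣≤ bB (suc l ℕ.+ n))
      (subst (λ k → term B (suc k) + term B (suc k) ≤ term B k) (ℕP.+-assoc l i J) (halving (l ℕ.+ i))))
    (tail bB l i)
    where
    n = i ℕ.+ J
    step : ∀ p q s S T → ∣ s ∣ ≤ S → S + S ≤ T → ∣ (p + s) - q ∣ + S ≤ ∣ p - q ∣ + T
    step p q s S T sS ST = ≤-trans
      (+-monoˡ-≤ S (subst (λ z → ∣ z ∣ ≤ ∣ p - q ∣ + S)
        (solve 3 (λ p q s → (p :- q) :+ s := (p :+ s) :- q) refl p q s)
        (≤-trans (∣p+q∣≤∣p∣+∣q∣ (p - q) s) (+-monoʳ-≤ ∣ p - q ∣ sS))))
      (subst (_≤ ∣ p - q ∣ + T) (sym (+-assoc ∣ p - q ∣ S S)) (+-monoʳ-≤ ∣ p - q ∣ ST))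

opaque
  exp-tail : ∀ B → 0ℚ ≤ B → ∃[ K ] (0ℚ ≤ K × (∀ k → psum B k ≤ K) ×
    (∀ {h} → 0ℚ < h → ∃[ N ] (∀ n → N ℕ.≤ n → ∀ b → ∣ b ∣ ≤ B → ∀ l → ∣ psum b (l ℕ.+ n) - psum b n ∣ < h)))
  exp-tail B 0≤B = K , ≤-trans (<⇒≤ 0<1) (psum≤K 0) , psum≤K , λ {h} 0<h →
      let (I , I-small) = term-small 0<h
      in I ℕ.+ J , λ n n≥ b bB l →
        let i    = n ℕ.∸ J
            J≤n  = ℕP.m+n≤o⇒n≤o I n≥
            I≤i  = subst (ℕ._≤ i) (ℕP.m+n∸n≡m I J) (ℕP.∸-monoˡ-≤ J n≥)
        in subst (λ m → ∣ psum b (l ℕ.+ m) - psum b m ∣ < h) (ℕP.m∸n+n≡m J≤n)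
             (≤-<-trans (≤-trans (p≤p+q ∣ psum b (l ℕ.+ (i ℕ.+ J)) - psum b (i ℕ.+ J) ∣
                 (term-nonNeg 0≤B (l ℕ.+ (i ℕ.+ J)))) (tail bB l i)) (I-small i I≤i))
    where
    J : ℕ
    J = proj₁ (ceil (B + B))
    open Tail 0≤B J (proj₂ (ceil (B + B)))

exp-near : ∀ p q r d h K → ∣ p - r ∣ ≤ d * K → K * d < h → ∣ r - q ∣ < h → ∣ p - q ∣ < h + h
exp-near p q r d h K pr Kd<h rq = ≤-<-trans
  (subst (λ z → ∣ z ∣ ≤ ∣ p - r ∣ + ∣ r - q ∣) (solve 3 (λ p q r → (p :- r) :+ (r :- q) := p :- q) refl p q r)
    (∣p+q∣≤∣p∣+∣q∣ (p - r) (r - q)))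
  (+-mono-< {∣ p - r ∣} {h} {∣ r - q ∣} {h} (≤-<-trans pr (subst (_< h) (*-comm K d) Kd<h)) rq)

opaque
  exp-cauchy : ∀ x e → 0ℚ < e → ∃[ N ] (∀ m n → N ℕ.≤ m → N ℕ.≤ n → ∣ psum (seq x m) m - psum (seq x n) n ∣ < e)
  exp-cauchy x e 0<e =
    let (B , 0≤B , L , xB) = bounded x
        (K , 0≤K , K≥ , small) = exp-tail B 0≤B
        (h , 0<h , e≡h+h) = halve 0<e
        (d , 0<d , Kd<h) = shrink {K} {h} 0≤K 0<h
        (M , xM) = cauchy x d 0<d
        (I , I-small) = small 0<h
        N = L ℕ.⊔ (M ℕ.⊔ I)
        L≥ = λ {k} (k≥ : N ℕ.≤ k) → ℕP.m⊔n≤o⇒m≤o L (M ℕ.⊔ I) k≥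
        M≥ = λ {k} (k≥ : N ℕ.≤ k) → ℕP.m⊔n≤o⇒m≤o M I (ℕP.m⊔n≤o⇒n≤o L (M ℕ.⊔ I) k≥)
        I≥ = λ {k} (k≥ : N ℕ.≤ k) → ℕP.m⊔n≤o⇒n≤o M I (ℕP.m⊔n≤o⇒n≤o L (M ℕ.⊔ I) k≥)
        ordered : ∀ m n → N ℕ.≤ m → N ℕ.≤ n → n ℕ.≤ m → ∣ psum (seq x m) m - psum (seq x n) n ∣ < e
        ordered m n m≥ n≥ n≤m = subst (∣ psum (seq x m) m - psum (seq x n) n ∣ <_) (sym e≡h+h)
          (exp-near (psum (seq x m) m) (psum (seq x n) n) (psum (seq x n) m) d h K
            (≤-trans (psum-lip {seq x m} {seq x n} (xB m (L≥ m≥)) (xB n (L≥ n≥)) 0≤K K≥ m)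
              (*-monoʳ {K} {∣ seq x m - seq x n ∣} {d} 0≤K (<⇒≤ (xM m n (M≥ m≥) (M≥ n≥)))))
            Kd<h
            (subst (λ k → ∣ psum (seq x n) k - psum (seq x n) n ∣ < h) (ℕP.m∸n+n≡m n≤m)
              (I-small n (I≥ n≥) (seq x n) (xB n (L≥ n≥)) (m ℕ.∸ n))))
    in N , λ m n m≥ n≥ → ⊎-rec
      (λ n≤m → ordered m n m≥ n≥ n≤m)
      (λ m≤n → subst (_< e) (∣-∣-flip (psum (seq x n) n) (psum (seq x m) m)) (ordered n m n≥ m≥ m≤n))
      (ℕP.≤-total n m)

-- The k-th approximation is the k-th partial sum of the series at the k-th approximation of x.
exp : ℝ → ℝ
exp x = mkℝ (λ k → psum (seq x k) k) (exp-cauchy x)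

term-mono : ∀ {q r} → 0ℚ ≤ q → q ≤ r → ∀ j → term q j ≤ term r j
term-mono 0≤q q≤r zero = ≤-refl
term-mono {q} {r} 0≤q q≤r (suc j) = *-monoʳ {unit j} {term q j * q} {term r j * r} (0≤unit j)
  (*-mono {term q j} {term r j} {q} {r} (term-nonNeg 0≤q j) (≤-trans 0≤q q≤r) (term-mono 0≤q q≤r j) q≤r)

psum-strict : ∀ {q r} → 0ℚ ≤ q → q ≤ r → ∀ k → psum q (suc k) + (r - q) ≤ psum r (suc k)
psum-strict {q} {r} 0≤q q≤r zero = ≤-reflexive (trans (cong (λ t → 1ℚ + t + (r - q)) (term-1 q))
  (trans (aux 1ℚ q r) (cong (1ℚ +_) (sym (term-1 r)))))
  where
  aux : ∀ o q r → o + q + (r - q) ≡ o + r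
  aux = solve 3 (λ o q r → o :+ q :+ (r :- q) := o :+ r) refl
psum-strict {q} {r} 0≤q q≤r (suc k) = subst (_≤ psum r (suc (suc k)))
  (aux (psum q (suc k)) (r - q) (term q (suc (suc k))))
  (+-mono-≤ {psum q (suc k) + (r - q)} {psum r (suc k)} {term q (suc (suc k))} {term r (suc (suc k))}
    (psum-strict 0≤q q≤r k) (term-mono 0≤q q≤r (suc (suc k))))
  where
  aux : ∀ a b c → a + b + c ≡ a + c + b
  aux = S.solve 3 (λ a b c → a S.:+ b S.:+ c S.:= a S.:+ c S.:+ b) refl

opaque
  exp-mono : ∀ q r → 0ℚ ≤ q → q < r → exp (ofℚ q) <ᴿ exp (ofℚ r)
  exp-mono q r 0≤q q<r = r - q , <-by {q} {r} q<r (aux q r) , 1 , λ where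
      zero ()
      (suc k) _ → psum-strict 0≤q (<⇒≤ q<r) k
    where
    aux : ∀ q r → r - q ≡ (r - q) - 0ℚ
    aux = solve 2 (λ q r → r :- q := (r :- q) :- con 0ℚ) refl

psum-1+ : ∀ {q} → 0ℚ ≤ q → ∀ k → 1ℚ + q ≤ psum q (suc k)
psum-1+ {q} 0≤q zero = ≤-reflexive (cong (1ℚ +_) (sym (term-1 q)))
psum-1+ {q} 0≤q (suc k) = ≤-trans (psum-1+ 0≤q k) (p≤p+q (psum q (suc k)) (term-nonNeg 0≤q (suc (suc k))))

opaque
  exp-unbounded : ∀ y → ∃[ b ] (0ℚ < b × y <ᴿ exp (ofℚ b))
  exp-unbounded y =
    let (B , 0≤B , N , yB) = bounded y
        b = 1ℚ + B
        0<b = <-≤-trans 0<1 (p≤p+q 1ℚ 0≤B)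
    in b , 0<b , 1ℚ , 0<1 , suc N , λ where
      zero ()
      (suc k) (ℕ.s≤s N≤k) → ≤-trans
        (≤-trans (+-monoˡ-≤ 1ℚ (≤-trans (p≤∣p∣ (seq y (suc k))) (yB (suc k) (ℕP.≤-trans N≤k (ℕP.n≤1+n k)))))
          (≤-trans (≤-reflexive (+-comm B 1ℚ)) (subst (1ℚ + B ≤_) (+-comm b 1ℚ) (p≤p+q b (<⇒≤ 0<1)))))
        (psum-1+ (<⇒≤ 0<b) k)

opaque
  thirds : ∀ {a b} → a < b → ∃[ w ] (0ℚ < w × b ≡ a + (w + (w + w)))
  thirds {a} {b} a<b = third * (b - a) , *-pos (positive⁻¹ third) (<-by {a} {b} {0ℚ} {b - a} a<b (aux₁ a b)) , aux₂ a b
    where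
    third : ℚ
    third = ℤ.+ 1 / 3
    aux₁ : ∀ a b → b - a ≡ (b - a) - 0ℚ
    aux₁ = solve 2 (λ a b → b :- a := (b :- a) :- con 0ℚ) refl
    aux₂ : ∀ a b → b ≡ a + (third * (b - a) + (third * (b - a) + third * (b - a)))
    aux₂ = solve 2 (λ a b → b := a :+ (con third :* (b :- a) :+ (con third :* (b :- a) :+ con third :* (b :- a)))) refl

p<p+q : ∀ p {q} → 0ℚ < q → p < p + q
p<p+q p {q} 0<q = subst (p <_) (+-comm q p) (p<q+p p 0<q)

within : ∀ {a b p q e} → a ≤ p → p ≤ b → a ≤ q → q ≤ b → b - a < e → ∣ p - q ∣ < e
within {a} {b} {p} {q} a≤p p≤b a≤q q≤b = ≤-<-trans (∣-∣-bound {p - q} {b - a}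
  (+-mono-≤ {p} {b} { - q} { - a} p≤b (neg-antimono-≤ a≤q))
  (subst (_≤ b - a) (aux p q) (+-mono-≤ {q} {b} { - p} { - a} q≤b (neg-antimono-≤ a≤p))))
  where
  aux : ∀ p q → q - p ≡ - (p - q)
  aux = solve 2 (λ p q → q :- p := :- (p :- q)) refl

shrink-width : ∀ n w → 0ℚ ≤ w → ι (3 ℕ.+ n) * (w + w) ≤ ι (2 ℕ.+ n) * (w + (w + w))
shrink-width n w 0≤w = subst₂ _≤_
  (cong (_* (w + w)) (sym ι3)) (trans (aux (ι n) w) (cong (_* (w + (w + w))) (sym ι2)))
  (p≤p+q ((1ℚ + (1ℚ + (1ℚ + ι n))) * (w + w)) (*-nonNeg {ι n} (0≤ι n) 0≤w))
  where
  ι2 : ι (2 ℕ.+ n) ≡ 1ℚ + (1ℚ + ι n)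
  ι2 = trans (ι-suc (suc n)) (cong (1ℚ +_) (ι-suc n))
  ι3 : ι (3 ℕ.+ n) ≡ 1ℚ + (1ℚ + (1ℚ + ι n))
  ι3 = trans (ι-suc (suc (suc n))) (cong (1ℚ +_) ι2)
  aux : ∀ N w → (1ℚ + (1ℚ + (1ℚ + N))) * (w + w) + N * w ≡ (1ℚ + (1ℚ + N)) * (w + (w + w))
  aux = S.solve 2 (λ N w → (S.con 1 S.:+ (S.con 1 S.:+ (S.con 1 S.:+ N))) S.:* (w S.:+ w) S.:+ N S.:* w
    S.:= (S.con 1 S.:+ (S.con 1 S.:+ N)) S.:* (w S.:+ (w S.:+ w))) refl

-- For f strictly increasing on [0,∞), the cut {q | q < 0 or f q < y}: this is f⁻¹(y) if f is
-- continuous and f 0 ≤ y, and 0 if y ≤ f 0.  The cut is located by trisection, since comparing f q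
-- with y is not decidable.
module Inverse (f : ℚ → ℝ) (mono : ∀ q r → 0ℚ ≤ q → q < r → f q <ᴿ f r)
  (y : ℝ) (top : ∃[ b ] (0ℚ < b × y <ᴿ f b)) where

  record Bracket : Set where
    field
      lo hi : ℚ
      0≤lo  : 0ℚ ≤ lo
      lo<hi : lo < hi
      below : lo ≡ 0ℚ ⊎ f lo <ᴿ y
      above : y <ᴿ f hi

  open Bracket

  start : Bracket
  start = record { lo = 0ℚ ; hi = proj₁ top ; 0≤lo = ≤-refl ; lo<hi = proj₁ (proj₂ top)
                 ; below = inj₁ refl ; above = proj₂ (proj₂ top) }

  record Step (s : Bracket) : Set where
    field
      next  : Bracket
      lo≤   : lo s ≤ lo next
      hi≤   : hi next ≤ hi s
      w     : ℚ
      0<w   : 0ℚ < w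
      old   : hi s - lo s ≡ w + (w + w)
      new   : hi next - lo next ≡ w + w

  open Step

  opaque
    step : ∀ s → Step s
    step s =
      let (w , 0<w , hi≡) = thirds (lo<hi s)
          a = lo s
          c = a + w
          d = a + (w + w)
          a<c = p<p+q a 0<w
          c<d = +-monoʳ-< a (p<p+q w 0<w)
          d<hi = subst (d <_) (sym hi≡) (+-monoʳ-< a (+-monoʳ-< w (p<p+q w 0<w)))
          0≤c = ≤-trans (0≤lo s) (<⇒≤ a<c)
          old = trans (cong (_- a) hi≡) (aux a (w + (w + w)))
      in ⊎-rec
        (λ fc<y → record
          { next = record { lo = c ; hi = hi s ; 0≤lo = 0≤c ; lo<hi = <-trans c<d d<hi
                          ; below = inj₂ fc<y ; above = above s }
          ; lo≤ = <⇒≤ a<c ; hi≤ = ≤-refl ; w = w ; 0<w = 0<w ; old = old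
          ; new = trans (cong (_- c) hi≡) (aux′ a w) })
        (λ y<fd → record
          { next = record { lo = a ; hi = d ; 0≤lo = 0≤lo s ; lo<hi = <-trans a<c c<d
                          ; below = below s ; above = y<fd }
          ; lo≤ = ≤-refl ; hi≤ = <⇒≤ d<hi ; w = w ; 0<w = 0<w ; old = old
          ; new = aux a (w + w) })
        (cotrans {f c} {f d} (mono c d 0≤c c<d) y)
      where
      aux : ∀ a v → (a + v) - a ≡ v
      aux = solve 2 (λ a v → (a :+ v) :- a := v) refl
      aux′ : ∀ a w → (a + (w + (w + w))) - (a + w) ≡ w + w
      aux′ = solve 2 (λ a w → (a :+ (w :+ (w :+ w))) :- (a :+ w) := w :+ w) refl

  brackets : ℕ → Bracket
  brackets zero    = start
  brackets (suc n) = next (step (brackets n))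

  width : ℕ → ℚ
  width n = hi (brackets n) - lo (brackets n)

  width-decay : ∀ n → ι (2 ℕ.+ n) * width n ≤ ι 2 * width 0
  width-decay zero = ≤-refl
  width-decay (suc n) = ≤-trans
    (subst₂ _≤_ (cong (ι (3 ℕ.+ n) *_) (sym (new st))) (cong (ι (2 ℕ.+ n) *_) (sym (old st)))
      (shrink-width n (w st) (<⇒≤ (0<w st))))
    (width-decay n)
    where
    st : Step (brackets n)
    st = step (brackets n)

  nested : ∀ k n → lo (brackets n) ≤ lo (brackets (k ℕ.+ n)) × hi (brackets (k ℕ.+ n)) ≤ hi (brackets n)
  nested zero n = ≤-refl , ≤-refl
  nested (suc k) n =
    ≤-trans (proj₁ (nested k n)) (lo≤ (step (brackets (k ℕ.+ n)))) ,
    ≤-trans (hi≤ (step (brackets (k ℕ.+ n)))) (proj₂ (nested k n))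

  nested′ : ∀ {n m} → n ℕ.≤ m → lo (brackets n) ≤ lo (brackets m) × hi (brackets m) ≤ hi (brackets n)
  nested′ {n} {m} n≤m = subst (λ k → lo (brackets n) ≤ lo (brackets k) × hi (brackets k) ≤ hi (brackets n))
    (ℕP.m∸n+n≡m n≤m) (nested (m ℕ.∸ n) n)

  opaque
    width-small : ∀ e → 0ℚ < e → ∃[ N ] (∀ n → N ℕ.≤ n → width n < e)
    width-small e 0<e =
      let (N , lt) = archimedes (ι 2 * width 0) 0<e
      in N , λ n N≤n → *-cancelˡ-<-nonNeg (ι (2 ℕ.+ n)) {{normalize-nonNeg (2 ℕ.+ n) 1}}
        (≤-<-trans (width-decay n) (<-≤-trans lt
          (*-monoʳ {e} {ι N} {ι (2 ℕ.+ n)} (<⇒≤ 0<e) (ι-mono′ (ℕP.≤-trans N≤n (ℕP.m≤n+m n 2))))))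

    hi-cauchy : ∀ e → 0ℚ < e → ∃[ N ] (∀ m n → N ℕ.≤ m → N ℕ.≤ n → ∣ hi (brackets m) - hi (brackets n) ∣ < e)
    hi-cauchy e 0<e =
      let (N , small) = width-small e 0<e
      in N , λ m n m≥ n≥ → within {lo (brackets N)} {hi (brackets N)}
        (≤-trans (proj₁ (nested′ m≥)) (<⇒≤ (lo<hi (brackets m)))) (proj₂ (nested′ m≥))
        (≤-trans (proj₁ (nested′ n≥)) (<⇒≤ (lo<hi (brackets n)))) (proj₂ (nested′ n≥))
        (small N ℕP.≤-refl)

  inverse : ℝ
  inverse = mkℝ (λ n → hi (brackets n)) hi-cauchy

  inverse-above : ∀ q → inverse <ᴿ ofℚ q → y <ᴿ f q
  inverse-above q (e , 0<e , N , lt) = <ᴿ-trans {y} {f h} {f q} (above s)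
    (mono h q (≤-trans (0≤lo s) (<⇒≤ (lo<hi s))) (<-≤-trans (p<p+q h 0<e) (lt N ℕP.≤-refl)))
    where
    s : Bracket
    s = brackets N
    h : ℚ
    h = hi s

  inverse-below : ∀ q → 0ℚ ≤ q → ofℚ q <ᴿ inverse → f q <ᴿ y
  inverse-below q 0≤q (e , 0<e , N , lt) =
    let (M , small) = width-small e 0<e
        n = M ℕ.⊔ N
        l = lo (brackets n)
        h = hi (brackets n)
        q<l = <-by {(h - l) + (q + e)} {e + h} {q} {l}
                (+-mono-<-≤ {h - l} {e} {q + e} {h} (small n (ℕP.m≤m⊔n M N)) (lt n (ℕP.m≤n⊔m M N)))
                (aux e h l q)
    in ⊎-rec
      (λ l≡0 → contradiction (<-≤-trans q<l (subst (_≤ q) (sym l≡0) 0≤q)) (<-irrefl refl))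
      (<ᴿ-trans {f q} {f l} {y} (mono q l 0≤q q<l))
      (below (brackets n))
    where
    aux : ∀ e h l q → (e + h) - ((h - l) + (q + e)) ≡ l - q
    aux = solve 4 (λ e h l q → (e :+ h) :- ((h :- l) :+ (q :+ e)) := l :- q) refl

-- Natural logarithm on [1,∞), and 0 on (-∞,1]
log : ℝ → ℝ
log y = Inverse.inverse (λ q → exp (ofℚ q)) exp-mono y (exp-unbounded y)

opaque
  square-mono : ∀ q r → 0ℚ ≤ q → q < r → ofℚ (q * q) <ᴿ ofℚ (r * r)
  square-mono q r 0≤q q<r = r * r - q * q , <-by {q * q} {r * r} qq<rr (aux (q * q) (r * r)) , 0 ,
    λ _ _ → ≤-reflexive (aux′ (q * q) (r * r))
    where
    qq<rr : q * q < r * r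
    qq<rr = ≤-<-trans (*-monoˡ {q} {q} {r} 0≤q (<⇒≤ q<r))
      (*-monoˡ-<-pos r {{positive (≤-<-trans 0≤q q<r)}} q<r)
    aux : ∀ a b → b - a ≡ (b - a) - 0ℚ
    aux = solve 2 (λ a b → b :- a := (b :- a) :- con 0ℚ) refl
    aux′ : ∀ a b → a + (b - a) ≡ b
    aux′ = solve 2 (λ a b → a :+ (b :- a) := b) refl

opaque
  square-unbounded : ∀ y → ∃[ b ] (0ℚ < b × y <ᴿ ofℚ (b * b))
  square-unbounded y =
    let (B , 0≤B , N , yB) = bounded y
        b = 1ℚ + B
        1≤b = p≤p+q 1ℚ 0≤B
        0<b = <-≤-trans 0<1 1≤b
    in b , 0<b , 1ℚ , 0<1 , N , λ n n≥ → ≤-trans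
        (subst (seq y n + 1ℚ ≤_) (+-comm B 1ℚ) (+-monoˡ-≤ 1ℚ (≤-trans (p≤∣p∣ (seq y n)) (yB n n≥))))
        (subst (_≤ b * b) (*-identityʳ b) (*-monoˡ {b} {1ℚ} {b} (<⇒≤ 0<b) 1≤b))

-- Square root on [0,∞), and 0 on (-∞,0]
√ : ℝ → ℝ
√ y = Inverse.inverse (λ q → ofℚ (q * q)) square-mono y (square-unbounded y)

opaque
  scale-mono : ∀ {x} → 0ᴿ <ᴿ x → ∀ q r → 0ℚ ≤ q → q < r → ofℚ q *ᴿ x <ᴿ ofℚ r *ᴿ x
  scale-mono {x} (e , 0<e , N , ex) q r 0≤q q<r = (r - q) * e , *-pos 0<r-q 0<e , N , λ n n≥ →
    subst (q * seq x n + (r - q) * e ≤_) (aux′ q r (seq x n))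
      (+-monoʳ-≤ (q * seq x n) (*-monoˡ {r - q} {e} {seq x n} (<⇒≤ 0<r-q)
        (subst (_≤ seq x n) (+-identityˡ e) (ex n n≥))))
    where
    aux : ∀ q r → r - q ≡ (r - q) - 0ℚ
    aux = solve 2 (λ q r → r :- q := (r :- q) :- con 0ℚ) refl
    0<r-q : 0ℚ < r - q
    0<r-q = <-by {q} {r} q<r (aux q r)
    aux′ : ∀ q r x → q * x + (r - q) * x ≡ r * x
    aux′ = solve 3 (λ q r x → q :* x :+ (r :- q) :* x := r :* x) refl

opaque
  scale-unbounded : ∀ {x} → 0ᴿ <ᴿ x → ∃[ b ] (0ℚ < b × 1ᴿ <ᴿ ofℚ b *ᴿ x)
  scale-unbounded {x} (e , 0<e , N , ex) =
    let (r , 0<r , re≡1) = reciprocal 0<e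
        b = r + r
        0<b = <-trans 0<r (p<p+q r 0<r)
    in b , 0<b , 1ℚ , 0<1 , N , λ n n≥ →
      subst (_≤ b * seq x n) (trans (*-distribʳ-+ e r r) (cong₂ _+_ re≡1 re≡1))
        (*-monoˡ {b} {e} {seq x n} (<⇒≤ 0<b) (subst (_≤ seq x n) (+-identityˡ e) (ex n n≥)))

-- x · y⁻¹, where y⁻¹ is the solution q of q · y = 1
_÷ᴿ_⟨_⟩ : ℝ → (y : ℝ) → 0ᴿ <ᴿ y → ℝ
x ÷ᴿ y ⟨ 0<y ⟩ = x *ᴿ Inverse.inverse (λ q → ofℚ q *ᴿ y) (scale-mono {y} 0<y) 1ᴿ (scale-unbounded {y} 0<y)

-- n ^ᴿ s = nˢ for n ≥ 1
_^ᴿ_ : ℕ → ℝ → ℝ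
n ^ᴿ s = exp (s *ᴿ log (ofℕ n))

-- Simple undirected graphs on the vertex set Fin n.  Adjacency is stored as a vector with irrelevant
-- proofs, so that graphs with the same edges are propositionally equal.
record Graph (n : ℕ) : Set where
  field
    matrix : Vec (Vec Bool n) n
  adjacent : Fin n → Fin n → Bool
  adjacent i j = lookup (lookup matrix i) j
  field
    .symmetric   : ∀ i j → adjacent i j ≡ adjacent j i
    .irreflexive : ∀ i → adjacent i i ≡ false

open Graph public

-- each unordered pair of distinct vertices once, as (i , j) with i < j
pairs : ∀ n → List (Fin n × Fin n)
pairs n = filter (λ (i , j) → i <ᶠ? j) (cartesianProduct (allFin n) (allFin n))

inducedEdges : ∀ {n} → Graph n → Subset n → List (Fin n × Fin n)
inducedEdges {n} G S = filterᵇ (λ (i , j) → lookup S i ∧ lookup S j ∧ adjacent G i j) (pairs n)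

-- ρ(S); the value at the empty set is a placeholder
density : ∀ {n} → Graph n → Subset n → ℚ
density G S with Sub.∣ S ∣
... | zero  = 0ℚ
... | suc k = (ℤ.+ length (inducedEdges G S)) / suc k

subsets : ∀ n → List (Subset n)
subsets zero    = Vec.[] ∷ []
subsets (suc n) = map (outside Vec.∷_) (subsets n) ++ map (inside Vec.∷_) (subsets n)

-- ρ(G); densities are nonnegative, so 0ℚ does not affect the maximum when n ≥ 1
maxDensity : ∀ {n} → Graph n → ℚ
maxDensity {n} G = foldr _⊔_ 0ℚ (map (density G) (filter nonempty? (subsets n)))

EdgeNeighbouring : ∀ {n} → Graph n → Graph n → Set
EdgeNeighbouring {n} G G′ =
  length (filterᵇ (λ (i , j) → adjacent G i j xor adjacent G′ i j) (pairs n)) ≡ 1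

sumᴿ : List ℝ → ℝ
sumᴿ = foldr _+ᴿ_ 0ᴿ

record Distribution (n : ℕ) : Set where
  field
    mass   : Subset n → ℝ
    nonneg : ∀ S → 0ᴿ ≤ᴿ mass S
    total  : sumᴿ (map mass (subsets n)) ≃ᴿ 1ᴿ

open Distribution public

Pr : ∀ {n} → Distribution n → (Subset n → Bool) → ℝ
Pr {n} D O = sumᴿ (map (mass D) (filterᵇ O (subsets n)))

-- The event P need not be decidable (it may compare real numbers), so its probability is bounded below
-- through a decidable event contained in it.  Classically P itself can serve as O.
PrAtLeast : ∀ {n} → Distribution n → (Subset n → Set) → ℝ → Set
PrAtLeast {n} D P r = ∃[ O ] ((∀ S → T (O S) → P S) × r ≤ᴿ Pr D O)

-- Randomised algorithms that output a set of vertices, given by their output distributions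
Algorithm : Set
Algorithm = ∀ n → 2 ℕ.≤ n → Graph n → Distribution n

EdgePrivate : ℝ → ℝ → Algorithm → Set
EdgePrivate ε δ 𝒜 = ∀ n (2≤n : 2 ℕ.≤ n) (G G′ : Graph n) → EdgeNeighbouring G G′ → ∀ O →
  Pr (𝒜 n 2≤n G) O ≤ᴿ exp ε *ᴿ Pr (𝒜 n 2≤n G′) O +ᴿ δ

{-# OPTIONS --safe #-}
module Submission where

-- The algorithm is purely ε-private: since δ < 1, an additive error O(log n / ε) is already within the
-- claimed bound.  It applies the exponential mechanism twice.  First a size k is drawn with probability
-- proportional to exp(ε′ Dₖ), where Dₖ is the largest density of a k-set; Dₖ changes by at most 1 when an
-- edge changes, and there are only n sizes.  Then a k-set S is drawn with probability proportional to
-- exp(ε′ |E(S)|); the loss in |E(S)| caused by the nᵏ candidates is O(k log n / ε), hence O(log n / ε) in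
-- density.
-- All probabilities are kept rational: exp(ε′/F) is replaced by a rational b = 1 + 2x, and F is a multiple
-- of n!, so that F times a density is a natural number.  Real numbers enter only through
-- b^m ≤ exp(2 x m), exp(x m) ≤ b^m and exp(-x) exp(x) = 1, which follow from the Cauchy product
-- of partial sums of the exponential series.
open import Algebra.Bundles using (CommutativeRing)
import Algebra.Properties.CommutativeSemiring.Exp as Exp
open import Data.Bool.Base using (Bool; true; false; T; not; if_then_else_; _∧_; _xor_)
open import Data.Fin.Base as Fin using ()
open import Data.Fin.Subset as Sub using (Subset; inside; outside; Nonempty)
open import Data.Fin.Subset.Properties using (∣p∣≤n; nonempty?; Empty-unique; ∣⊥∣≡0; ∣⊤∣≡n)
import Data.Integer.Base as ℤ
import Data.Integer.Properties as ℤP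
open import Data.List.Base using (List; []; _∷_; _++_; map; filter; filterᵇ; length; foldr)
open import Data.List.Membership.Propositional using (_∈_)
open import Data.List.Membership.Propositional.Properties using (∈-map⁺; ∈-++⁺ˡ; ∈-++⁺ʳ; ∈-filter⁻)
open import Data.List.Relation.Unary.Any using (here; there)
open import Data.Nat.Base as ℕ using (ℕ; zero; suc; _≡ᵇ_; _!)
import Data.Nat.Divisibility as ℕD
import Data.Nat.DivMod as ℕD
import Data.Nat.Properties as ℕP
open import Data.Product using (∃-syntax; _×_; _,_; proj₁; proj₂)
open import Data.Rational
open import Data.Rational.Properties
open import Data.Rational.Solver using (module +-*-Solver)
import Data.Rational.Unnormalised.Base as ℚᵘ
import Data.Rational.Unnormalised.Properties as ℚᵘP
open import Data.Sum.Base using (_⊎_; inj₁; inj₂) renaming ([_,_]′ to ⊎-rec)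
open import Data.Unit.Base using (tt)
open import Data.Vec.Base as Vec using (lookup)
open import Relation.Binary.PropositionalEquality
  using (_≡_; refl; sym; trans; cong; cong₂; subst; subst₂)
open import Relation.Nullary using (¬_; Dec; yes; no)
open import Relation.Nullary.Decidable using (isYes; _×-dec_; toWitness; toWitnessFalse)
open import Relation.Nullary.Negation using (contradiction)
open import Defs

open +-*-Solver using (solve; _:=_; _:+_; _:*_; _:-_; :-_; con)
open Exp (CommutativeRing.commutativeSemiring +-*-commutativeRing)
  using (_^_; ^-homo-*; ^-assocʳ; ^-distrib-*)

-- The exponential series

-- Scoring all 2^n sets by density in a single draw loses order n / ε under the usual union bound.
-- Once the size k is fixed, the edge count is k times the density, and this factor k in the
-- exponent pays for the number of k-sets: a deficit that multiplies the density score by s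
-- multiplies the edge score by s^k, and for t = 1 / (2 n) the sum of t^|S| over all sets is at most
-- 2. A set is good if its density score is at least s^2 times that of a densest set, where s = t^(m
-- + 1) and m is an integer with m ≥ c; each draw may lose one s. The event in `PrAtLeast` must be
-- Boolean, so goodness compares rationals and the real bound is deduced from it. That bound is a
-- negated strict inequality: a violation supplies a rational ℓ and an index k with n <
-- `psum (ℓ + ℓ) k`, which is refuted by comparing powers, so no logarithm or square root is ever
-- evaluated. The mechanism knows ε only through a rational q with q ≤ ε ≤ 2 q.

ι-+ : ∀ m n → ι (m ℕ.+ n) ≡ ι m + ι n
ι-+ zero    n = sym (+-identityˡ (ι n))
ι-+ (suc m) n = trans (ι-suc (m ℕ.+ n)) (trans (cong (1ℚ +_) (ι-+ m n))
  (trans (sym (+-assoc 1ℚ (ι m) (ι n))) (cong (_+ ι n) (sym (ι-suc m)))))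

-- The Cauchy product. Recursion peels off the head of the first sequence, so the identities below
-- are stated for arbitrary sequences and induct with the first one shifted.
conv : (ℕ → ℚ) → (ℕ → ℚ) → ℕ → ℚ
conv f g zero    = f 0 * g 0
conv f g (suc j) = f 0 * g (suc j) + conv (λ i → f (suc i)) g j

conv-congˡ : ∀ {f f′} g → (∀ i → f i ≡ f′ i) → ∀ j → conv f g j ≡ conv f′ g j
conv-congˡ g f≡ zero    = cong (_* g 0) (f≡ 0)
conv-congˡ g f≡ (suc j) = cong₂ _+_ (cong (_* g (suc j)) (f≡ 0)) (conv-congˡ g (λ i → f≡ (suc i)) j)

conv-congʳ : ∀ f {g g′} → (∀ i → g i ≡ g′ i) → ∀ j → conv f g j ≡ conv f g′ j
conv-congʳ f g≡ zero    = cong (f 0 *_) (g≡ 0)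
conv-congʳ f g≡ (suc j) = cong₂ _+_ (cong (f 0 *_) (g≡ (suc j))) (conv-congʳ (λ i → f (suc i)) g≡ j)

conv-scaleˡ : ∀ c f g j → conv (λ i → f i * c) g j ≡ conv f g j * c
conv-scaleˡ c f g zero    = S.solve 3 (λ c x y → (x S.:* c) S.:* y S.:= (x S.:* y) S.:* c) refl c (f 0) (g 0)
conv-scaleˡ c f g (suc j) = trans (cong (f 0 * c * g (suc j) +_) (conv-scaleˡ c (λ i → f (suc i)) g j))
  (S.solve 4 (λ c x y z → (x S.:* c) S.:* y S.:+ z S.:* c S.:= (x S.:* y S.:+ z) S.:* c) refl
    c (f 0) (g (suc j)) (conv (λ i → f (suc i)) g j))

conv-scaleʳ : ∀ c f g j → conv f (λ i → g i * c) j ≡ conv f g j * c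
conv-scaleʳ c f g zero    = sym (*-assoc (f 0) (g 0) c)
conv-scaleʳ c f g (suc j) = trans (cong (f 0 * (g (suc j) * c) +_) (conv-scaleʳ c (λ i → f (suc i)) g j))
  (S.solve 4 (λ c x y z → x S.:* (y S.:* c) S.:+ z S.:* c S.:= (x S.:* y S.:+ z) S.:* c) refl
    c (f 0) (g (suc j)) (conv (λ i → f (suc i)) g j))

conv-shiftˡ : ∀ f g j → f 0 ≡ 0ℚ → conv f g (suc j) ≡ conv (λ i → f (suc i)) g j
conv-shiftˡ f g j f0 = trans
  (cong (_+ conv (λ i → f (suc i)) g j) (trans (cong (_* g (suc j)) f0) (*-zeroˡ (g (suc j)))))
  (+-identityˡ (conv (λ i → f (suc i)) g j))

conv-shiftʳ : ∀ f g j → g 0 ≡ 0ℚ → conv f g (suc j) ≡ conv f (λ i → g (suc i)) j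
conv-shiftʳ f g zero    g0 = trans
  (cong (f 0 * g 1 +_) (trans (cong (f 1 *_) g0) (*-zeroʳ (f 1)))) (+-identityʳ (f 0 * g 1))
conv-shiftʳ f g (suc j) g0 = cong (f 0 * g (suc (suc j)) +_) (conv-shiftʳ (λ i → f (suc i)) g j g0)

-- With s = 0 this is the product rule for the derivation fᵢ ↦ i fᵢ; the offset s is what the recursion
-- of conv in its first argument requires.
conv-derivation : ∀ s f g j →
  ι (s ℕ.+ j) * conv f g j ≡ conv (λ i → f i * ι (s ℕ.+ i)) g j + conv f (λ i → g i * ι i) j
conv-derivation s f g zero =
  S.solve 3 (λ x y z → x S.:* (y S.:* z) S.:= y S.:* x S.:* z S.:+ y S.:* (z S.:* S.con 0)) refl
    (ι (s ℕ.+ 0)) (f 0) (g 0)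
conv-derivation s f g (suc j) = trans (cong (λ t → t * (f 0 * g (suc j) + C)) eq) (trans
    (S.solve 5 (λ a b x y z → (a S.:+ b) S.:* (x S.:* y S.:+ z)
      S.:= x S.:* a S.:* y S.:+ x S.:* (y S.:* b) S.:+ (a S.:+ b) S.:* z) refl (ι s) (ι (suc j)) (f 0) (g (suc j)) C)
    (trans (cong₂ (λ t u → f 0 * ι t * g (suc j) + f 0 * (g (suc j) * ι (suc j)) + u) (sym (ℕP.+-identityʳ s))
        (trans (cong (_* C) (sym (trans (cong ι (sym (ℕP.+-suc s j))) eq)))
          (trans (conv-derivation (suc s) f′ g j)
            (cong (_+ conv f′ (λ i → g i * ι i) j)
              (conv-congˡ g (λ i → cong (λ k → f′ i * ι k) (sym (ℕP.+-suc s i))) j)))))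
      (S.solve 4 (λ a b c d → (a S.:+ b) S.:+ (c S.:+ d) S.:= (a S.:+ c) S.:+ (b S.:+ d)) refl
        (f 0 * ι (s ℕ.+ 0) * g (suc j)) (f 0 * (g (suc j) * ι (suc j)))
        (conv (λ i → f′ i * ι (s ℕ.+ suc i)) g j) (conv f′ (λ i → g i * ι i) j))))
  where
  f′ : ℕ → ℚ
  f′ i = f (suc i)
  C : ℚ
  C = conv f′ g j
  eq : ι (s ℕ.+ suc j) ≡ ι s + ι (suc j)
  eq = ι-+ s (suc j)

-- The binomial theorem divided by j!. After multiplying coefficient j + 1 by j + 1 and applying the
-- derivation rule, `term-rec` turns the two summands into a and b times coefficient j, which is the
-- recursion of `term (a + b)`.
term-binomial : ∀ a b j → conv (term a) (term b) j ≡ term (a + b) j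
term-binomial a b zero    = refl
term-binomial a b (suc j) = trans (sym (*-unit C j)) (cong (_* unit j) (trans (*-comm C (ι (suc j)))
    (trans (conv-derivation 0 (term a) (term b) (suc j)) (trans (cong₂ _+_ left right)
      (trans (sym (*-distribˡ-+ (conv (term a) (term b) j) a b)) (cong (_* (a + b)) (term-binomial a b j)))))))
  where
  C : ℚ
  C = conv (term a) (term b) (suc j)
  left : conv (λ i → term a i * ι i) (term b) (suc j) ≡ conv (term a) (term b) j * a
  left = trans (conv-shiftˡ (λ i → term a i * ι i) (term b) j refl)
    (trans (conv-congˡ (term b) (term-rec a) j) (conv-scaleˡ a (term a) (term b) j))
  right : conv (term a) (λ i → term b i * ι i) (suc j) ≡ conv (term a) (term b) j * b
  right = trans (conv-shiftʳ (term a) (λ i → term b i * ι i) j refl)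
    (trans (conv-congʳ (term a) (term-rec b) j) (conv-scaleʳ b (term a) (term b) j))

conv-psum : ∀ f b k → conv f (psum b) (suc k) ≡ conv f (psum b) k + conv f (term b) (suc k)
conv-psum f b zero    = S.solve 3 (λ x y t → x S.:* (S.con 1 S.:+ t) S.:+ y S.:* S.con 1
  S.:= x S.:* S.con 1 S.:+ (x S.:* t S.:+ y S.:* S.con 1)) refl (f 0) (f 1) (term b 1)
conv-psum f b (suc k) = trans
  (cong (f 0 * (psum b (suc k) + term b (suc (suc k))) +_) (conv-psum (λ i → f (suc i)) b k))
  (S.solve 5 (λ x p t u v → x S.:* (p S.:+ t) S.:+ (u S.:+ v) S.:= (x S.:* p S.:+ u) S.:+ (x S.:* t S.:+ v)) refl
    (f 0) (psum b (suc k)) (term b (suc (suc k))) (conv (λ i → f (suc i)) (psum b) k)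
    (conv (λ i → f (suc i)) (term b) (suc k)))

-- Convolving with partial sums adds up all products of a term of index i and a term of index j over
-- the triangle i + j ≤ k.
psum-binomial : ∀ a b k → conv (term a) (psum b) k ≡ psum (a + b) k
psum-binomial a b zero    = refl
psum-binomial a b (suc k) = trans
  (conv-psum (term a) b k) (cong₂ _+_ (psum-binomial a b k) (term-binomial a b (suc k)))

-- Σ_{i ≤ k} f i, peeling off f 0 as conv does
Σ≤ : (ℕ → ℚ) → ℕ → ℚ
Σ≤ f zero    = f 0
Σ≤ f (suc k) = f 0 + Σ≤ (λ i → f (suc i)) k

Σ≤-suc : ∀ f k → Σ≤ f (suc k) ≡ Σ≤ f k + f (suc k)
Σ≤-suc f zero    = refl
Σ≤-suc f (suc k) = trans (cong (f 0 +_) (Σ≤-suc (λ i → f (suc i)) k))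
  (sym (+-assoc (f 0) (Σ≤ (λ i → f (suc i)) k) (f (suc (suc k)))))

psum≡Σ≤ : ∀ q k → psum q k ≡ Σ≤ (term q) k
psum≡Σ≤ q zero    = refl
psum≡Σ≤ q (suc k) = trans (cong (_+ term q (suc k)) (psum≡Σ≤ q k)) (sym (Σ≤-suc (term q) k))

conv-nonNeg : ∀ {f g} → (∀ i → 0ℚ ≤ f i) → (∀ i → 0ℚ ≤ g i) → ∀ k → 0ℚ ≤ conv f g k
conv-nonNeg 0≤f 0≤g zero    = *-nonNeg (0≤f 0) (0≤g 0)
conv-nonNeg 0≤f 0≤g (suc k) = +-nonNeg (*-nonNeg (0≤f 0) (0≤g (suc k))) (conv-nonNeg (λ i → 0≤f (suc i)) 0≤g k)

-- The factor paired with f i on the right is g at k + l - i, an index of at least l when i ≤ k. For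
-- g a sequence of partial sums, a rectangle of indices is thus placed inside a triangle.
product≤conv : ∀ {f g} → (∀ i → 0ℚ ≤ f i) → (∀ i → 0ℚ ≤ g i) → (∀ i → g i ≤ g (suc i)) →
  ∀ k l → Σ≤ f k * g l ≤ conv f g (k ℕ.+ l)
product≤conv 0≤f 0≤g g↑ zero    zero    = ≤-refl
product≤conv {f} {g} 0≤f 0≤g g↑ zero (suc l) = p≤p+q (f 0 * g (suc l)) (conv-nonNeg (λ i → 0≤f (suc i)) 0≤g l)
product≤conv {f} {g} 0≤f 0≤g g↑ (suc k) l = subst (_≤ conv f g (suc (k ℕ.+ l)))
  (sym (*-distribʳ-+ (g l) (f 0) (Σ≤ (λ i → f (suc i)) k)))
  (+-mono-≤ (*-monoˡ (0≤f 0) (g-mono (suc k))) (product≤conv (λ i → 0≤f (suc i)) 0≤g g↑ k l))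
  where
  g-mono : ∀ i → g l ≤ g (i ℕ.+ l)
  g-mono zero    = ≤-refl
  g-mono (suc i) = ≤-trans (g-mono i) (g↑ (i ℕ.+ l))

-- The difference is the sum of f i (X - g (k - i)), so it can be majorised term by term. This
-- carries error estimates from nonnegative arguments to signed ones.
product-conv-gap : ∀ {f g F G X Y} k → (∀ i → ∣ f i ∣ ≤ F i) → (∀ j → j ℕ.≤ k → ∣ X - g j ∣ ≤ Y - G j) →
  ∣ Σ≤ f k * X - conv f g k ∣ ≤ Σ≤ F k * Y - conv F G k
product-conv-gap {f} {g} {F} {G} {X} {Y} zero f≤F gap = subst₂ _≤_
  (trans (sym (∣p*q∣≡∣p∣*∣q∣ (f 0) (X - g 0))) (cong ∣_∣ (aux (f 0) X (g 0)))) (aux (F 0) Y (G 0))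
  (*-mono (0≤∣p∣ (f 0)) (≤-trans (0≤∣p∣ (X - g 0)) (gap 0 ℕP.≤-refl)) (f≤F 0) (gap 0 ℕP.≤-refl))
  where
  aux : ∀ a x y → a * (x - y) ≡ a * x - a * y
  aux = solve 3 (λ a x y → a :* (x :- y) := a :* x :- a :* y) refl
product-conv-gap {f} {g} {F} {G} {X} {Y} (suc k) f≤F gap = subst₂ _≤_
  (cong ∣_∣ (aux (f 0) (Σ≤ f′ k) X (g (suc k)) (conv f′ g k))) (aux (F 0) (Σ≤ F′ k) Y (G (suc k)) (conv F′ G k))
  (≤-trans (∣p+q∣≤∣p∣+∣q∣ (f 0 * (X - g (suc k))) (Σ≤ f′ k * X - conv f′ g k))
    (+-mono-≤
      (subst (_≤ F 0 * (Y - G (suc k))) (sym (∣p*q∣≡∣p∣*∣q∣ (f 0) (X - g (suc k))))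
        (*-mono (0≤∣p∣ (f 0)) (≤-trans (0≤∣p∣ (X - g (suc k))) (gap (suc k) ℕP.≤-refl))
          (f≤F 0) (gap (suc k) ℕP.≤-refl)))
      (product-conv-gap k (λ i → f≤F (suc i)) (λ j j≤k → gap j (ℕP.≤-trans j≤k (ℕP.n≤1+n k))))))
  where
  f′ F′ : ℕ → ℚ
  f′ i = f (suc i)
  F′ i = F (suc i)
  aux : ∀ a s x y c → a * (x - y) + (s * x - c) ≡ (a + s) * x - (a * y + c)
  aux = solve 5 (λ a s x y c → a :* (x :- y) :+ (s :* x :- c) := (a :+ s) :* x :- (a :* y :+ c)) refl

psum-step : ∀ {q} → 0ℚ ≤ q → ∀ k → psum q k ≤ psum q (suc k)
psum-step {q} 0≤q k = p≤p+q (psum q k) (term-nonNeg 0≤q (suc k))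

psum-mono-index : ∀ {q} → 0ℚ ≤ q → ∀ {k l} → k ℕ.≤ l → psum q k ≤ psum q l
psum-mono-index {q} 0≤q {k} {l} k≤l = subst (λ j → psum q k ≤ psum q j) (ℕP.m∸n+n≡m k≤l) (go (l ℕ.∸ k))
  where
  go : ∀ i → psum q k ≤ psum q (i ℕ.+ k)
  go zero    = ≤-refl
  go (suc i) = ≤-trans (go i) (psum-step 0≤q (i ℕ.+ k))

psum-mono-arg : ∀ {q r} → 0ℚ ≤ q → q ≤ r → ∀ k → psum q k ≤ psum r k
psum-mono-arg 0≤q q≤r zero    = ≤-refl
psum-mono-arg 0≤q q≤r (suc k) = +-mono-≤ (psum-mono-arg 0≤q q≤r k) (term-mono 0≤q q≤r (suc k))

psum-nonNeg : ∀ {q} → 0ℚ ≤ q → ∀ k → 0ℚ ≤ psum q k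
psum-nonNeg 0≤q k = ≤-trans (<⇒≤ 0<1) (psum-mono-index 0≤q {0} {k} ℕ.z≤n)

psum-gap : ∀ {b B} → ∣ b ∣ ≤ B → ∀ {j k} → j ℕ.≤ k → ∣ psum b k - psum b j ∣ ≤ psum B k - psum B j
psum-gap {b} {B} b≤B {j} {k} j≤k =
  subst (λ m → ∣ psum b m - psum b j ∣ ≤ psum B m - psum B j) (ℕP.m∸n+n≡m j≤k) (go (k ℕ.∸ j))
  where
  aux : ∀ x y t → (x - y) + t ≡ (x + t) - y
  aux = solve 3 (λ x y t → (x :- y) :+ t := (x :+ t) :- y) refl
  go : ∀ i → ∣ psum b (i ℕ.+ j) - psum b j ∣ ≤ psum B (i ℕ.+ j) - psum B j
  go zero    = ≤-reflexive (trans (cong ∣_∣ (+-inverseʳ (psum b j))) (sym (+-inverseʳ (psum B j))))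
  go (suc i) = subst₂ _≤_ (cong ∣_∣ (aux (psum b (i ℕ.+ j)) (psum b j) (term b (suc i ℕ.+ j))))
    (aux (psum B (i ℕ.+ j)) (psum B j) (term B (suc i ℕ.+ j)))
    (≤-trans (∣p+q∣≤∣p∣+∣q∣ (psum b (i ℕ.+ j) - psum b j) (term b (suc i ℕ.+ j)))
      (+-mono-≤ (go i) (∣term∣≤ b≤B (suc i ℕ.+ j))))

psum-product-gap : ∀ {a b A B} → ∣ a ∣ ≤ A → ∣ b ∣ ≤ B → ∀ k →
  ∣ psum a k * psum b k - psum (a + b) k ∣ ≤ psum A k * psum B k - psum (A + B) k
psum-product-gap {a} {b} {A} {B} a≤A b≤B k = subst₂ _≤_
  (cong₂ (λ s t → ∣ s * psum b k - t ∣) (sym (psum≡Σ≤ a k)) (psum-binomial a b k))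
  (cong₂ (λ s t → s * psum B k - t) (sym (psum≡Σ≤ A k)) (psum-binomial A B k))
  (product-conv-gap k (∣term∣≤ a≤A) (λ j → psum-gap b≤B {j} {k}))

psum-product≤ : ∀ {a b} → 0ℚ ≤ a → 0ℚ ≤ b → ∀ k l → psum a k * psum b l ≤ psum (a + b) (k ℕ.+ l)
psum-product≤ {a} {b} 0≤a 0≤b k l = subst₂ _≤_
  (cong (_* psum b l) (sym (psum≡Σ≤ a k))) (psum-binomial a b (k ℕ.+ l))
  (product≤conv (term-nonNeg 0≤a) (psum-nonNeg 0≤b) (psum-step 0≤b) k l)

psum-+≤ : ∀ {a b} → 0ℚ ≤ a → 0ℚ ≤ b → ∀ k → psum (a + b) k ≤ psum a k * psum b k
psum-+≤ {a} {b} 0≤a 0≤b k = ≤-by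
  (≤-trans (0≤∣p∣ (psum a k * psum b k - psum (a + b) k))
    (psum-product-gap (≤-reflexive (0≤p⇒∣p∣≡p 0≤a)) (≤-reflexive (0≤p⇒∣p∣≡p 0≤b)) k))
  (aux (psum a k * psum b k) (psum (a + b) k))
  where
  aux : ∀ x y → (x - y) - 0ℚ ≡ x - y
  aux = solve 2 (λ x y → (x :- y) :- con 0ℚ := x :- y) refl

-- The error is at most the one for `A` and `B`. A square of side n lies in the triangle of size 2
-- n, so that error is at most a tail of the series at A + B. Uniformity in a and b is needed
-- because the argument of `exp` changes with the index.
psum-homomorphic : ∀ {A B} → 0ℚ ≤ A → 0ℚ ≤ B → ∀ {h} → 0ℚ < h →
  ∃[ N ] (∀ n → N ℕ.≤ n → ∀ a b → ∣ a ∣ ≤ A → ∣ b ∣ ≤ B →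
    ∣ psum a n * psum b n - psum (a + b) n ∣ < h)
psum-homomorphic {A} {B} 0≤A 0≤B {h} 0<h =
  let (_ , _ , _ , small) = exp-tail (A + B) (+-nonNeg 0≤A 0≤B)
      (N , tail) = small 0<h
  in N , λ n N≤n a b a≤A b≤B → ≤-<-trans (psum-product-gap a≤A b≤B n)
    (≤-<-trans (+-monoˡ-≤ (- psum (A + B) n) (psum-product≤ 0≤A 0≤B n n))
      (≤-<-trans (p≤∣p∣ (psum (A + B) (n ℕ.+ n) - psum (A + B) n))
        (tail n N≤n (A + B) (≤-reflexive (0≤p⇒∣p∣≡p (+-nonNeg 0≤A 0≤B))) n)))

term-0 : ∀ j → term 0ℚ (suc j) ≡ 0ℚ
term-0 j = trans (cong (_* unit j) (*-zeroʳ (term 0ℚ j))) (*-zeroˡ (unit j))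

psum-0 : ∀ k → psum 0ℚ k ≡ 1ℚ
psum-0 zero    = refl
psum-0 (suc k) = trans (cong₂ _+_ (psum-0 k) (term-0 k)) (+-identityʳ 1ℚ)

psum-neg : ∀ {X} → 0ℚ ≤ X → ∀ {h} → 0ℚ < h →
  ∃[ N ] (∀ n → N ℕ.≤ n → ∀ x → ∣ x ∣ ≤ X → 1ℚ - psum (- x) n * psum x n < h)
psum-neg {X} 0≤X {h} 0<h =
  let (N , near) = psum-homomorphic 0≤X 0≤X 0<h
  in N , λ n N≤n x x≤X → ≤-<-trans (p≤∣p∣ (1ℚ - psum (- x) n * psum x n))
    (subst (_< h)
      (trans (∣-∣-flip (psum (- x) n * psum x n) (psum (- x + x) n))
        (cong (λ t → ∣ t - psum (- x) n * psum x n ∣) (trans (cong (λ t → psum t n) (+-inverseˡ x)) (psum-0 n))))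
      (near n N≤n (- x) x (subst (_≤ X) (sym (∣-p∣≡∣p∣ x)) x≤X) x≤X))

-- Powers and compound growth.

^-nonNeg : ∀ {x} → 0ℚ ≤ x → ∀ n → 0ℚ ≤ x ^ n
^-nonNeg 0≤x zero    = <⇒≤ 0<1
^-nonNeg 0≤x (suc n) = *-nonNeg 0≤x (^-nonNeg 0≤x n)

^-pos : ∀ {x} → 0ℚ < x → ∀ n → 0ℚ < x ^ n
^-pos 0<x zero    = 0<1
^-pos 0<x (suc n) = *-pos 0<x (^-pos 0<x n)

^-monoˡ : ∀ {x y} → 0ℚ ≤ x → x ≤ y → ∀ n → x ^ n ≤ y ^ n
^-monoˡ 0≤x x≤y zero    = ≤-refl
^-monoˡ 0≤x x≤y (suc n) = *-mono 0≤x (^-nonNeg (≤-trans 0≤x x≤y) n) x≤y (^-monoˡ 0≤x x≤y n)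

1≤^ : ∀ {x} → 1ℚ ≤ x → ∀ n → 1ℚ ≤ x ^ n
1≤^ 1≤x zero    = ≤-refl
1≤^ {x} 1≤x (suc n) = subst (_≤ x * x ^ n) (*-identityˡ 1ℚ)
  (*-mono (<⇒≤ 0<1) (^-nonNeg (≤-trans (<⇒≤ 0<1) 1≤x) n) 1≤x (1≤^ 1≤x n))

^-monoʳ : ∀ {x} → 1ℚ ≤ x → ∀ {m n} → m ℕ.≤ n → x ^ m ≤ x ^ n
^-monoʳ {x} 1≤x {m} {n} m≤n = subst (x ^ m ≤_)
  (trans (sym (^-homo-* x (n ℕ.∸ m) m)) (cong (x ^_) (ℕP.m∸n+n≡m m≤n)))
  (subst (_≤ x ^ (n ℕ.∸ m) * x ^ m) (*-identityˡ (x ^ m))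
    (*-monoʳ (^-nonNeg (≤-trans (<⇒≤ 0<1) 1≤x) m) (1≤^ 1≤x (n ℕ.∸ m))))

psum-^ : ∀ {q} → 0ℚ ≤ q → ∀ k c → psum q k ^ c ≤ psum (ι c * q) (c ℕ.* k)
psum-^ {q} 0≤q k zero    = ≤-refl
psum-^ {q} 0≤q k (suc c) = ≤-trans (*-monoˡ (psum-nonNeg 0≤q k) (psum-^ 0≤q k c))
  (≤-trans (psum-product≤ 0≤q (*-nonNeg (0≤ι c) 0≤q) k (c ℕ.* k))
    (≤-reflexive (cong (λ t → psum t (k ℕ.+ c ℕ.* k)) (sym (ι-suc-* c q)))))

psum-*≤^ : ∀ {q} → 0ℚ ≤ q → ∀ k c → psum (ι c * q) k ≤ psum q k ^ c
psum-*≤^ {q} 0≤q k zero    = ≤-reflexive (trans (cong (λ t → psum t k) (*-zeroˡ q)) (psum-0 k))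
psum-*≤^ {q} 0≤q k (suc c) = ≤-trans (≤-reflexive (cong (λ t → psum t k) (ι-suc-* c q)))
  (≤-trans (psum-+≤ 0≤q (*-nonNeg (0≤ι c) 0≤q) k) (*-monoˡ (psum-nonNeg 0≤q k) (psum-*≤^ 0≤q k c)))

-- 1 + y is the partial sum of index 1, so its m-th power is below the partial sum of index m
-- already, without passing to a limit.
compound≤psum : ∀ {y} → 0ℚ ≤ y → ∀ {m k} → m ℕ.≤ k → (1ℚ + y) ^ m ≤ psum (ι m * y) k
compound≤psum {y} 0≤y {m} {k} m≤k = ≤-trans
  (subst (λ t → t ^ m ≤ psum (ι m * y) (m ℕ.* 1)) (cong (1ℚ +_) (term-1 y)) (psum-^ 0≤y 1 m))
  (psum-mono-index (*-nonNeg (0≤ι m) 0≤y) (subst (ℕ._≤ k) (sym (ℕP.*-identityʳ m)) m≤k))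

-- The tail bound of Defs applies from the index J = 1 on because x + x ≤ 1.
psum-linear : ∀ {x} → 0ℚ ≤ x → x + x ≤ 1ℚ → ∀ k → psum x k ≤ 1ℚ + (x + x)
psum-linear {x} 0≤x 2x≤1 k = subst (psum x k ≤_)
  (trans (cong (λ t → (1ℚ + t) + t) (term-1 x)) (+-assoc 1ℚ x x)) (Tail.psum≤K 0≤x 1 2x≤1 k)

psum≤compound : ∀ {x} → 0ℚ ≤ x → x + x ≤ 1ℚ → ∀ m k → psum (ι m * x) k ≤ (1ℚ + (x + x)) ^ m
psum≤compound 0≤x 2x≤1 m k = ≤-trans (psum-*≤^ 0≤x k m) (^-monoˡ (psum-nonNeg 0≤x k) (psum-linear 0≤x 2x≤1 k) m)

-- Real numbers

¬p≤q∧q+e≤p : ∀ {p q e} → 0ℚ < e → p ≤ q → ¬ q + e ≤ p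
¬p≤q∧q+e≤p {p} {q} {e} 0<e p≤q q+e≤p = <-irrefl refl (<-≤-trans (p<p+q q 0<e) (≤-trans q+e≤p p≤q))

≤ᴿ-eventually : ∀ x y N → (∀ n → N ℕ.≤ n → seq x n ≤ seq y n) → x ≤ᴿ y
≤ᴿ-eventually x y N x≤y (e , 0<e , M , y<x) =
  ¬p≤q∧q+e≤p 0<e (x≤y (N ℕ.⊔ M) (ℕP.m≤m⊔n N M)) (y<x (N ℕ.⊔ M) (ℕP.m≤n⊔m N M))

eventually-positive : ∀ {x} → 0ᴿ <ᴿ x → ∃[ N ] (∀ n → N ℕ.≤ n → 0ℚ ≤ seq x n)
eventually-positive {x} (e , 0<e , N , e≤x) = N , λ n N≤n →
  ≤-trans (<⇒≤ 0<e) (subst (_≤ seq x n) (+-identityˡ e) (e≤x n N≤n))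

eventually-below : ∀ x → ∃[ c ] ∃[ N ] (∀ n → N ℕ.≤ n → seq x n ≤ ι c)
eventually-below x =
  let (B , _ , N , x≤B) = bounded x
      (c , B≤c) = ceil B
  in c , N , λ n N≤n → ≤-trans (p≤∣p∣ (seq x n)) (≤-trans (x≤B n N≤n) B≤c)

-- For an approximation X of error d with 4 d ≤ X, the choice q = X - d gives X + d ≤ 2 q. The
-- factor two ends up in the constant of the theorem.
dyadic-bounds : ∀ {x} → 0ᴿ <ᴿ x →
  ∃[ q ] (0ℚ < q × ∃[ N ] (∀ n → N ℕ.≤ n → q ≤ seq x n × seq x n ≤ q + q))
dyadic-bounds {x} (e , 0<e , N , e≤x) =
  let (h , 0<h , e≡h+h) = halve 0<e
      (d , 0<d , h≡d+d) = halve 0<h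
      (M , near-M) = cauchy x d 0<d
      K = N ℕ.⊔ M
      X = seq x K
      e≤X = subst (_≤ X) (trans (+-identityˡ e) (trans e≡h+h (cong₂ _+_ h≡d+d h≡d+d))) (e≤x K (ℕP.m≤m⊔n N M))
      d+d+d≤q = ≤-by e≤X (aux₁ X d)
      d+d≤q = ≤-trans (p≤p+q (d + d) (<⇒≤ 0<d)) d+d+d≤q
  in X - d , <-≤-trans 0<d (≤-trans (p≤p+q d (<⇒≤ 0<d)) d+d≤q) , K , λ n K≤n →
    let M≤n = ℕP.≤-trans (ℕP.m≤n⊔m N M) K≤n
    in ≤-by (near X (seq x n) d (near-M K n (ℕP.m≤n⊔m N M) M≤n)) (aux₂ X (seq x n) d) ,
       ≤-trans (near (seq x n) X d (near-M n K M≤n (ℕP.m≤n⊔m N M)))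
         (≤-by d+d≤q (aux₃ X d))
  where
  aux₁ : ∀ X d → X - ((d + d) + (d + d)) ≡ (X - d) - ((d + d) + d)
  aux₁ = solve 2 (λ X d → X :- ((d :+ d) :+ (d :+ d)) := (X :- d) :- ((d :+ d) :+ d)) refl
  aux₂ : ∀ X Y d → (Y + d) - X ≡ Y - (X - d)
  aux₂ = solve 3 (λ X Y d → (Y :+ d) :- X := Y :- (X :- d)) refl
  aux₃ : ∀ X d → (X - d) - (d + d) ≡ ((X - d) + (X - d)) - (X + d)
  aux₃ = solve 2 (λ X d → (X :- d) :- (d :+ d) := ((X :- d) :+ (X :- d)) :- (X :+ d)) refl

-- Square root, logarithm and reciprocal.

module _ (f : ℚ → ℝ) (mono : ∀ q r → 0ℚ ≤ q → q < r → f q <ᴿ f r)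
  (y : ℝ) (top : ∃[ b ] (0ℚ < b × y <ᴿ f b)) where
  open Inverse f mono y top
  open Bracket

  inverse-nonNeg : ∀ n → 0ℚ ≤ seq inverse n
  inverse-nonNeg n = ≤-trans (0≤lo (brackets n)) (<⇒≤ (lo<hi (brackets n)))

√-nonNeg : ∀ y n → 0ℚ ≤ seq (√ y) n
√-nonNeg y = inverse-nonNeg (λ q → ofℚ (q * q)) square-mono y (square-unbounded y)

√-above : ∀ {y} q → √ y <ᴿ ofℚ q → y <ᴿ ofℚ (q * q)
√-above {y} = Inverse.inverse-above (λ q → ofℚ (q * q)) square-mono y (square-unbounded y)

log-nonNeg : ∀ y n → 0ℚ ≤ seq (log y) n
log-nonNeg y = inverse-nonNeg (λ q → exp (ofℚ q)) exp-mono y (exp-unbounded y)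

log-above : ∀ {y} q → log y <ᴿ ofℚ q → y <ᴿ exp (ofℚ q)
log-above {y} = Inverse.inverse-above (λ q → exp (ofℚ q)) exp-mono y (exp-unbounded y)

inv : (y : ℝ) → 0ᴿ <ᴿ y → ℝ
inv y 0<y = Inverse.inverse (λ q → ofℚ q *ᴿ y) (scale-mono {y} 0<y) 1ᴿ (scale-unbounded {y} 0<y)

inv-above : ∀ {y} (0<y : 0ᴿ <ᴿ y) q → inv y 0<y <ᴿ ofℚ q → 1ᴿ <ᴿ ofℚ q *ᴿ y
inv-above {y} 0<y = Inverse.inverse-above (λ q → ofℚ q *ᴿ y) (scale-mono {y} 0<y) 1ᴿ (scale-unbounded {y} 0<y)

ofℚ-mono : ∀ {u v} → u < v → ofℚ u <ᴿ ofℚ v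
ofℚ-mono {u} {v} u<v = v - u , <-by u<v (solve 2 (λ u v → v :- u := (v :- u) :- con 0ℚ) refl u v) , 0 ,
  λ _ _ → ≤-reflexive (solve 2 (λ u v → u :+ (v :- u) := v) refl u v)

eventually-above : ∀ {u} x → ofℚ u <ᴿ x → ∃[ N ] (∀ n → N ℕ.≤ n → u ≤ seq x n)
eventually-above {u} x (e , 0<e , N , u<x) = N , λ n N≤n → ≤-trans (p≤p+q u (<⇒≤ 0<e)) (u<x n N≤n)

-- Cotransitivity decides between u < 1/y and 1/y < v, and the latter contradicts v y ≤ 1. The price
-- is the gap between u and v.
inv-eventually-above : ∀ {y t u v} (0<y : 0ᴿ <ᴿ y) → ∃[ N ] (∀ n → N ℕ.≤ n → seq y n ≤ t) →
  0ℚ ≤ v → v * t ≡ 1ℚ → u < v → ∃[ N ] (∀ n → N ℕ.≤ n → u ≤ seq (inv y 0<y) n)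
inv-eventually-above {y} {t} {u} {v} 0<y (N , y≤t) 0≤v vt≡1 u<v = ⊎-rec
  (eventually-above (inv y 0<y))
  (λ inv<v → contradiction (inv-above {y} 0<y v inv<v)
    (≤ᴿ-eventually (ofℚ v *ᴿ y) 1ᴿ N (λ n N≤n → subst (v * seq y n ≤_) vt≡1 (*-monoˡ 0≤v (y≤t n N≤n)))))
  (cotrans {ofℚ u} {ofℚ v} (ofℚ-mono u<v) (inv y 0<y))

psum-½ : ∀ k → psum ½ k ≤ ι 2
psum-½ = psum-linear (<⇒≤ (positive⁻¹ ½)) ≤-refl

-- The approximations of `log` are upper ends of brackets, where `exp` may exceed n. The lower ends
-- obey the bound n, and a bracket narrower than 1/2 adds a factor exp (1/2) ≤ 2. This is why 2 n
-- replaces n in the rest of the proof.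
psum-log : ∀ n → 1 ℕ.≤ n → ∃[ K ] (∀ k → K ℕ.≤ k → ∀ j → psum (seq (log (ofℕ n)) k) j ≤ ι n * ι 2)
psum-log n 1≤n =
  let (K , narrow) = width-small ½ (positive⁻¹ ½)
  in K , λ k K≤k j →
    let s = brackets k
    in ≤-trans (psum-mono-arg (≤-trans (0≤lo s) (<⇒≤ (lo<hi s)))
           (≤-by (<⇒≤ (narrow k K≤k)) (aux (hi s) (lo s) ½)) j)
         (≤-trans (psum-+≤ (0≤lo s) (<⇒≤ (positive⁻¹ ½)) j)
           (*-mono (psum-nonNeg (0≤lo s) j) (0≤ι 2) (low s j) (psum-½ j)))
  where
  open Inverse (λ q → exp (ofℚ q)) exp-mono (ofℕ n) (exp-unbounded (ofℕ n))
  open Bracket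
  aux : ∀ h l w → w - (h - l) ≡ (l + w) - h
  aux = solve 3 (λ h l w → w :- (h :- l) := (l :+ w) :- h) refl
  low : ∀ s j → psum (lo s) j ≤ ι n
  low s j with below s
  ... | inj₁ lo≡0 = subst (_≤ ι n) (sym (trans (cong (λ q → psum q j) lo≡0) (psum-0 j))) (ι-mono′ 1≤n)
  -- The strict inequality is known for late indices only; partial sums increase, so it bounds the
  -- earlier ones too.
  ... | inj₂ (e , 0<e , N , lt) = ≤-trans (psum-mono-index (0≤lo s) (ℕP.m≤m⊔n j N))
    (≤-trans (p≤p+q (psum (lo s) (j ℕ.⊔ N)) (<⇒≤ 0<e)) (lt (j ℕ.⊔ N) (ℕP.m≤n⊔m j N)))

-- A partial sum at a negative argument may itself be negative, hence the case distinction on p.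
half≤ : ∀ p r Q → 0ℚ ≤ r → r ≤ Q → 1ℚ - p * r < ½ → ½ ≤ p * Q
half≤ p r Q 0≤r r≤Q lt = ⊎-rec
    (λ 0≤p → ≤-trans ½≤pr (*-monoˡ {p} {r} {Q} 0≤p r≤Q))
    (λ p≤0 → contradiction (≤-trans ½≤pr (subst (p * r ≤_) (*-zeroˡ r) (*-monoʳ {r} {p} {0ℚ} 0≤r p≤0)))
      (λ ½≤0 → <-irrefl refl (<-≤-trans (positive⁻¹ ½) ½≤0)))
    (≤-total 0ℚ p)
  where
  aux : ∀ x → ½ - (1ℚ - x) ≡ x - ½
  aux = solve 1 (λ x → con ½ :- (con 1ℚ :- x) := x :- con ½) refl
  ½≤pr : ½ ≤ p * r
  ½≤pr = ≤-by {1ℚ - p * r} {½} {½} {p * r} (<⇒≤ lt) (aux (p * r))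

psum-log-multiple : ∀ {c l m k A} → 0ℚ ≤ c → 0ℚ ≤ l → c ≤ ι m → psum l k ≤ A → psum (c * l) k ≤ A ^ m
psum-log-multiple {c} {l} {m} {k} {A} 0≤c 0≤l c≤m pl≤A = ≤-trans
  (psum-mono-arg {c * l} {ι m * l} (*-nonNeg 0≤c 0≤l) (*-monoʳ {l} {c} {ι m} 0≤l c≤m) k)
  (≤-trans (psum-*≤^ {l} 0≤l k m) (^-monoˡ {psum l k} {A} (psum-nonNeg {l} 0≤l k) pl≤A m))

-- For an integer m ≥ c, exp (c log n) ≤ (2 n)^m, and exp (-x) exp x is eventually above 1/2. The
-- failure probability can therefore be controlled by the rational (2 n)^(-m); m is chosen before n,
-- as the constant of the theorem requires.
reciprocal-power-bound : ∀ {c} → 0ᴿ <ᴿ c → ∃[ m ] (∀ n → 1 ℕ.≤ n →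
  ∃[ K ] (∀ k → K ℕ.≤ k → ½ ≤ seq (n ^ᴿ (-ᴿ c)) k * (ι n * ι 2) ^ m))
reciprocal-power-bound {c} 0<c =
  let (m , N₁ , c≤m) = eventually-below c
      (N₂ , 0≤c) = eventually-positive {c} 0<c
  in m , λ n 1≤n →
    let L = log (ofℕ n)
        (B , 0≤B , N₃ , cL≤B) = bounded (c *ᴿ L)
        (N₄ , inverse-law) = psum-neg {B} 0≤B {½} (positive⁻¹ ½)
        (N₅ , pL) = psum-log n 1≤n
        K₁ = N₁ ℕ.⊔ N₂
        K₂ = N₃ ℕ.⊔ (N₄ ℕ.⊔ N₅)
    in K₁ ℕ.⊔ K₂ , λ k K≤k →
      let K₁≤ = ℕP.m⊔n≤o⇒m≤o K₁ K₂ K≤k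
          K₂≤ = ℕP.m⊔n≤o⇒n≤o K₁ K₂ K≤k
          K₃≤ = ℕP.m⊔n≤o⇒n≤o N₃ (N₄ ℕ.⊔ N₅) K₂≤
          0≤ck = 0≤c k (ℕP.m⊔n≤o⇒n≤o N₁ N₂ K₁≤)
          0≤Lk = log-nonNeg (ofℕ n) k
      in body n m k (seq c k) (seq L k) 0≤ck 0≤Lk
           (c≤m k (ℕP.m⊔n≤o⇒m≤o N₁ N₂ K₁≤))
           (pL k (ℕP.m⊔n≤o⇒n≤o N₄ N₅ K₃≤) k)
           (inverse-law k (ℕP.m⊔n≤o⇒m≤o N₄ N₅ K₃≤) (seq c k * seq L k)
             (cL≤B k (ℕP.m⊔n≤o⇒m≤o N₃ (N₄ ℕ.⊔ N₅) K₂≤)))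
  where
  body : ∀ n m k x l → 0ℚ ≤ x → 0ℚ ≤ l → x ≤ ι m → psum l k ≤ ι n * ι 2 →
    1ℚ - psum (- (x * l)) k * psum (x * l) k < ½ → ½ ≤ psum (- x * l) k * (ι n * ι 2) ^ m
  body n m k x l 0≤x 0≤l x≤m pl≤ lt = subst (λ t → ½ ≤ psum t k * (ι n * ι 2) ^ m) (neg-distribˡ-* x l)
    (half≤ (psum (- (x * l)) k) (psum (x * l) k) ((ι n * ι 2) ^ m)
      (psum-nonNeg {x * l} (*-nonNeg 0≤x 0≤l) k) (psum-log-multiple {x} {l} {m} {k} {ι n * ι 2} 0≤x 0≤l x≤m pl≤) lt)

-- Applied to y = n and to y = n / δ. The slack h is there because the quotient is known only up to
-- an error; it is absorbed by the strictness of `log y <ᴿ ofℚ ℓ`.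
log-bound : ∀ {y n ℓ} → (∀ {h} → 0ℚ < h → ∃[ N ] (∀ k → N ℕ.≤ k → ι n ≤ seq y k + h)) →
  log y <ᴿ ofℚ ℓ → ∃[ k ] ι n < psum ℓ k
log-bound {y} {n} {ℓ} n≤y log<ℓ =
  let (e , 0<e , N , y<exp) = log-above {y} ℓ log<ℓ
      (h , 0<h , e≡h+h) = halve 0<e
      (M , n≤y+h) = n≤y 0<h
      k = N ℕ.⊔ M
  in k , <-≤-trans (≤-<-trans (n≤y+h k (ℕP.m≤n⊔m N M))
           (+-monoʳ-< (seq y k) (subst (h <_) (sym e≡h+h) (p<p+q h 0<h))))
         (y<exp k (ℕP.m≤m⊔n N M))

n≤n÷δ : ∀ {n δ} (0<δ : 0ᴿ <ᴿ δ) → δ <ᴿ 1ᴿ → ∀ {h} → 0ℚ < h →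
  ∃[ N ] (∀ k → N ℕ.≤ k → ι n ≤ seq (ofℕ n ÷ᴿ δ ⟨ 0<δ ⟩) k + h)
n≤n÷δ {n} {δ} 0<δ (e , 0<e , N , δ<1) {h} 0<h =
  let (d , 0<d , nd<h) = shrink (0≤ι n) 0<h
      (M , 1-d≤) = inv-eventually-above {δ} {1ℚ} {1ℚ - d} {1ℚ} 0<δ
        (N , λ k N≤k → ≤-trans (p≤p+q (seq δ k) (<⇒≤ 0<e)) (δ<1 k N≤k)) (<⇒≤ 0<1) (*-identityˡ 1ℚ)
        (<-by 0<d (aux₁ d))
  in M , λ k M≤k → ≤-trans (≤-by (<⇒≤ nd<h) (aux₂ (ι n) d h)) (+-monoˡ-≤ h (*-monoˡ (0≤ι n) (1-d≤ k M≤k)))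
  where
  aux₁ : ∀ h → h - 0ℚ ≡ 1ℚ - (1ℚ - h)
  aux₁ = solve 1 (λ h → h :- con 0ℚ := con 1ℚ :- (con 1ℚ :- h)) refl
  aux₂ : ∀ n h e → e - n * h ≡ (n * (1ℚ - h) + e) - n
  aux₂ = solve 3 (λ n h e → e :- n :* h := (n :* (con 1ℚ :- h) :+ e) :- n) refl

-- If both factors exceeded ℓ, their product would be at least ℓ^2. Cotransitivity needs room above
-- ℓ, hence 2 ℓ.
√-product : ∀ {x y ℓ} → 0ℚ < ℓ → (∀ k → 0ℚ ≤ seq y k) → √ (x *ᴿ y) <ᴿ ofℚ ℓ →
  x <ᴿ ofℚ (ℓ + ℓ) ⊎ y <ᴿ ofℚ (ℓ + ℓ)
√-product {x} {y} {ℓ} 0<ℓ 0≤y √<ℓ = ⊎-rec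
    (λ ℓ<x → ⊎-rec (λ ℓ<y → contradiction (√-above {x *ᴿ y} ℓ √<ℓ) (large ℓ<x ℓ<y)) inj₂ (compare y))
    inj₁ (compare x)
  where
  compare : ∀ z → ofℚ ℓ <ᴿ z ⊎ z <ᴿ ofℚ (ℓ + ℓ)
  compare = cotrans {ofℚ ℓ} {ofℚ (ℓ + ℓ)} (ofℚ-mono (p<p+q ℓ 0<ℓ))
  large : ofℚ ℓ <ᴿ x → ofℚ ℓ <ᴿ y → ofℚ (ℓ * ℓ) ≤ᴿ x *ᴿ y
  large ℓ<x ℓ<y =
    let (M , ℓ≤x) = eventually-above x ℓ<x
        (N , ℓ≤y) = eventually-above y ℓ<y
    in ≤ᴿ-eventually (ofℚ (ℓ * ℓ)) (x *ᴿ y) (M ℕ.⊔ N)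
      (λ k k≥ → *-mono (<⇒≤ 0<ℓ) (0≤y k) (ℓ≤x k (ℕP.m⊔n≤o⇒m≤o M N k≥)) (ℓ≤y k (ℕP.m⊔n≤o⇒n≤o M N k≥)))

-- Both logarithms are at least log n since δ < 1, so whichever of them is small leads to the same
-- conclusion.
√log-bound : ∀ {n δ} (0<δ : 0ᴿ <ᴿ δ) → δ <ᴿ 1ᴿ → ∀ {ℓ} → 0ℚ < ℓ →
  √ (log (ofℕ n) *ᴿ log (ofℕ n ÷ᴿ δ ⟨ 0<δ ⟩)) <ᴿ ofℚ ℓ → ∃[ k ] ι n < psum (ℓ + ℓ) k
√log-bound {n} {δ} 0<δ δ<1 {ℓ} 0<ℓ √<ℓ = ⊎-rec
  (log-bound {ofℕ n} {n} {ℓ + ℓ} (λ {h} 0<h → 0 , λ _ _ → p≤p+q (ι n) (<⇒≤ 0<h)))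
  (log-bound {ofℕ n ÷ᴿ δ ⟨ 0<δ ⟩} {n} {ℓ + ℓ} (n≤n÷δ {n} {δ} 0<δ δ<1))
  (√-product {log (ofℕ n)} {log (ofℕ n ÷ᴿ δ ⟨ 0<δ ⟩)} 0<ℓ (log-nonNeg (ofℕ n ÷ᴿ δ ⟨ 0<δ ⟩)) √<ℓ)

-- A violation σ < ρ − C z/ε of the accuracy bound makes z strictly smaller than ℓ = (ρ − σ)/(C u),
-- where u is a lower bound for 1/ε.
violation : ∀ {ρ σ C u ε} z (0<ε : 0ᴿ <ᴿ ε) → (∀ n → 0ℚ ≤ seq z n) → 0ℚ < C * u → 0ℚ ≤ C →
  ∃[ N ] (∀ n → N ℕ.≤ n → u ≤ seq (inv ε 0<ε) n) →
  ofℚ σ <ᴿ ofℚ ρ -ᴿ ofℚ C *ᴿ (z ÷ᴿ ε ⟨ 0<ε ⟩) →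
  ∃[ ℓ ] (0ℚ < ℓ × C * u * ℓ ≡ ρ - σ × z <ᴿ ofℚ ℓ)
violation {ρ} {σ} {C} {u} {ε} z 0<ε 0≤z 0<Cu 0≤C (M , u≤) (e , 0<e , N , lt) =
  let (t , 0<t , tCu≡1) = reciprocal 0<Cu
      te≤ = λ k (k≥ : M ℕ.⊔ N ℕ.≤ k) →
        let zk = seq z k
            rk = seq (inv ε 0<ε) k
            Cuz≤Czr = ≤-trans (≤-reflexive (aux₁ C u zk))
              (*-monoˡ 0≤C (*-monoˡ (0≤z k) (u≤ k (ℕP.m⊔n≤o⇒m≤o M N k≥))))
            Cuz+e≤ = ≤-trans (+-monoˡ-≤ e Cuz≤Czr) (≤-by (lt k (ℕP.m⊔n≤o⇒n≤o M N k≥)) (aux₂ ρ σ e (C * (zk * rk))))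
        in subst (_≤ t * (ρ - σ))
             (trans (aux₃ t (C * u) zk e)
               (trans (cong (λ s → s * zk + t * e) tCu≡1) (cong (_+ t * e) (*-identityˡ zk))))
             (*-monoˡ (<⇒≤ 0<t) Cuz+e≤)
      0<te = *-pos 0<t 0<e
      K = M ℕ.⊔ N
  in t * (ρ - σ) ,
     <-≤-trans 0<te (≤-trans
       (subst (_≤ seq z K + t * e) (+-identityˡ (t * e)) (+-monoˡ-≤ (t * e) (0≤z K))) (te≤ K ℕP.≤-refl)) ,
     trans (aux₄ (C * u) t (ρ - σ)) (trans (cong (_* (ρ - σ)) tCu≡1) (*-identityˡ (ρ - σ))) ,
     t * e , 0<te , K , te≤
  where
  aux₁ : ∀ C u z → C * u * z ≡ C * (z * u)
  aux₁ = S.solve 3 (λ C u z → C S.:* u S.:* z S.:= C S.:* (z S.:* u)) refl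
  aux₂ : ∀ ρ σ e x → (ρ + - x) - (σ + e) ≡ (ρ - σ) - (x + e)
  aux₂ = solve 4 (λ ρ σ e x → (ρ :+ :- x) :- (σ :+ e) := (ρ :- σ) :- (x :+ e)) refl
  aux₃ : ∀ t d z e → t * (d * z + e) ≡ t * d * z + t * e
  aux₃ = S.solve 4 (λ t d z e → t S.:* (d S.:* z S.:+ e) S.:= t S.:* d S.:* z S.:+ t S.:* e) refl
  aux₄ : ∀ d t g → d * (t * g) ≡ t * d * g
  aux₄ = S.solve 3 (λ d t g → d S.:* (t S.:* g) S.:= t S.:* d S.:* g) refl

-- Finite sums and maxima

invert : ∀ {p} → Dec (0ℚ < p) → ℚ
invert (yes 0<p) = proj₁ (reciprocal 0<p)
invert (no _)    = 0ℚ

-- 1/p for p > 0, and 0 otherwise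
recip : ℚ → ℚ
recip p = invert (0ℚ <? p)

recip-nonNeg : ∀ p → 0ℚ ≤ recip p
recip-nonNeg p with 0ℚ <? p
... | yes 0<p = <⇒≤ (proj₁ (proj₂ (reciprocal 0<p)))
... | no _    = ≤-refl

recip-inverse : ∀ {p} → 0ℚ < p → recip p * p ≡ 1ℚ
recip-inverse {p} 0<p with 0ℚ <? p
... | yes 0<p′ = proj₂ (proj₂ (reciprocal 0<p′))
... | no ¬0<p  = contradiction 0<p ¬0<p

recip*≤1 : ∀ p → recip p * p ≤ 1ℚ
recip*≤1 p with 0ℚ <? p
... | yes 0<p = ≤-reflexive (proj₂ (proj₂ (reciprocal 0<p)))
... | no _    = subst (_≤ 1ℚ) (sym (*-zeroˡ p)) (<⇒≤ 0<1)

recip-≤ : ∀ {p q c} → 0ℚ < p → 0ℚ < q → q ≤ c * p → recip p ≤ c * recip q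
recip-≤ {p} {q} {c} 0<p 0<q q≤cp = subst₂ _≤_
  (trans (cong (recip p *_) (recip-inverse 0<q)) (*-identityʳ (recip p)))
  (trans (aux (recip p) (recip q) c p)
    (trans (cong (_* (c * recip q)) (recip-inverse 0<p)) (*-identityˡ (c * recip q))))
  (*-monoˡ (recip-nonNeg p) (*-monoˡ (recip-nonNeg q) q≤cp))
  where
  aux : ∀ r s c p → r * (s * (c * p)) ≡ r * p * (c * s)
  aux = S.solve 4 (λ r s c p → r S.:* (s S.:* (c S.:* p)) S.:= r S.:* p S.:* (c S.:* s)) refl

module _ {A : Set} where

  sum : (A → ℚ) → List A → ℚ
  sum f []       = 0ℚ
  sum f (x ∷ xs) = f x + sum f xs

  sum-mono : ∀ {f g} → (∀ x → f x ≤ g x) → ∀ xs → sum f xs ≤ sum g xs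
  sum-mono f≤g []       = ≤-refl
  sum-mono f≤g (x ∷ xs) = +-mono-≤ (f≤g x) (sum-mono f≤g xs)

  sum-cong : ∀ {f g} → (∀ x → f x ≡ g x) → ∀ xs → sum f xs ≡ sum g xs
  sum-cong f≡g []       = refl
  sum-cong f≡g (x ∷ xs) = cong₂ _+_ (f≡g x) (sum-cong f≡g xs)

  sum-nonNeg : ∀ {f} → (∀ x → 0ℚ ≤ f x) → ∀ xs → 0ℚ ≤ sum f xs
  sum-nonNeg 0≤f []       = ≤-refl
  sum-nonNeg 0≤f (x ∷ xs) = +-nonNeg (0≤f x) (sum-nonNeg 0≤f xs)

  sum-*ˡ : ∀ c f xs → sum (λ x → c * f x) xs ≡ c * sum f xs
  sum-*ˡ c f []       = sym (*-zeroʳ c)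
  sum-*ˡ c f (x ∷ xs) = trans (cong (c * f x +_) (sum-*ˡ c f xs)) (sym (*-distribˡ-+ c (f x) (sum f xs)))

  sum-*ʳ : ∀ c f xs → sum (λ x → f x * c) xs ≡ sum f xs * c
  sum-*ʳ c f xs = trans (sum-cong (λ x → *-comm (f x) c) xs) (trans (sum-*ˡ c f xs) (*-comm c (sum f xs)))

  sum-+ : ∀ f g xs → sum (λ x → f x + g x) xs ≡ sum f xs + sum g xs
  sum-+ f g []       = refl
  sum-+ f g (x ∷ xs) = trans (cong (f x + g x +_) (sum-+ f g xs))
    (S.solve 4 (λ a b c d → (a S.:+ b) S.:+ (c S.:+ d) S.:= (a S.:+ c) S.:+ (b S.:+ d)) refl
      (f x) (g x) (sum f xs) (sum g xs))

  term≤sum : ∀ {f} → (∀ x → 0ℚ ≤ f x) → ∀ {x xs} → x ∈ xs → f x ≤ sum f xs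
  term≤sum {f} 0≤f {x} (here {xs = xs} refl) = p≤p+q (f x) (sum-nonNeg 0≤f xs)
  term≤sum {f} 0≤f {x} (there {y} {xs} x∈xs) = ≤-trans (term≤sum 0≤f x∈xs)
    (subst (_≤ f y + sum f xs) (+-identityˡ (sum f xs)) (+-monoˡ-≤ (sum f xs) (0≤f y)))

  sum-Σ≤ : ∀ (h : A → ℕ → ℚ) n xs → sum (λ x → Σ≤ (h x) n) xs ≡ Σ≤ (λ k → sum (λ x → h x k) xs) n
  sum-Σ≤ h zero    xs = refl
  sum-Σ≤ h (suc n) xs = trans (sum-+ (λ x → h x 0) (λ x → Σ≤ (λ k → h x (suc k)) n) xs)
    (cong (sum (λ x → h x 0) xs +_) (sum-Σ≤ (λ x k → h x (suc k)) n xs))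

  sum-split : ∀ f O xs → sum f xs ≡ sum f (filterᵇ O xs) + sum f (filterᵇ (λ x → not (O x)) xs)
  sum-split f O []       = refl
  sum-split f O (x ∷ xs) with O x
  ... | true  = trans (cong (f x +_) (sum-split f O xs))
    (sym (+-assoc (f x) (sum f (filterᵇ O xs)) (sum f (filterᵇ (λ x → not (O x)) xs))))
  ... | false = trans (cong (f x +_) (sum-split f O xs))
    (S.solve 3 (λ a b c → a S.:+ (b S.:+ c) S.:= b S.:+ (a S.:+ c)) refl
      (f x) (sum f (filterᵇ O xs)) (sum f (filterᵇ (λ x → not (O x)) xs)))

  sum-filterᵇ≤ : ∀ {f g} O → (∀ x → T (O x) → f x ≤ g x) → (∀ x → 0ℚ ≤ g x) → ∀ xs →
    sum f (filterᵇ O xs) ≤ sum g xs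
  sum-filterᵇ≤ O f≤g 0≤g [] = ≤-refl
  sum-filterᵇ≤ {f} {g} O f≤g 0≤g (x ∷ xs) with O x | f≤g x
  ... | true  | fx≤gx = +-mono-≤ (fx≤gx _) (sum-filterᵇ≤ O f≤g 0≤g xs)
  ... | false | _     = ≤-trans (sum-filterᵇ≤ {f} {g} O f≤g 0≤g xs)
    (subst (_≤ g x + sum g xs) (+-identityˡ (sum g xs)) (+-monoˡ-≤ (sum g xs) (0≤g x)))

  max : (A → ℚ) → List A → ℚ
  max f []       = 0ℚ
  max f (x ∷ xs) = f x ⊔ max f xs

  max-nonNeg : ∀ f xs → 0ℚ ≤ max f xs
  max-nonNeg f []       = ≤-refl
  max-nonNeg f (x ∷ xs) = ≤-trans (max-nonNeg f xs) (p≤q⊔p (f x) (max f xs))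

  term≤max : ∀ f {x xs} → x ∈ xs → f x ≤ max f xs
  term≤max f {x} (here {xs = xs} refl) = p≤p⊔q (f x) (max f xs)
  term≤max f {x} (there {y} {xs} x∈xs) = ≤-trans (term≤max f x∈xs) (p≤q⊔p (f y) (max f xs))

  max-≤* : ∀ {f g c} → 0ℚ ≤ c → (∀ x → f x ≤ c * g x) → ∀ xs → max f xs ≤ c * max g xs
  max-≤* {f} {g} {c} 0≤c f≤cg [] = ≤-reflexive (sym (*-zeroʳ c))
  max-≤* {f} {g} {c} 0≤c f≤cg (x ∷ xs) = ⊔-lub
    (≤-trans (f≤cg x) (*-monoˡ 0≤c (p≤p⊔q (g x) (max g xs))))
    (≤-trans (max-≤* 0≤c f≤cg xs) (*-monoˡ 0≤c (p≤q⊔p (g x) (max g xs))))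

  -- A power of the maximum is 0 or the power of one entry. The exponent is a successor because the
  -- empty maximum is 0, and 0^0 = 1 would exceed the empty sum.
  max^≤sum : ∀ {f} → (∀ x → 0ℚ ≤ f x) → ∀ k xs → max f xs ^ suc k ≤ sum (λ x → f x ^ suc k) xs
  max^≤sum {f} 0≤f k [] = ≤-reflexive (*-zeroˡ (0ℚ ^ k))
  max^≤sum {f} 0≤f k (x ∷ xs) = ⊎-rec
    (λ eq → subst (λ t → t ^ suc k ≤ X + R) (sym eq) (p≤p+q X (sum-nonNeg (λ y → ^-nonNeg (0≤f y) (suc k)) xs)))
    (λ eq → subst (λ t → t ^ suc k ≤ X + R) (sym eq) (≤-trans (max^≤sum 0≤f k xs)
      (subst (_≤ X + R) (+-identityˡ R) (+-monoˡ-≤ R (^-nonNeg (0≤f x) (suc k))))))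
    (⊔-sel (f x) (max f xs))
    where
    X R : ℚ
    X = f x ^ suc k
    R = sum (λ y → f y ^ suc k) xs

-- A mask: sums and maxima over the sets of one size become sums and maxima over the fixed list
-- `subsets n`.
at : ℕ → ℕ → ℚ → ℚ
at i j p = if i ≡ᵇ j then p else 0ℚ

at-refl : ∀ i p → at i i p ≡ p
at-refl zero    p = refl
at-refl (suc i) p = at-refl i p

at-≤* : ∀ i j {c p q} → 0ℚ ≤ c → p ≤ c * q → at i j p ≤ c * at i j q
at-≤* i j {c} 0≤c p≤cq with i ≡ᵇ j
... | true  = p≤cq
... | false = ≤-reflexive (sym (*-zeroʳ c))

at-nonNeg : ∀ i j {p} → 0ℚ ≤ p → 0ℚ ≤ at i j p
at-nonNeg i j 0≤p with i ≡ᵇ j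
... | true  = 0≤p
... | false = ≤-refl

-- Takes the place of a rewrite along i ≡ j, which the Boolean test does not provide.
at-index : ∀ i j (h : ℕ → ℚ) → at i j (h i) ≡ at i j (h j)
at-index zero    zero    h = refl
at-index zero    (suc j) h = refl
at-index (suc i) zero    h = refl
at-index (suc i) (suc j) h = at-index i j (λ k → h (suc k))

at≤ : ∀ i j {p} → 0ℚ ≤ p → at i j p ≤ p
at≤ i j 0≤p with i ≡ᵇ j
... | true  = ≤-refl
... | false = 0≤p

at-* : ∀ i j p q → at i j (p * q) ≡ at i j p * q
at-* i j p q with i ≡ᵇ j
... | true  = refl
... | false = sym (*-zeroˡ q)

at-^ : ∀ i j p k → at i j p ^ suc k ≡ at i j (p ^ suc k)
at-^ i j p k with i ≡ᵇ j
... | true  = refl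
... | false = *-zeroˡ (0ℚ ^ k)

Σ≤-mono : ∀ {f g} → (∀ k → f k ≤ g k) → ∀ n → Σ≤ f n ≤ Σ≤ g n
Σ≤-mono f≤g zero    = f≤g 0
Σ≤-mono f≤g (suc n) = +-mono-≤ (f≤g 0) (Σ≤-mono (λ k → f≤g (suc k)) n)

Σ≤-0 : ∀ n → Σ≤ (λ _ → 0ℚ) n ≡ 0ℚ
Σ≤-0 zero    = refl
Σ≤-0 (suc n) = trans (+-identityˡ _) (Σ≤-0 n)

Σ≤-1 : ∀ n → Σ≤ (λ _ → 1ℚ) n ≡ ι (suc n)
Σ≤-1 zero    = refl
Σ≤-1 (suc n) = trans (cong (1ℚ +_) (Σ≤-1 n)) (sym (ι-suc (suc n)))

Σ≤-at : ∀ {i n} → i ℕ.≤ n → ∀ p → Σ≤ (λ k → at i k p) n ≡ p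
Σ≤-at {zero}  {zero}  _             p = refl
Σ≤-at {zero}  {suc n} _             p = trans (cong (p +_) (Σ≤-0 n)) (+-identityʳ p)
Σ≤-at {suc i} {suc n} (ℕ.s≤s i≤n) p = trans (+-identityˡ _) (Σ≤-at i≤n p)

-- Sums over all subsets.

subsets-complete : ∀ {n} (S : Subset n) → S ∈ subsets n
subsets-complete Vec.[]            = here refl
subsets-complete (outside Vec.∷ S) = ∈-++⁺ˡ (∈-map⁺ (outside Vec.∷_) (subsets-complete S))
subsets-complete {suc n} (inside Vec.∷ S) =
  ∈-++⁺ʳ (map (outside Vec.∷_) (subsets n)) (∈-map⁺ (inside Vec.∷_) (subsets-complete S))

sum-++ : ∀ {A : Set} (f : A → ℚ) xs ys → sum f (xs ++ ys) ≡ sum f xs + sum f ys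
sum-++ f []       ys = sym (+-identityˡ (sum f ys))
sum-++ f (x ∷ xs) ys = trans (cong (f x +_) (sum-++ f xs ys)) (sym (+-assoc (f x) (sum f xs) (sum f ys)))

sum-map : ∀ {A B : Set} (f : B → ℚ) (g : A → B) xs → sum f (map g xs) ≡ sum (λ x → f (g x)) xs
sum-map f g []       = refl
sum-map f g (x ∷ xs) = cong (f (g x) +_) (sum-map f g xs)

-- The binomial theorem over sets. At t = 1 / (2 n) the value is at most exp (1/2) ≤ 2, a union
-- bound over all sizes at once.
size-generating-function : ∀ t n → sum (λ S → t ^ Sub.∣ S ∣) (subsets n) ≡ (1ℚ + t) ^ n
size-generating-function t zero    = refl
size-generating-function t (suc n) = trans
  (sum-++ (λ S → t ^ Sub.∣ S ∣) (map (outside Vec.∷_) (subsets n)) (map (inside Vec.∷_) (subsets n)))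
  (trans (cong₂ _+_ (sum-map (λ S → t ^ Sub.∣ S ∣) (outside Vec.∷_) (subsets n))
      (trans (sum-map (λ S → t ^ Sub.∣ S ∣) (inside Vec.∷_) (subsets n))
        (sum-*ˡ t (λ S → t ^ Sub.∣ S ∣) (subsets n))))
    (trans (cong (λ g → g + t * g) (size-generating-function t n))
      (S.solve 2 (λ t g → g S.:+ t S.:* g S.:= (S.con 1 S.:+ t) S.:* g) refl t ((1ℚ + t) ^ n))))

-- The parameters satisfy k · e k = F for 1 ≤ k ≤ n, so a set of k vertices with E edges gets
-- b^(e k · E) = b^(F · density).
module Mechanism (n : ℕ) (F : ℕ) (e : ℕ → ℕ) (e≤F : ∀ k → e k ℕ.≤ F) (b : ℚ) (1≤b : 1ℚ ≤ b) where

  0≤b : 0ℚ ≤ b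
  0≤b = ≤-trans (<⇒≤ 0<1) 1≤b

  Score : Set
  Score = Subset n → ℕ

  quality : ℕ → ℕ → ℚ
  quality k m = b ^ (e k ℕ.* m)

  weight : ℕ → ℚ
  weight m = b ^ (F ℕ.* m)

  -- b^(F · D), where D is the largest density of a set of size k
  best : Score → ℕ → ℚ
  best E zero    = 0ℚ
  best E (suc k) = max (λ S → at Sub.∣ S ∣ (suc k) (quality (suc k) (E S))) (subsets n)

  partition : Score → ℕ → ℚ
  partition E k = sum (λ S → at Sub.∣ S ∣ k (weight (E S))) (subsets n)

  -- the probability of S given its size
  conditional : Score → Subset n → ℚ
  conditional E S = weight (E S) * recip (partition E Sub.∣ S ∣)

  -- Size 0 has `best` equal to 0, so the empty set is never drawn. The sets of each size k ≤ n
  -- together receive `best E k`, hence `normaliser` is the total weight of all sizes.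
  unnormalised : Score → Subset n → ℚ
  unnormalised E S = best E Sub.∣ S ∣ * conditional E S

  normaliser : Score → ℚ
  normaliser E = sum (unnormalised E) (subsets n)

  probability : Score → Subset n → ℚ
  probability E S = unnormalised E S * recip (normaliser E)

  0<quality : ∀ k m → 0ℚ < quality k m
  0<quality k m = ^-pos (<-≤-trans 0<1 1≤b) (e k ℕ.* m)

  0<weight : ∀ m → 0ℚ < weight m
  0<weight m = ^-pos (<-≤-trans 0<1 1≤b) (F ℕ.* m)

  best-nonNeg : ∀ E k → 0ℚ ≤ best E k
  best-nonNeg E zero    = ≤-refl
  best-nonNeg E (suc k) = max-nonNeg (λ S → at Sub.∣ S ∣ (suc k) (quality (suc k) (E S))) (subsets n)

  quality≤best : ∀ E S {k} → Sub.∣ S ∣ ≡ suc k → quality (suc k) (E S) ≤ best E (suc k)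
  quality≤best E S {k} eq = subst (_≤ best E (suc k))
    (trans (cong (λ i → at i (suc k) (quality (suc k) (E S))) eq) (at-refl (suc k) (quality (suc k) (E S))))
    (term≤max (λ S → at Sub.∣ S ∣ (suc k) (quality (suc k) (E S))) (subsets-complete S))

  0<partition : ∀ E S → 0ℚ < partition E Sub.∣ S ∣
  0<partition E S = <-≤-trans (0<weight (E S)) (subst (_≤ partition E Sub.∣ S ∣)
    (at-refl Sub.∣ S ∣ (weight (E S)))
    (term≤sum {f = λ T → at Sub.∣ T ∣ Sub.∣ S ∣ (weight (E T))}
      (λ T → at-nonNeg Sub.∣ T ∣ Sub.∣ S ∣ (<⇒≤ (0<weight (E T)))) (subsets-complete S)))

  conditional-nonNeg : ∀ E S → 0ℚ ≤ conditional E S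
  conditional-nonNeg E S = *-nonNeg (<⇒≤ (0<weight (E S))) (recip-nonNeg (partition E Sub.∣ S ∣))

  unnormalised-nonNeg : ∀ E S → 0ℚ ≤ unnormalised E S
  unnormalised-nonNeg E S = *-nonNeg (best-nonNeg E Sub.∣ S ∣) (conditional-nonNeg E S)

  -- `conditional` sums to 1 over the sets of one size, so these sets contribute exactly `best` of
  -- that size. Taking the size of a given set makes `partition` positive.
  best≤normaliser : ∀ E S → best E Sub.∣ S ∣ ≤ normaliser E
  best≤normaliser E S = subst (_≤ normaliser E) column-sum
    (sum-mono (λ T → ≤-trans (≤-reflexive (at-≡ T)) (at≤ Sub.∣ T ∣ k (unnormalised-nonNeg E T))) (subsets n))
    where
    k : ℕ
    k = Sub.∣ S ∣
    r : ℚ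
    r = recip (partition E k)
    at-≡ : ∀ T → at Sub.∣ T ∣ k (best E k * (weight (E T) * r)) ≡ at Sub.∣ T ∣ k (unnormalised E T)
    at-≡ T = sym (at-index Sub.∣ T ∣ k (λ i → best E i * (weight (E T) * recip (partition E i))))
    column-sum : sum (λ T → at Sub.∣ T ∣ k (best E k * (weight (E T) * r))) (subsets n) ≡ best E k
    column-sum = trans (sum-cong (λ T → trans
          (cong (at Sub.∣ T ∣ k) (aux (best E k) (weight (E T)) r)) (at-* Sub.∣ T ∣ k (weight (E T)) (r * best E k)))
        (subsets n))
      (trans (sum-*ʳ (r * best E k) (λ T → at Sub.∣ T ∣ k (weight (E T))) (subsets n))
        (trans (aux′ (partition E k) r (best E k))
          (trans (cong (_* best E k) (recip-inverse (0<partition E S))) (*-identityˡ (best E k)))))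
      where
      aux : ∀ m w r → m * (w * r) ≡ w * (r * m)
      aux = S.solve 3 (λ m w r → m S.:* (w S.:* r) S.:= w S.:* (r S.:* m)) refl
      aux′ : ∀ v r m → v * (r * m) ≡ r * v * m
      aux′ = S.solve 3 (λ v r m → v S.:* (r S.:* m) S.:= r S.:* v S.:* m) refl

  quality≤normaliser : ∀ E S {k} → Sub.∣ S ∣ ≡ suc k → quality (suc k) (E S) ≤ normaliser E
  quality≤normaliser E S {k} eq = ≤-trans (quality≤best E S eq)
    (subst (λ i → best E i ≤ normaliser E) eq (best≤normaliser E S))

  -- Grouped by size, each of the n + 1 sizes contributes at most 1.
  Σconditional≤ : ∀ E → sum (conditional E) (subsets n) ≤ ι (suc n)
  Σconditional≤ E = subst₂ _≤_
    (trans (sym (sum-Σ≤ (λ S k → at Sub.∣ S ∣ k (weight (E S) * recip (partition E k))) n (subsets n)))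
      (sum-cong by-size (subsets n)))
    (Σ≤-1 n)
    (Σ≤-mono {λ k → sum (λ S → at Sub.∣ S ∣ k (weight (E S) * recip (partition E k))) (subsets n)} column n)
    where
    by-size : ∀ S → Σ≤ (λ k → at Sub.∣ S ∣ k (weight (E S) * recip (partition E k))) n ≡ conditional E S
    by-size S = trans (Σ≤-cong (λ k → sym (at-index Sub.∣ S ∣ k (λ i → weight (E S) * recip (partition E i)))) n)
      (Σ≤-at (∣p∣≤n S) (conditional E S))
      where
      Σ≤-cong : ∀ {f g : ℕ → ℚ} → (∀ k → f k ≡ g k) → ∀ n → Σ≤ f n ≡ Σ≤ g n
      Σ≤-cong f≡g zero    = f≡g 0
      Σ≤-cong f≡g (suc n) = cong₂ _+_ (f≡g 0) (Σ≤-cong (λ k → f≡g (suc k)) n)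
    column : ∀ k → sum (λ S → at Sub.∣ S ∣ k (weight (E S) * recip (partition E k))) (subsets n) ≤ 1ℚ
    column k = subst (_≤ 1ℚ)
      (sym (trans (sum-cong (λ S → at-* Sub.∣ S ∣ k (weight (E S)) (recip (partition E k))) (subsets n))
        (trans (sum-*ʳ (recip (partition E k)) (λ S → at Sub.∣ S ∣ k (weight (E S))) (subsets n))
          (*-comm (partition E k) (recip (partition E k))))))
      (recip*≤1 (partition E k))

  -- Privacy

  module _ {E E′ : Score} (close : ∀ S → E S ℕ.≤ suc (E′ S)) where

    power-close : ∀ {c} → c ℕ.≤ F → ∀ S → b ^ (c ℕ.* E S) ≤ b ^ F * b ^ (c ℕ.* E′ S)
    power-close {c} c≤F S = subst (b ^ (c ℕ.* E S) ≤_) (^-homo-* b F (c ℕ.* E′ S))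
      (^-monoʳ 1≤b (ℕP.≤-trans (ℕP.*-monoʳ-≤ c (close S))
        (subst (ℕ._≤ F ℕ.+ c ℕ.* E′ S) (sym (ℕP.*-suc c (E′ S))) (ℕP.+-monoˡ-≤ (c ℕ.* E′ S) c≤F))))

    best-close : ∀ k → best E k ≤ b ^ F * best E′ k
    best-close zero    = ≤-reflexive (sym (*-zeroʳ (b ^ F)))
    best-close (suc k) = max-≤* (^-nonNeg 0≤b F)
      (λ S → at-≤* Sub.∣ S ∣ (suc k) (^-nonNeg 0≤b F) (power-close (e≤F (suc k)) S)) (subsets n)

    partition-close : ∀ k → partition E k ≤ b ^ F * partition E′ k
    partition-close k = subst (partition E k ≤_)
      (sum-*ˡ (b ^ F) (λ S → at Sub.∣ S ∣ k (weight (E′ S))) (subsets n))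
      (sum-mono (λ S → at-≤* Sub.∣ S ∣ k (^-nonNeg 0≤b F) (power-close ℕP.≤-refl S)) (subsets n))

  Close : Score → Score → Set
  Close E E′ = ∀ S → E S ℕ.≤ suc (E′ S)

  -- One factor b^F comes from each of `best`, `weight` and the reciprocal of `partition`; the last
  -- uses closeness in the reverse direction.
  unnormalised-close : ∀ {E E′} → Close E E′ → Close E′ E → ∀ S →
    unnormalised E S ≤ b ^ F * (b ^ F * b ^ F) * unnormalised E′ S
  unnormalised-close {E} {E′} close close′ S = subst (unnormalised E S ≤_)
    (aux (b ^ F) (best E′ k) (weight (E′ S)) (recip (partition E′ k)))
    (*-mono (best-nonNeg E k)
      (*-nonNeg (*-nonNeg 0≤B (<⇒≤ (0<weight (E′ S)))) (*-nonNeg 0≤B (recip-nonNeg (partition E′ k))))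
      (best-close close k)
      (*-mono (<⇒≤ (0<weight (E S))) (*-nonNeg 0≤B (recip-nonNeg (partition E′ k)))
        (power-close close ℕP.≤-refl S)
        (recip-≤ {c = b ^ F} (0<partition E S) (0<partition E′ S) (partition-close close′ k))))
    where
    k : ℕ
    k = Sub.∣ S ∣
    0≤B : 0ℚ ≤ b ^ F
    0≤B = ^-nonNeg 0≤b F
    aux : ∀ B m w r → (B * m) * ((B * w) * (B * r)) ≡ B * (B * B) * (m * (w * r))
    aux = S.solve 4 (λ B m w r → (B S.:* m) S.:* ((B S.:* w) S.:* (B S.:* r))
      S.:= B S.:* (B S.:* B) S.:* (m S.:* (w S.:* r))) refl

  module _ (S₀ : Subset n) {k₀ : ℕ} (∣S₀∣≡ : Sub.∣ S₀ ∣ ≡ suc k₀) where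

    0<normaliser : ∀ E → 0ℚ < normaliser E
    0<normaliser E = <-≤-trans (0<quality (suc k₀) (E S₀)) (quality≤normaliser E S₀ ∣S₀∣≡)

    probability-nonNeg : ∀ E S → 0ℚ ≤ probability E S
    probability-nonNeg E S = *-nonNeg (unnormalised-nonNeg E S) (recip-nonNeg (normaliser E))

    Σprobability : ∀ E → sum (probability E) (subsets n) ≡ 1ℚ
    Σprobability E = trans (sum-*ʳ (recip (normaliser E)) (unnormalised E) (subsets n))
      (trans (*-comm (normaliser E) (recip (normaliser E))) (recip-inverse (0<normaliser E)))

    -- The reciprocal of the normaliser costs b^(3 F) on top of the b^(3 F) of `unnormalised-close`,
    -- whence the 6.
    probability-close : ∀ {E E′} → Close E E′ → Close E′ E → ∀ S →
      probability E S ≤ b ^ (6 ℕ.* F) * probability E′ S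
    probability-close {E} {E′} close close′ S = subst (probability E S ≤_)
      (trans (aux (b ^ F) (unnormalised E′ S) (recip (normaliser E′)))
        (cong (_* probability E′ S) (trans (sixth (b ^ F)) (trans (^-assocʳ b F 6) (cong (b ^_) (ℕP.*-comm F 6))))))
      (*-mono (unnormalised-nonNeg E S) (*-nonNeg 0≤B³ (recip-nonNeg (normaliser E′)))
        (unnormalised-close close close′ S)
        (recip-≤ {c = b ^ F * (b ^ F * b ^ F)} (0<normaliser E) (0<normaliser E′)
          (subst (normaliser E′ ≤_) (sum-*ˡ (b ^ F * (b ^ F * b ^ F)) (unnormalised E) (subsets n))
            (sum-mono (unnormalised-close close′ close) (subsets n)))))
      where
      0≤B : 0ℚ ≤ b ^ F
      0≤B = ^-nonNeg 0≤b F
      0≤B³ : 0ℚ ≤ b ^ F * (b ^ F * b ^ F)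
      0≤B³ = *-nonNeg 0≤B (*-nonNeg 0≤B 0≤B)
      aux : ∀ B u r → (B * (B * B) * u) * (B * (B * B) * r) ≡ B * (B * (B * (B * (B * B)))) * (u * r)
      aux = S.solve 3 (λ B u r → (B S.:* (B S.:* B) S.:* u) S.:* (B S.:* (B S.:* B) S.:* r)
        S.:= B S.:* (B S.:* (B S.:* (B S.:* (B S.:* B)))) S.:* (u S.:* r)) refl
      sixth : ∀ B → B * (B * (B * (B * (B * B)))) ≡ B ^ 6
      sixth B = cong (λ t → B * (B * (B * (B * (B * t))))) (sym (*-identityʳ B))

  -- Utility

  module Utility (ek≡F : ∀ k → suc k ℕ.≤ n → e (suc k) ℕ.* suc k ≡ F) (E : Score)
    (S₀ : Subset n) {k₀ : ℕ} (∣S₀∣≡ : Sub.∣ S₀ ∣ ≡ suc k₀) where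

    quality^≡weight : ∀ k → suc k ℕ.≤ n → ∀ m → quality (suc k) m ^ suc k ≡ weight m
    quality^≡weight k k≤n m = trans (^-assocʳ b (e (suc k) ℕ.* m) (suc k))
      (cong (b ^_) (trans (ℕP.*-assoc (e (suc k)) m (suc k))
        (trans (cong (e (suc k) ℕ.*_) (ℕP.*-comm m (suc k)))
          (trans (sym (ℕP.*-assoc (e (suc k)) (suc k) m)) (cong (ℕ._* m) (ek≡F k k≤n))))))

    -- By `quality^≡weight` the left side is the weight of a densest set of that size, which is one
    -- summand of `partition`.
    best^≤partition : ∀ k → suc k ℕ.≤ n → best E (suc k) ^ suc k ≤ partition E (suc k)
    best^≤partition k k≤n = subst (best E (suc k) ^ suc k ≤_)
      (sum-cong (λ S → trans (at-^ Sub.∣ S ∣ (suc k) (quality (suc k) (E S)) k)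
        (cong (at Sub.∣ S ∣ (suc k)) (quality^≡weight k k≤n (E S)))) (subsets n))
      (max^≤sum (λ S → at-nonNeg Sub.∣ S ∣ (suc k) (<⇒≤ (0<quality (suc k) (E S)))) k (subsets n))

    Q₀ : ℚ
    Q₀ = quality (suc k₀) (E S₀)

    -- One of the two factors s is lost either in the choice of the size |S| or in the choice of S among the
    -- sets of its size.
    unnormalised-bad : ∀ {s} → 0ℚ ≤ s → ∀ {S k} → Sub.∣ S ∣ ≡ suc k → quality (suc k) (E S) ≤ s * (s * Q₀) →
      unnormalised E S ≤ normaliser E * (s * conditional E S + s ^ Sub.∣ S ∣)
    unnormalised-bad {s} 0≤s {S} {k} eq bad = ⊎-rec unlikely-size unlikely-set (≤-total (best E (suc k)) (s * Q₀))
      where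
      c : ℚ
      c = conditional E S
      0≤c : 0ℚ ≤ c
      0≤c = conditional-nonNeg E S
      best≡ : best E Sub.∣ S ∣ ≡ best E (suc k)
      best≡ = cong (best E) eq
      0≤Z : 0ℚ ≤ normaliser E
      0≤Z = <⇒≤ (0<normaliser S₀ ∣S₀∣≡ E)
      unlikely-size : best E (suc k) ≤ s * Q₀ → unnormalised E S ≤ normaliser E * (s * c + s ^ Sub.∣ S ∣)
      unlikely-size le = ≤-trans (*-monoʳ 0≤c (subst (_≤ s * normaliser E) (sym best≡)
          (≤-trans le (*-monoˡ 0≤s (quality≤normaliser E S₀ ∣S₀∣≡)))))
        (≤-trans (≤-reflexive (aux s (normaliser E) c))
          (*-monoˡ 0≤Z (p≤p+q (s * c) (^-nonNeg 0≤s Sub.∣ S ∣))))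
        where
        aux : ∀ s z c → s * z * c ≡ z * (s * c)
        aux = S.solve 3 (λ s z c → s S.:* z S.:* c S.:= z S.:* (s S.:* c)) refl
      unlikely-set : s * Q₀ ≤ best E (suc k) → unnormalised E S ≤ normaliser E * (s * c + s ^ Sub.∣ S ∣)
      unlikely-set le = *-mono (best-nonNeg E Sub.∣ S ∣)
        (+-nonNeg (*-nonNeg 0≤s 0≤c) (^-nonNeg 0≤s Sub.∣ S ∣)) (best≤normaliser E S)
        (≤-trans c≤ (subst (_≤ s * c + s ^ Sub.∣ S ∣) (+-identityˡ (s ^ Sub.∣ S ∣))
          (+-monoˡ-≤ (s ^ Sub.∣ S ∣) (*-nonNeg 0≤s 0≤c))))
        where
        k≤n : suc k ℕ.≤ n
        k≤n = subst (ℕ._≤ n) eq (∣p∣≤n S)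
        weight≤ : weight (E S) ≤ s ^ Sub.∣ S ∣ * partition E Sub.∣ S ∣
        weight≤ = subst₂ _≤_ (quality^≡weight k k≤n (E S))
          (cong (λ i → s ^ i * partition E i) (sym eq))
          (≤-trans (^-monoˡ (<⇒≤ (0<quality (suc k) (E S))) (≤-trans bad (*-monoˡ 0≤s le)) (suc k))
            (≤-trans (≤-reflexive (^-distrib-* s (best E (suc k)) (suc k)))
              (*-monoˡ (^-nonNeg 0≤s (suc k)) (best^≤partition k k≤n))))
        c≤ : c ≤ s ^ Sub.∣ S ∣
        c≤ = ≤-trans (*-monoʳ (recip-nonNeg (partition E Sub.∣ S ∣)) weight≤)
          (≤-reflexive (trans (*-assoc (s ^ Sub.∣ S ∣) (partition E Sub.∣ S ∣) (recip (partition E Sub.∣ S ∣)))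
            (trans (cong (s ^ Sub.∣ S ∣ *_) (trans (*-comm (partition E Sub.∣ S ∣) (recip (partition E Sub.∣ S ∣)))
                (recip-inverse (0<partition E S)))) (*-identityʳ (s ^ Sub.∣ S ∣)))))

    module _ (1≤n : 1 ℕ.≤ n) {t : ℚ} (0≤t : 0ℚ ≤ t) (t-inverse : t * (ι n * ι 2) ≡ 1ℚ) (m : ℕ) where

      -- Here t = 1 / (2 n). The single factor t pays for the union bound and leaves t^m as the
      -- scale of the failure probability.
      s : ℚ
      s = t * t ^ m

      1≤ιn : 1ℚ ≤ ι n
      1≤ιn = ι-mono′ 1≤n

      nt≡½ : ι n * t ≡ ½
      nt≡½ = trans (aux (ι n) t) (trans (cong (½ *_) t-inverse) (*-identityʳ ½))
        where
        aux : ∀ n t → n * t ≡ ½ * (t * (n * ι 2))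
        aux = solve 2 (λ n t → n :* t := con ½ :* (t :* (n :* con (ι 2)))) refl

      t≤1 : t ≤ 1ℚ
      t≤1 = ≤-trans (subst₂ _≤_ (*-identityˡ t) nt≡½ (*-monoʳ {t} {1ℚ} {ι n} 0≤t 1≤ιn)) ½≤1
        where
        ½≤1 : ½ ≤ 1ℚ
        ½≤1 = p≤p+q ½ (<⇒≤ (positive⁻¹ ½))

      ^≤1 : ∀ k → t ^ k ≤ 1ℚ
      ^≤1 zero    = ≤-refl
      ^≤1 (suc k) = ≤-trans (*-monoˡ {t} {t ^ k} {1ℚ} 0≤t (^≤1 k)) (subst (_≤ 1ℚ) (sym (*-identityʳ t)) t≤1)

      -- What remains of the bound in `unnormalised-bad` once a factor t^m is taken out of both
      -- summands.
      excess : Subset n → ℚ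
      excess S = t * conditional E S + t ^ Sub.∣ S ∣

      -- The first summands add up to at most t (n + 1) ≤ 2 n t = 1, the second to (1 + t)^n ≤ exp
      -- (1/2) ≤ 2.
      Σexcess≤3 : sum excess (subsets n) ≤ ι 3
      Σexcess≤3 = subst (_≤ ι 3)
        (sym (trans (sum-+ (λ S → t * conditional E S) (λ S → t ^ Sub.∣ S ∣) (subsets n))
          (cong (_+ sum (λ S → t ^ Sub.∣ S ∣) (subsets n)) (sum-*ˡ t (conditional E) (subsets n)))))
        (+-mono-≤ {t * sum (conditional E) (subsets n)} {1ℚ} {sum (λ S → t ^ Sub.∣ S ∣) (subsets n)} {ι 2}
          (≤-trans (*-monoˡ 0≤t (≤-trans (Σconditional≤ E) sn≤2n)) (≤-reflexive t-inverse))
          (subst (_≤ ι 2) (sym (size-generating-function t n))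
            (≤-trans (subst (λ q → (1ℚ + t) ^ n ≤ psum q n) nt≡½ (compound≤psum {t} 0≤t {n} {n} ℕP.≤-refl))
              (psum-½ n))))
        where
        sn≤2n : ι (suc n) ≤ ι n * ι 2
        sn≤2n = subst₂ _≤_ (sym (ι-suc n)) (aux (ι n)) (+-monoˡ-≤ (ι n) 1≤ιn)
          where
          aux : ∀ x → x + x ≡ x * ι 2
          aux = solve 1 (λ x → x :+ x := x :* con (ι 2)) refl

      Bad : Subset n → Set
      Bad S = Sub.∣ S ∣ ≡ 0 ⊎ quality Sub.∣ S ∣ (E S) ≤ s * (s * Q₀)

      excess-nonNeg : ∀ S → 0ℚ ≤ excess S
      excess-nonNeg S = +-nonNeg (*-nonNeg 0≤t (conditional-nonNeg E S)) (^-nonNeg 0≤t Sub.∣ S ∣)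

      unnormalised≤excess : ∀ S → Bad S → ∀ k → Sub.∣ S ∣ ≡ k → unnormalised E S ≤ normaliser E * (t ^ m * excess S)
      unnormalised≤excess S _ zero eq = subst (_≤ normaliser E * (t ^ m * excess S))
        (sym (trans (cong (λ i → best E i * conditional E S) eq) (*-zeroˡ (conditional E S))))
        (*-nonNeg (<⇒≤ (0<normaliser S₀ ∣S₀∣≡ E)) (*-nonNeg (^-nonNeg 0≤t m) (excess-nonNeg S)))
      unnormalised≤excess S (inj₁ eq′) (suc k) eq = contradiction (trans (sym eq′) eq) λ ()
      unnormalised≤excess S (inj₂ bad) (suc k) eq = ≤-trans
        (unnormalised-bad {s} (*-nonNeg 0≤t (^-nonNeg 0≤t m)) {S} eq
          (subst (λ i → quality i (E S) ≤ s * (s * Q₀)) eq bad))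
        (*-monoˡ (<⇒≤ (0<normaliser S₀ ∣S₀∣≡ E))
          (subst (s * conditional E S + s ^ Sub.∣ S ∣ ≤_) (aux t (t ^ m) (conditional E S) (t ^ Sub.∣ S ∣))
            (+-monoʳ-≤ (s * conditional E S) (≤-trans (≤-reflexive (^-distrib-* t (t ^ m) Sub.∣ S ∣))
              (*-monoˡ (^-nonNeg 0≤t Sub.∣ S ∣) (subst (λ i → (t ^ m) ^ i ≤ t ^ m) (sym eq) first-factor))))))
        where
        -- A nonempty set supplies at least one factor t^m; the others are at most 1.
        first-factor : (t ^ m) ^ suc k ≤ t ^ m
        first-factor = subst ((t ^ m) ^ suc k ≤_) (*-identityʳ (t ^ m))
          (*-monoˡ {t ^ m} {(t ^ m) ^ k} {1ℚ} (^-nonNeg 0≤t m)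
            (subst (_≤ 1ℚ) (sym (^-assocʳ t m k)) (^≤1 (m ℕ.* k))))
        aux : ∀ t u c v → t * u * c + v * u ≡ u * (t * c + v)
        aux = S.solve 4 (λ t u c v → t S.:* u S.:* c S.:+ v S.:* u S.:= u S.:* (t S.:* c S.:+ v)) refl

      Σbad≤ : ∀ O → (∀ S → T (O S) → Bad S) → sum (probability E) (filterᵇ O (subsets n)) ≤ t ^ m * ι 3
      Σbad≤ O bad = ≤-trans
        (sum-filterᵇ≤ {f = probability E} {λ S → t ^ m * excess S} O
          (λ S S∈O → subst (probability E S ≤_) (cancel (t ^ m * excess S))
            (*-monoʳ (recip-nonNeg (normaliser E)) (unnormalised≤excess S (bad S S∈O) Sub.∣ S ∣ refl)))
          (λ S → *-nonNeg (^-nonNeg 0≤t m) (excess-nonNeg S)) (subsets n))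
        (≤-trans (≤-reflexive (sum-*ˡ (t ^ m) excess (subsets n))) (*-monoˡ (^-nonNeg 0≤t m) Σexcess≤3))
        where
        aux : ∀ z x r → z * x * r ≡ r * z * x
        aux = S.solve 3 (λ z x r → z S.:* x S.:* r S.:= r S.:* z S.:* x) refl
        cancel : ∀ x → normaliser E * x * recip (normaliser E) ≡ x
        cancel x = trans (aux (normaliser E) x (recip (normaliser E)))
          (trans (cong (_* x) (recip-inverse (0<normaliser S₀ ∣S₀∣≡ E))) (*-identityˡ x))

-- Graphs

edges : ∀ {n} → Graph n → Subset n → ℕ
edges G S = length (inducedEdges G S)

filterᵇ-cover : ∀ {A : Set} (f h g : A → Bool) → (∀ x → T (f x) → T (h x) ⊎ T (g x)) → ∀ xs →
  length (filterᵇ f xs) ℕ.≤ length (filterᵇ h xs) ℕ.+ length (filterᵇ g xs)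
filterᵇ-cover f h g cover [] = ℕ.z≤n
filterᵇ-cover f h g cover (x ∷ xs) with f x | h x | g x | cover x
... | false | false | false | _ = filterᵇ-cover f h g cover xs
... | false | true  | false | _ = ℕP.m≤n⇒m≤1+n (filterᵇ-cover f h g cover xs)
... | false | false | true  | _ = ℕP.≤-trans (filterᵇ-cover f h g cover xs)
  (ℕP.+-monoʳ-≤ (length (filterᵇ h xs)) (ℕP.n≤1+n (length (filterᵇ g xs))))
... | false | true  | true  | _ = ℕP.m≤n⇒m≤1+n (ℕP.≤-trans (filterᵇ-cover f h g cover xs)
  (ℕP.+-monoʳ-≤ (length (filterᵇ h xs)) (ℕP.n≤1+n (length (filterᵇ g xs)))))
... | true  | true  | false | _ = ℕ.s≤s (filterᵇ-cover f h g cover xs)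
... | true  | true  | true  | _ = ℕ.s≤s (ℕP.≤-trans (filterᵇ-cover f h g cover xs)
  (ℕP.+-monoʳ-≤ (length (filterᵇ h xs)) (ℕP.n≤1+n (length (filterᵇ g xs)))))
... | true  | false | true  | _ = subst (suc (length (filterᵇ f xs)) ℕ.≤_)
  (sym (ℕP.+-suc (length (filterᵇ h xs)) (length (filterᵇ g xs)))) (ℕ.s≤s (filterᵇ-cover f h g cover xs))
... | true  | false | false | c = contradiction (c tt) (λ { (inj₁ ()) ; (inj₂ ()) })

-- An edge of one graph inside S is an edge of the other inside S or a pair on which they differ,
-- and there is exactly one such pair.
edges-close : ∀ {n} (G G′ : Graph n) → EdgeNeighbouring G G′ →
  (∀ S → edges G S ℕ.≤ suc (edges G′ S)) × (∀ S → edges G′ S ℕ.≤ suc (edges G S))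
edges-close {n} G G′ one =
  (λ S → subst (λ d → edges G S ℕ.≤ d ℕ.+ edges G′ S) one
    (filterᵇ-cover _ _ _
      (λ (i , j) → cover (lookup S i) (lookup S j) (adjacent G i j) (adjacent G′ i j)) (pairs n))) ,
  (λ S → subst (λ d → edges G′ S ℕ.≤ d ℕ.+ edges G S) one
    (filterᵇ-cover _ _ _
      (λ (i , j) → cover′ (lookup S i) (lookup S j) (adjacent G i j) (adjacent G′ i j)) (pairs n)))
  where
  cover : ∀ s t p q → T (s ∧ t ∧ p) → T (p xor q) ⊎ T (s ∧ t ∧ q)
  cover true true true true  _ = inj₂ tt
  cover true true true false _ = inj₁ tt
  cover′ : ∀ s t p q → T (s ∧ t ∧ q) → T (p xor q) ⊎ T (s ∧ t ∧ p)
  cover′ true true true  true _ = inj₂ tt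
  cover′ true true false true _ = inj₁ tt

nonempty-size : ∀ {n} (S : Subset n) → Nonempty S → ∃[ k ] Sub.∣ S ∣ ≡ suc k
nonempty-size (inside Vec.∷ S)  _                     = Sub.∣ S ∣ , refl
nonempty-size (outside Vec.∷ S) (Fin.suc i , Vec.there i∈S) = nonempty-size S (i , i∈S)

empty-size : ∀ {n} (S : Subset n) → ¬ Nonempty S → Sub.∣ S ∣ ≡ 0
empty-size {n} S empty = trans (cong Sub.∣_∣ (Empty-unique empty)) (∣⊥∣≡0 n)

/-* : ∀ m k → (ℤ.+ m / suc k) * ι (suc k) ≡ ι m
/-* m k = toℚᵘ-injective (begin-equality
  toℚᵘ ((ℤ.+ m / suc k) * ι (suc k))           ≃⟨ toℚᵘ-homo-* (ℤ.+ m / suc k) (ι (suc k)) ⟩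
  toℚᵘ (ℤ.+ m / suc k) ℚᵘ.* toℚᵘ (ι (suc k))   ≃⟨ ℚᵘP.*-cong (toℚᵘ-fromℚᵘ (ℚᵘ.mkℚᵘ (ℤ.+ m) k))
                                                     (toℚᵘ-fromℚᵘ (ℚᵘ.mkℚᵘ (ℤ.+ suc k) 0)) ⟩
  ℚᵘ.mkℚᵘ (ℤ.+ m) k ℚᵘ.* ℚᵘ.mkℚᵘ (ℤ.+ suc k) 0  ≃⟨ ℚᵘ.*≡* (ℤP.*-assoc (ℤ.+ m) (ℤ.+ suc k) (ℤ.+ 1)) ⟩
  ℚᵘ.mkℚᵘ (ℤ.+ m) 0                             ≃⟨ toℚᵘ-fromℚᵘ (ℚᵘ.mkℚᵘ (ℤ.+ m) 0) ⟨
  toℚᵘ (ι m)                                    ∎)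
  where open ℚᵘP.≤-Reasoning

density-* : ∀ {n} (G : Graph n) S {k} → Sub.∣ S ∣ ≡ suc k → density G S * ι (suc k) ≡ ι (edges G S)
density-* G S {k} eq with Sub.∣ S ∣ | eq
... | .(suc k) | refl = /-* (edges G S) k

density-nonNeg : ∀ {n} (G : Graph n) S → 0ℚ ≤ density G S
density-nonNeg G S with Sub.∣ S ∣
... | zero  = ≤-refl
... | suc k = nonNegative⁻¹ (ℤ.+ edges G S / suc k) {{normalize-nonNeg (edges G S) (suc k)}}

foldr-⊔-attained : ∀ {A : Set} (f : A → ℚ) xs →
  foldr _⊔_ 0ℚ (map f xs) ≡ 0ℚ ⊎ ∃[ x ] (x ∈ xs × foldr _⊔_ 0ℚ (map f xs) ≡ f x)
foldr-⊔-attained f [] = inj₁ refl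
foldr-⊔-attained f (x ∷ xs) with ⊔-sel (f x) (foldr _⊔_ 0ℚ (map f xs)) | foldr-⊔-attained f xs
... | inj₁ eq | _                    = inj₂ (x , here refl , eq)
... | inj₂ eq | inj₁ eq′             = inj₁ (trans eq eq′)
... | inj₂ eq | inj₂ (y , y∈xs , eq′) = inj₂ (y , there y∈xs , trans eq eq′)

densest : ∀ {n} → 1 ℕ.≤ n → (G : Graph n) → ∃[ S ] ((∃[ k ] Sub.∣ S ∣ ≡ suc k) × maxDensity G ≤ density G S)
densest {suc n} _ G with foldr-⊔-attained (density G) (filter nonempty? (subsets (suc n)))
-- The fold may return its default 0; then the whole vertex set is dense enough.
... | inj₁ eq = Sub.⊤ , (n , ∣⊤∣≡n (suc n)) , subst (_≤ density G Sub.⊤) (sym eq) (density-nonNeg G Sub.⊤)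
... | inj₂ (S , S∈ , eq) = S ,
  nonempty-size S (proj₂ (∈-filter⁻ nonempty? {xs = subsets (suc n)} S∈)) , ≤-reflexive eq

ι-* : ∀ m n → ι (m ℕ.* n) ≡ ι m * ι n
ι-* zero    n = sym (*-zeroˡ (ι n))
ι-* (suc m) n = trans (ι-+ n (m ℕ.* n)) (trans (cong (ι n +_) (ι-* m n)) (sym (ι-suc-* m (ι n))))

module Exponents (n m : ℕ) where

  -- The factor n! makes the division by every size k ≤ n exact. The factor m + 1, with m a bound
  -- for q, makes the scale at least q and thereby ensures x + x ≤ 1.
  scale : ℕ
  scale = n ! ℕ.* suc m

  exponent : ℕ → ℕ
  exponent zero    = 0
  exponent (suc k) = scale ℕD./ suc k

  exponent≤scale : ∀ k → exponent k ℕ.≤ scale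
  exponent≤scale zero    = ℕ.z≤n
  exponent≤scale (suc k) = ℕD.m/n≤m scale (suc k)

  exponent-* : ∀ k → suc k ℕ.≤ n → exponent (suc k) ℕ.* suc k ≡ scale
  exponent-* k k≤n = ℕD.m/n*n≡m
    (ℕD.∣m⇒∣m*n (suc m) (ℕD.∣-trans (ℕD.m∣m*n (k !)) (ℕD.m≤n⇒m!∣n! k≤n)))

  suc-m≤scale : suc m ℕ.≤ scale
  suc-m≤scale = ℕP.m≤n*m (suc m) (n !) {{ℕP._!≢0 n}}

sumᴿ-ofℚ : ∀ {A : Set} (f : A → ℚ) xs k → seq (sumᴿ (map (λ x → ofℚ (f x)) xs)) k ≡ sum f xs
sumᴿ-ofℚ f []       k = refl
sumᴿ-ofℚ f (x ∷ xs) k = cong (f x +_) (sumᴿ-ofℚ f xs k)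

-- The algorithm

^-mono-< : ∀ {x y} → 0ℚ ≤ x → x < y → ∀ n → x ^ suc n < y ^ suc n
^-mono-< {x} {y} 0≤x x<y n = ≤-<-trans (*-monoˡ {x} 0≤x (^-monoˡ {x} {y} 0≤x (<⇒≤ x<y) n))
  (*-monoˡ-<-pos (y ^ n) {{positive (^-pos (≤-<-trans 0≤x x<y) n)}} x<y)

-- With base b = 1 + 2x and 12 F x = q, privacy costs b^(6F) ≤ exp q.
module Parameters (q : ℚ) (0<q : 0ℚ < q) (n : ℕ) where

  open Exponents n (proj₁ (ceil q)) public

  0<scale : 0ℚ < ι scale
  0<scale = <-≤-trans 0<1 (ι-mono′ (ℕP.≤-trans (ℕ.s≤s ℕ.z≤n) suc-m≤scale))

  q≤scale : q ≤ ι scale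
  q≤scale = ≤-trans (proj₂ (ceil q)) (ι-mono′ (ℕP.≤-trans (ℕP.n≤1+n (proj₁ (ceil q))) suc-m≤scale))

  0<12scale : 0ℚ < ι 12 * ι scale
  0<12scale = *-pos (positive⁻¹ (ι 12)) 0<scale

  x : ℚ
  x = recip (ι 12 * ι scale) * q

  0≤x : 0ℚ ≤ x
  0≤x = *-nonNeg (recip-nonNeg (ι 12 * ι scale)) (<⇒≤ 0<q)

  12Fx≡q : ι 12 * (ι scale * x) ≡ q
  12Fx≡q = trans (aux (ι 12) (ι scale) (recip (ι 12 * ι scale)) q)
    (trans (cong (_* q) (recip-inverse 0<12scale)) (*-identityˡ q))
    where
    aux : ∀ t f r q → t * (f * (r * q)) ≡ r * (t * f) * q
    aux = S.solve 4 (λ t f r q → t S.:* (f S.:* (r S.:* q)) S.:= r S.:* (t S.:* f) S.:* q) refl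

  x+x≤1 : x + x ≤ 1ℚ
  x+x≤1 = *-cancelˡ-≤-pos (ι scale) {{positive 0<scale}} (≤-trans
    (≤-trans (p≤p+q (ι scale * (x + x)) (*-nonNeg (0≤ι 10) (*-nonNeg (0≤ι scale) 0≤x)))
      (≤-reflexive (trans (aux (ι scale) x) 12Fx≡q)))
    (≤-trans q≤scale (≤-reflexive (sym (*-identityʳ (ι scale))))))
    where
    aux : ∀ f x → f * (x + x) + ι 10 * (f * x) ≡ ι 12 * (f * x)
    aux = solve 2 (λ f x → f :* (x :+ x) :+ con (ι 10) :* (f :* x) := con (ι 12) :* (f :* x)) refl

  base : ℚ
  base = 1ℚ + (x + x)

  1≤base : 1ℚ ≤ base
  1≤base = p≤p+q 1ℚ (+-nonNeg 0≤x 0≤x)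

  base^6scale≤ : ∀ {k r} → 6 ℕ.* scale ℕ.≤ k → q ≤ r → base ^ (6 ℕ.* scale) ≤ psum r k
  base^6scale≤ {k} {r} le q≤r = ≤-trans (compound≤psum {x + x} (+-nonNeg 0≤x 0≤x) {6 ℕ.* scale} {k} le)
    (≤-trans (≤-reflexive (cong (λ t → psum t k) exponent≡)) (psum-mono-arg {q} {r} (<⇒≤ 0<q) q≤r k))
    where
    aux : ∀ f x → ι 6 * f * (x + x) ≡ ι 12 * (f * x)
    aux = solve 2 (λ f x → con (ι 6) :* f :* (x :+ x) := con (ι 12) :* (f :* x)) refl
    exponent≡ : ι (6 ℕ.* scale) * (x + x) ≡ q
    exponent≡ = trans (cong (_* (x + x)) (ι-* 6 scale)) (trans (aux (ι scale) x) 12Fx≡q)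

  open Mechanism n scale exponent exponent≤scale base 1≤base public

  scaled-density : ∀ (G : Graph n) S {k} → Sub.∣ S ∣ ≡ suc k →
    ι (exponent (suc k) ℕ.* edges G S) ≡ ι scale * density G S
  scaled-density G S {k} eq = trans (ι-* (exponent (suc k)) (edges G S))
    (trans (cong (ι (exponent (suc k)) *_) (sym (density-* G S eq)))
      (trans (aux (ι (exponent (suc k))) (density G S) (ι (suc k)))
        (cong (_* density G S) (trans (sym (ι-* (exponent (suc k)) (suc k)))
          (cong ι (exponent-* k (subst (ℕ._≤ n) eq (∣p∣≤n S))))))))
    where
    aux : ∀ e d k → e * (d * k) ≡ e * k * d
    aux = S.solve 3 (λ e d k → e S.:* (d S.:* k) S.:= e S.:* k S.:* d) refl

module _ (ε : ℝ) (q : ℚ) (0<q : 0ℚ < q) (N : ℕ) (q≤ε : ∀ k → N ℕ.≤ k → q ≤ seq ε k) where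

  open Parameters q 0<q

  mechanism : Algorithm
  mechanism n 2≤n G = record
    { mass   = λ S → ofℚ (probability n (edges G) S)
    ; nonneg = λ S → ≤ᴿ-eventually 0ᴿ (ofℚ (probability n (edges G) S)) 0
        (λ _ _ → probability-nonNeg n S₀ eq₀ (edges G) S)
    ; total  = ≤ᴿ-eventually (sumᴿ (map mass′ (subsets n))) 1ᴿ 0 (λ k _ → ≤-reflexive (total≡ k))
             , ≤ᴿ-eventually 1ᴿ (sumᴿ (map mass′ (subsets n))) 0 (λ k _ → ≤-reflexive (sym (total≡ k))) }
    where
    mass′ : Subset n → ℝ
    mass′ S = ofℚ (probability n (edges G) S)
    S₀ : Subset n
    S₀ = proj₁ (densest (ℕP.≤-trans (ℕP.n≤1+n 1) 2≤n) G)
    eq₀ : Sub.∣ S₀ ∣ ≡ suc _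
    eq₀ = proj₂ (proj₁ (proj₂ (densest (ℕP.≤-trans (ℕP.n≤1+n 1) 2≤n) G)))
    total≡ : ∀ k → seq (sumᴿ (map mass′ (subsets n))) k ≡ 1ℚ
    total≡ k = trans (sumᴿ-ofℚ (probability n (edges G)) (subsets n) k) (Σprobability n S₀ eq₀ (edges G))

  mechanism-private : ∀ {δ} → 0ᴿ <ᴿ δ → EdgePrivate ε δ mechanism
  mechanism-private {δ} 0<δ n 2≤n G G′ neighbours O =
    let (M , 0≤δ) = eventually-positive {δ} 0<δ
        K = N ℕ.⊔ (M ℕ.⊔ 6 ℕ.* scale n)
    in ≤ᴿ-eventually (Pr (mechanism n 2≤n G) O) (exp ε *ᴿ Pr (mechanism n 2≤n G′) O +ᴿ δ) K (λ k K≤k →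
      let MK≤k = ℕP.m⊔n≤o⇒n≤o N (M ℕ.⊔ 6 ℕ.* scale n) K≤k
      in subst₂ (λ s t → s ≤ psum (seq ε k) k * t + seq δ k)
        (sym (sumᴿ-ofℚ (probability n (edges G)) (filterᵇ O (subsets n)) k))
        (sym (sumᴿ-ofℚ (probability n (edges G′)) (filterᵇ O (subsets n)) k))
        (bound k (ℕP.m⊔n≤o⇒n≤o M (6 ℕ.* scale n) MK≤k) (q≤ε k (ℕP.m⊔n≤o⇒m≤o N (M ℕ.⊔ 6 ℕ.* scale n) K≤k))
          (0≤δ k (ℕP.m⊔n≤o⇒m≤o M (6 ℕ.* scale n) MK≤k))))
    where
    S₀ : Subset n
    S₀ = proj₁ (densest (ℕP.≤-trans (ℕP.n≤1+n 1) 2≤n) G)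
    eq₀ : Sub.∣ S₀ ∣ ≡ suc _
    eq₀ = proj₂ (proj₁ (proj₂ (densest (ℕP.≤-trans (ℕP.n≤1+n 1) 2≤n) G)))
    p p′ : ℚ
    p  = sum (probability n (edges G)) (filterᵇ O (subsets n))
    p′ = sum (probability n (edges G′)) (filterᵇ O (subsets n))
    bound : ∀ k {e d} → 6 ℕ.* scale n ℕ.≤ k → q ≤ e → 0ℚ ≤ d → p ≤ psum e k * p′ + d
    bound k {e} {d} le q≤e 0≤d = ≤-trans
      (sum-mono (probability-close n S₀ eq₀ {edges G} {edges G′}
        (proj₁ (edges-close G G′ neighbours)) (proj₂ (edges-close G G′ neighbours))) (filterᵇ O (subsets n)))
      (≤-trans (≤-reflexive (sum-*ˡ (base n ^ (6 ℕ.* scale n)) (probability n (edges G′)) (filterᵇ O (subsets n))))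
        (≤-trans (*-monoʳ {p′} {base n ^ (6 ℕ.* scale n)} {psum e k}
            (sum-nonNeg (probability-nonNeg n S₀ eq₀ (edges G′)) (filterᵇ O (subsets n)))
            (base^6scale≤ n {k} {e} le q≤e))
          (p≤p+q (psum e k * p′) 0≤d)))

-- Accuracy: from scores back to densities.

^-inverse : ∀ {t T} → t * T ≡ 1ℚ → ∀ k → t ^ k * T ^ k ≡ 1ℚ
^-inverse {t} {T} tT≡1 k = trans (sym (^-distrib-* t T k)) (trans (cong (_^ k) tT≡1) (1^ k))
  where
  1^ : ∀ k → 1ℚ ^ k ≡ 1ℚ
  1^ zero    = refl
  1^ (suc k) = trans (*-identityˡ (1ℚ ^ k)) (1^ k)

-- Multiplying by T^κ twice cancels the two factors s, and dividing by b^f leaves b to the power of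
-- the deficit f₀ - f.
power-gap : ∀ {b s T κ f f₀} → 0ℚ < b → 0ℚ ≤ T → s * T ^ κ ≡ 1ℚ → f ℕ.≤ f₀ →
  s * (s * b ^ f₀) ≤ b ^ f → b ^ (f₀ ℕ.∸ f) ≤ T ^ (κ ℕ.+ κ)
power-gap {b} {s} {T} {κ} {f} {f₀} 0<b 0≤T sT≡1 f≤f₀ le = subst₂ _≤_
  (trans (aux (T ^ κ) s B) (trans (cong₂ (λ u v → u * (v * B)) sT≡1 sT≡1)
    (trans (*-identityˡ (1ℚ * B)) (*-identityˡ B))))
  (trans (*-identityʳ (T ^ κ * T ^ κ)) (sym (^-homo-* T κ κ)))
  (*-monoˡ {T ^ κ * T ^ κ} {s * (s * B)} {1ℚ} (*-nonNeg (^-nonNeg 0≤T κ) (^-nonNeg 0≤T κ)) cancelled)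
  where
  B : ℚ
  B = b ^ (f₀ ℕ.∸ f)
  aux : ∀ t s B → t * t * (s * (s * B)) ≡ s * t * (s * t * B)
  aux = S.solve 3 (λ t s B → t S.:* t S.:* (s S.:* (s S.:* B)) S.:= s S.:* t S.:* (s S.:* t S.:* B)) refl
  aux′ : ∀ s B c → s * (s * (B * c)) ≡ s * (s * B) * c
  aux′ = S.solve 3 (λ s B c → s S.:* (s S.:* (B S.:* c)) S.:= s S.:* (s S.:* B) S.:* c) refl
  b^f₀≡ : b ^ f₀ ≡ B * b ^ f
  b^f₀≡ = trans (cong (b ^_) (sym (ℕP.m∸n+n≡m f≤f₀))) (^-homo-* b (f₀ ℕ.∸ f) f)
  cancelled : s * (s * B) ≤ 1ℚ
  cancelled = *-cancelʳ-≤-pos (b ^ f) {{positive (^-pos 0<b f)}}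
    (subst₂ _≤_ (trans (cong (λ v → s * (s * v)) b^f₀≡) (aux′ s B (b ^ f))) (sym (*-identityˡ (b ^ f))) le)

-- With K = 4 (κ + 1), the chain n^K < exp (2 ℓ)^K = exp (2 K ℓ) ≤ exp (M x) ≤ (1 + 2 x)^M ≤ (2
-- n)^(K / 2) ≤ n^K is absurd. Its last step is 2 n ≤ n^2, where n ≥ 2 enters.
growth-contradiction : ∀ {n κ ℓ x M k} → 2 ℕ.≤ n → 0ℚ ≤ ℓ → 0ℚ ≤ x → x + x ≤ 1ℚ → ι n < psum (ℓ + ℓ) k →
  ι (4 ℕ.* suc κ) * (ℓ + ℓ) ≤ ι M * x → ¬ (1ℚ + (x + x)) ^ M ≤ (ι n * ι 2) ^ (suc κ ℕ.+ suc κ)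
growth-contradiction {n} {κ} {ℓ} {x} {M} {k} 2≤n 0≤ℓ 0≤x 2x≤1 n<psum 8κℓ≤Mx compound≤ =
  -- `^-mono-<` takes the predecessor of the exponent, here 4 (κ + 1) - 1.
  <-irrefl refl (<-≤-trans (^-mono-< {ι n} {psum (ℓ + ℓ) k} (0≤ι n) n<psum (κ ℕ.+ 3 ℕ.* suc κ))
    (≤-trans (psum-^ {ℓ + ℓ} 0≤2ℓ k (4 ℕ.* suc κ))
      (≤-trans (psum-mono-arg {ι (4 ℕ.* suc κ) * (ℓ + ℓ)} {ι M * x} (*-nonNeg (0≤ι (4 ℕ.* suc κ)) 0≤2ℓ) 8κℓ≤Mx
          (4 ℕ.* suc κ ℕ.* k))
        (≤-trans (psum≤compound {x} 0≤x 2x≤1 M (4 ℕ.* suc κ ℕ.* k)) (≤-trans compound≤ (≤-trans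
          (^-monoˡ {ι n * ι 2} {ι n ^ 2} (*-nonNeg (0≤ι n) (0≤ι 2)) 2n≤n² (suc κ ℕ.+ suc κ))
          (≤-reflexive (trans (^-assocʳ (ι n) 2 (suc κ ℕ.+ suc κ)) (cong (ι n ^_) four)))))))))
  where
  0≤2ℓ : 0ℚ ≤ ℓ + ℓ
  0≤2ℓ = +-nonNeg 0≤ℓ 0≤ℓ
  2n≤n² : ι n * ι 2 ≤ ι n ^ 2
  2n≤n² = subst (ι n * ι 2 ≤_) (cong (ι n *_) (sym (*-identityʳ (ι n))))
    (*-monoˡ {ι n} {ι 2} {ι n} (0≤ι n) (ι-mono′ 2≤n))
  four : 2 ℕ.* (suc κ ℕ.+ suc κ) ≡ 4 ℕ.* suc κ
  four = trans (cong (2 ℕ.*_) (cong (suc κ ℕ.+_) (sym (ℕP.+-identityʳ (suc κ))))) (sym (ℕP.*-assoc 2 2 (suc κ)))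

-- the choice of the constant 384
constants : ∀ κ {ℓ u q F x} → ι 12 * (F * x) ≡ q → ι 4 * (u * q) ≡ 1ℚ →
  ι (4 ℕ.* κ) * (ℓ + ℓ) ≡ F * (ι 384 * ι κ * u * ℓ) * x
constants κ {ℓ} {u} {q} {F} {x} 12Fx≡q 4uq≡1 = trans (cong (_* (ℓ + ℓ)) (ι-* 4 κ)) (trans (aux₁ (ι κ) ℓ)
  (trans (cong (ι 8 * ι κ * ℓ *_) (sym (trans (cong (λ z → ι 4 * (u * z)) 12Fx≡q) 4uq≡1))) (aux₂ (ι κ) ℓ u F x)))
  where
  aux₁ : ∀ κ ℓ → ι 4 * κ * (ℓ + ℓ) ≡ ι 8 * κ * ℓ * 1ℚ
  aux₁ = solve 2 (λ κ ℓ → con (ι 4) :* κ :* (ℓ :+ ℓ) := con (ι 8) :* κ :* ℓ :* con 1ℚ) refl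
  aux₂ : ∀ κ ℓ u F x → ι 8 * κ * ℓ * (ι 4 * (u * (ι 12 * (F * x)))) ≡ F * (ι 384 * κ * u * ℓ) * x
  aux₂ = solve 5 (λ κ ℓ u F x → con (ι 8) :* κ :* ℓ :* (con (ι 4) :* (u :* (con (ι 12) :* (F :* x))))
    := F :* (con (ι 384) :* κ :* u :* ℓ) :* x) refl

module Accuracy (c : ℝ) (0<c : 0ᴿ <ᴿ c) where

  m : ℕ
  m = proj₁ (reciprocal-power-bound {c} 0<c)

  -- 384 = 8 · 12 · 4, from the exponent 8 (m + 1) ℓ in `growth-contradiction`, from 12 F x = q and
  -- from 4 u q = 1.
  C : ℚ
  C = ι 384 * ι (suc m)

  0<C : 0ℚ < C
  0<C = *-pos (positive⁻¹ (ι 384)) (<-≤-trans 0<1 (ι-mono′ {1} {suc m} (ℕ.s≤s ℕ.z≤n)))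

  module _ (q : ℚ) (0<q : 0ℚ < q) (n : ℕ) (2≤n : 2 ℕ.≤ n) (G : Graph n) where

    open Parameters q 0<q n

    1≤n : 1 ℕ.≤ n
    1≤n = ℕP.≤-trans (ℕP.n≤1+n 1) 2≤n

    S₀ : Subset n
    S₀ = proj₁ (densest 1≤n G)

    k₀ : ℕ
    k₀ = proj₁ (proj₁ (proj₂ (densest 1≤n G)))

    ∣S₀∣≡ : Sub.∣ S₀ ∣ ≡ suc k₀
    ∣S₀∣≡ = proj₂ (proj₁ (proj₂ (densest 1≤n G)))

    open Utility exponent-* (edges G) S₀ ∣S₀∣≡

    T₀ t : ℚ
    T₀ = ι n * ι 2
    t = recip T₀

    0<T₀ : 0ℚ < T₀
    0<T₀ = *-pos (<-≤-trans 0<1 (ι-mono′ 1≤n)) (positive⁻¹ (ι 2))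

    0≤t : 0ℚ ≤ t
    0≤t = recip-nonNeg T₀

    tT≡1 : t * T₀ ≡ 1ℚ
    tT≡1 = recip-inverse 0<T₀

    -- A decidable stand-in for the real accuracy bound, with slack t^(m + 1) for each of the two
    -- draws.
    Good : Subset n → Set
    Good S = t ^ suc m * (t ^ suc m * Q₀) ≤ quality Sub.∣ S ∣ (edges G S)

    good? : ∀ S → Dec (Good S)
    good? S = t ^ suc m * (t ^ suc m * Q₀) ≤? quality Sub.∣ S ∣ (edges G S)

    event : Subset n → Bool
    event S = isYes (nonempty? S ×-dec good? S)

    event-good : ∀ S → T (event S) → Nonempty S × Good S
    event-good S = toWitness {a? = nonempty? S ×-dec good? S}

    event-bad : ∀ S → T (not (event S)) → Bad 1≤n 0≤t tT≡1 m S
    event-bad S S∉ = cases (nonempty? S)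
      where
      cases : Dec (Nonempty S) → Bad 1≤n 0≤t tT≡1 m S
      cases (no empty) = inj₁ (empty-size S empty)
      cases (yes ne)   = inj₂ (<⇒≤ (≰⇒> λ good → toWitnessFalse {a? = nonempty? S ×-dec good? S} S∉ (ne , good)))

    -- Bad sets have probability at most 3 t^m, and 1 ≤ 2 P T₀^m gives t^m ≤ 2 P. With P an
    -- approximation of n^(-c), this is the 6 of the theorem.
    event-likely : ∀ {P} → ½ ≤ P * T₀ ^ m →
      1ℚ + - (ι 6 * P) ≤ sum (probability (edges G)) (filterᵇ event (subsets n))
    event-likely {P} ½≤ = ≤-by bad≤6P (trans (aux (ι 6 * P) bad)
        (trans (cong (λ z → z - bad - (1ℚ + - (ι 6 * P))) (sym good+bad)) (aux′ good bad (1ℚ + - (ι 6 * P)))))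
      where
      good bad : ℚ
      good = sum (probability (edges G)) (filterᵇ event (subsets n))
      bad = sum (probability (edges G)) (filterᵇ (λ S → not (event S)) (subsets n))
      good+bad : good + bad ≡ 1ℚ
      good+bad = trans (sym (sum-split (probability (edges G)) event (subsets n))) (Σprobability S₀ ∣S₀∣≡ (edges G))
      aux : ∀ a b → a - b ≡ 1ℚ - b - (1ℚ + - a)
      aux = solve 2 (λ a b → a :- b := con 1ℚ :- b :- (con 1ℚ :+ :- a)) refl
      aux′ : ∀ g b z → (g + b) - b - z ≡ g - z
      aux′ = solve 3 (λ g b z → (g :+ b) :- b :- z := g :- z) refl
      aux″ : ∀ t P T → t * (P * T + P * T) * ι 3 ≡ ι 6 * P * (t * T)
      aux″ = solve 3 (λ t P T → t :* (P :* T :+ P :* T) :* con (ι 3) := con (ι 6) :* P :* (t :* T)) refl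
      bad≤6P : bad ≤ ι 6 * P
      bad≤6P = ≤-trans (Σbad≤ 1≤n 0≤t tT≡1 m (λ S → not (event S)) event-bad)
        (≤-trans (*-monoʳ {ι 3} {t ^ m} {t ^ m * (P * T₀ ^ m + P * T₀ ^ m)} (0≤ι 3)
            (subst (_≤ t ^ m * (P * T₀ ^ m + P * T₀ ^ m)) (*-identityʳ (t ^ m))
              (*-monoˡ {t ^ m} {1ℚ} {P * T₀ ^ m + P * T₀ ^ m} (^-nonNeg 0≤t m)
                (+-mono-≤ {½} {P * T₀ ^ m} {½} {P * T₀ ^ m} ½≤ ½≤))))
          (≤-reflexive (trans (aux″ (t ^ m) P (T₀ ^ m))
            (trans (cong (ι 6 * P *_) (^-inverse tT≡1 m)) (*-identityʳ (ι 6 * P))))))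

    -- F times the gap C u ℓ to the maximal density is at most the deficit f₀ - f between the
    -- exponents of `quality`. Goodness bounds this deficit through `power-gap`, and C is large
    -- enough for `growth-contradiction` to apply.
    good-dense : ∀ {S u ℓ k} → Nonempty S → Good S → ι 4 * (u * q) ≡ 1ℚ → 0ℚ < u → 0ℚ < ℓ →
      C * u * ℓ ≡ maxDensity G - density G S → ¬ ι n < psum (ℓ + ℓ) k
    good-dense {S} {u} {ℓ} {k} ne good 4uq≡1 0<u 0<ℓ gap≡ n<psum =
      ⊎-rec f≰f₀ f₀≰f (ℕP.≤-total f f₀)
      where
      k₁ : ℕ
      k₁ = proj₁ (nonempty-size S ne)
      ∣S∣≡ : Sub.∣ S ∣ ≡ suc k₁
      ∣S∣≡ = proj₂ (nonempty-size S ne)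
      f f₀ : ℕ
      f  = exponent (suc k₁) ℕ.* edges G S
      f₀ = exponent (suc k₀) ℕ.* edges G S₀
      Δ : ℚ
      Δ = C * u * ℓ
      0<Δ : 0ℚ < Δ
      0<Δ = *-pos (*-pos 0<C 0<u) 0<ℓ
      FΔ≤ : ι scale * Δ ≤ ι f₀ - ι f
      FΔ≤ = subst₂ _≤_ (cong (ι scale *_) (sym gap≡))
        (trans (aux (ι scale) (density G S₀) (density G S))
          (sym (cong₂ _-_ (scaled-density G S₀ ∣S₀∣≡) (scaled-density G S ∣S∣≡))))
        (*-monoˡ {ι scale} (0≤ι scale) (+-monoˡ-≤ (- density G S) (proj₂ (proj₂ (densest 1≤n G)))))
        where
        aux : ∀ F a b → F * (a - b) ≡ F * a - F * b
        aux = solve 3 (λ F a b → F :* (a :- b) := F :* a :- F :* b) refl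
      -- Truncated subtraction requires knowing the order of the exponents; this order contradicts
      -- the positive gap.
      f₀≰f : ¬ f₀ ℕ.≤ f
      f₀≰f f₀≤f = <-irrefl refl (<-≤-trans (*-pos 0<scale 0<Δ)
        (≤-trans FΔ≤ (subst (ι f₀ - ι f ≤_) (+-inverseʳ (ι f)) (+-monoˡ-≤ (- ι f) (ι-mono′ f₀≤f)))))
      f≰f₀ : ¬ f ℕ.≤ f₀
      f≰f₀ f≤f₀ = growth-contradiction {n} {m} {ℓ} {x} {f₀ ℕ.∸ f} {k} 2≤n (<⇒≤ 0<ℓ) 0≤x x+x≤1 n<psum
        (≤-trans (≤-reflexive (constants (suc m) {ℓ} {u} {q} {ι scale} {x} 12Fx≡q 4uq≡1))
          (*-monoʳ {x} {ι scale * Δ} {ι (f₀ ℕ.∸ f)} 0≤x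
          (≤-trans FΔ≤ (≤-reflexive f₀-f))))
        (power-gap {base} {t ^ suc m} {T₀} {suc m} {f} {f₀} (<-≤-trans 0<1 1≤base) (<⇒≤ 0<T₀)
          (^-inverse {t} {T₀} tT≡1 (suc m)) f≤f₀
          (subst (λ i → t ^ suc m * (t ^ suc m * Q₀) ≤ quality i (edges G S)) ∣S∣≡ good))
        where
        f₀-f : ι f₀ - ι f ≡ ι (f₀ ℕ.∸ f)
        f₀-f = trans (cong (_- ι f) (trans (cong ι (sym (ℕP.m∸n+n≡m f≤f₀))) (ι-+ (f₀ ℕ.∸ f) f)))
          (solve 2 (λ a b → (a :+ b) :- b := a) refl (ι (f₀ ℕ.∸ f)) (ι f))

mainTheorem1 :
    (c : ℝ) → 0ᴿ <ᴿ c →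
    ∃[ C ] ((δ : ℝ) (0<δ : 0ᴿ <ᴿ δ) → δ <ᴿ 1ᴿ →
      (ε : ℝ) (0<ε : 0ᴿ <ᴿ ε) →
      ∃[ 𝒜 ] (EdgePrivate ε δ 𝒜 ×
        (∀ n (2≤n : 2 ℕ.≤ n) (G : Graph n) →
          PrAtLeast (𝒜 n 2≤n G)
            (λ S → Nonempty S ×
              ofℚ (maxDensity G)
                -ᴿ C *ᴿ (√ (log (ofℕ n) *ᴿ log (ofℕ n ÷ᴿ δ ⟨ 0<δ ⟩)) ÷ᴿ ε ⟨ 0<ε ⟩)
                ≤ᴿ ofℚ (density G S))
            (1ᴿ -ᴿ ofℕ 6 *ᴿ n ^ᴿ (-ᴿ c)))))
mainTheorem1 c 0<c = ofℚ C , λ δ 0<δ δ<1 ε 0<ε →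
  let (q , 0<q , N , bounds) = dyadic-bounds {ε} 0<ε
      q≤ε = λ k N≤k → proj₁ (bounds k N≤k)
  in mechanism ε q 0<q N q≤ε , mechanism-private ε q 0<q N q≤ε {δ} 0<δ , λ n 2≤n G →
    event q 0<q n 2≤n G ,
    (λ S S∈ →
      let (ne , good) = event-good q 0<q n 2≤n G S S∈
      in ne , accurate δ 0<δ δ<1 ε 0<ε q 0<q N (λ k N≤k → proj₂ (bounds k N≤k)) n 2≤n G S ne good) ,
    likely ε q 0<q N q≤ε n 2≤n G
  where
  open Accuracy c 0<c
  accurate : ∀ δ (0<δ : 0ᴿ <ᴿ δ) → δ <ᴿ 1ᴿ → ∀ ε (0<ε : 0ᴿ <ᴿ ε) q (0<q : 0ℚ < q) N →
    (∀ k → N ℕ.≤ k → seq ε k ≤ q + q) → ∀ n 2≤n G S → Nonempty S → Good q 0<q n 2≤n G S →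
    ofℚ (maxDensity G) -ᴿ ofℚ C *ᴿ (√ (log (ofℕ n) *ᴿ log (ofℕ n ÷ᴿ δ ⟨ 0<δ ⟩)) ÷ᴿ ε ⟨ 0<ε ⟩)
      ≤ᴿ ofℚ (density G S)
  accurate δ 0<δ δ<1 ε 0<ε q 0<q N ε≤2q n 2≤n G S ne good violated =
    -- From ε ≤ 2 q follows 1/ε ≥ v = 1 / (2 q). Halving v gives the strict room that
    -- `inv-eventually-above` asks for, and 4 u q = 1.
    let (v , 0<v , v[q+q]≡1) = reciprocal {q + q} (<-trans 0<q (p<p+q q 0<q))
        (u , 0<u , v≡u+u) = halve 0<v
        1/ε≥u = inv-eventually-above {ε} {q + q} {u} {v} 0<ε (N , ε≤2q) (<⇒≤ 0<v) v[q+q]≡1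
          (subst (u <_) (sym v≡u+u) (p<p+q u 0<u))
        (ℓ , 0<ℓ , gap≡ , √<ℓ) = violation {maxDensity G} {density G S} {C} {u} {ε}
          (√ (log (ofℕ n) *ᴿ log (ofℕ n ÷ᴿ δ ⟨ 0<δ ⟩))) 0<ε
          (√-nonNeg (log (ofℕ n) *ᴿ log (ofℕ n ÷ᴿ δ ⟨ 0<δ ⟩)))
          (*-pos 0<C 0<u) (<⇒≤ 0<C) 1/ε≥u violated
        (k , n<psum) = √log-bound {n} {δ} 0<δ δ<1 {ℓ} 0<ℓ √<ℓ
    in good-dense q 0<q n 2≤n G {S} {u} {ℓ} {k} ne good
         (trans (aux u q) (trans (cong (_* (q + q)) (sym v≡u+u)) v[q+q]≡1)) 0<u 0<ℓ gap≡ n<psum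
    where
    aux : ∀ u q → ι 4 * (u * q) ≡ (u + u) * (q + q)
    aux = solve 2 (λ u q → con (ι 4) :* (u :* q) := (u :+ u) :* (q :+ q)) refl
  likely : ∀ ε q (0<q : 0ℚ < q) N q≤ε n 2≤n (G : Graph n) →
    1ᴿ -ᴿ ofℕ 6 *ᴿ n ^ᴿ (-ᴿ c) ≤ᴿ Pr (mechanism ε q 0<q N q≤ε n 2≤n G) (event q 0<q n 2≤n G)
  likely ε q 0<q N q≤ε n 2≤n G =
    let (K , ½≤) = proj₂ (reciprocal-power-bound {c} 0<c) n (ℕP.≤-trans (ℕP.n≤1+n 1) 2≤n)
        O = event q 0<q n 2≤n G
    in ≤ᴿ-eventually (1ᴿ -ᴿ ofℕ 6 *ᴿ n ^ᴿ (-ᴿ c)) (Pr (mechanism ε q 0<q N q≤ε n 2≤n G) O) K (λ k K≤k →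
      subst (1ℚ + - (ι 6 * seq (n ^ᴿ (-ᴿ c)) k) ≤_)
        (sym (sumᴿ-ofℚ (Parameters.probability q 0<q n (edges G)) (filterᵇ O (subsets n)) k))
        (event-likely q 0<q n 2≤n G {seq (n ^ᴿ (-ᴿ c)) k} (½≤ k K≤k)))
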